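{- Let $\beta\in S_n$ have cycle type $(c_1,\dots,c_n)$. Then \[ c(4,\beta)=c([4],\beta)+c([3,1],\beta)+c([2,2],\beta)+c([2,1,1],\beta), \] where \begin{align*} c([4],\beta)&=|C_{S_n}(\beta)|\sum_{i\ge4}c_i\binom{i}{4},\\ c([3,1],\beta)&=|C_{S_n}(\beta)|\sum_{i\ge1,\ j\ge i+2}ij(j-i-1)c_ic_j,\\ c([2,2],\beta)&=|C_{S_n}(\beta)|\Big(\sum_{i\ge2}i\binom{i}{2}\binom{c_i}{2}+\sum_{j>i\ge2}i(i-1)j\,c_ic_j\Big),\\ c([2,1,1],\beta)&=|C_{S_n}(\beta)|\Big(\sum_{i\ge1}i^3c_{2i}\binom{c_i}{2}+\sum_{j>i\ge1}ij(i+j)c_ic_jc_{i+j}\Big). \end{align*}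
   Context: $S_n$ is the symmetric group on $[n]$, products composed right to left. The cycle type $(c_1,\dots,c_n)$ means $\beta$ has exactly $c_i$ cycles of length $i$ (fixed points counted as $1$-cycles), with $c_i=0$ for $i>n$. $C_{S_n}(\beta)$ is the centralizer of $\beta$. A point $a$ is a bad commuting point of $\alpha,\beta$ if $\alpha\beta(a)\ne\beta\alpha(a)$; $\alpha$ $k$-commutes with $\beta$ if there are exactly $k$ bad commuting points, and $c(k,\beta)$ is the number of $\alpha\in S_n$ that $k$-commute with $\beta$. For an unordered integer partition $[k_1,\dots,k_h]$ of $k$ with all $k_i\ge1$, $c([k_1,\dots,k_h],\beta)$ is the number of $\alpha\in S_n$ that $k$-commute with $\beta$ such that the bad commuting points lie in exactly $h$ cycles $\beta_1,\dots,\beta_h$ of $\beta$, with $\beta_i$ containing exactly $k_i$ of them. -}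

module Defs where

open import Data.Nat using (ℕ; zero; suc; _+_; _*_; _∸_; _≤ᵇ_; _≡ᵇ_)
open import Data.Fin using (Fin; toℕ) renaming (zero to fzero; suc to fsuc)
open import Data.Fin.Properties using (_≟_)
open import Data.Bool using (Bool; true; false; _∧_; _∨_; not; if_then_else_)
open import Data.List using (List; []; _∷_; map; allFin; concatMap; upTo)
open import Data.Nat.ListAction using (sum)
open import Data.Bool.ListAction using (and; or)
open import Relation.Nullary using (does)

iter : ∀ {n} → (Fin n → Fin n) → ℕ → Fin n → Fin n
iter f zero a = a
iter f (suc k) a = f (iter f k a)

_==_ : ∀ {n} → Fin n → Fin n → Bool
a == b = does (a ≟ b)

countFin : ∀ n → (Fin n → Bool) → ℕ
countFin n p = sum (map (λ a → if p a then 1 else 0) (allFin n))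

allFin? : ∀ n → (Fin n → Bool) → Bool
allFin? n p = and (map p (allFin n))

anyFin? : ∀ n → (Fin n → Bool) → Bool
anyFin? n p = or (map p (allFin n))

allFuns : ∀ m n → List (Fin m → Fin n)
allFuns zero n = (λ ()) ∷ []
allFuns (suc m) n =
  concatMap (λ b → map (λ f → λ { fzero → b ; (fsuc i) → f i }) (allFuns m n)) (allFin n)

-- a self-map of [n] is a permutation iff it is injective
isPerm : ∀ {n} → (Fin n → Fin n) → Bool
isPerm {n} f = allFin? n (λ a → allFin? n (λ b → not (f a == f b) ∨ (a == b)))

countPerms : ∀ n → ((Fin n → Fin n) → Bool) → ℕ
countPerms n P = sum (map (λ α → if isPerm α ∧ P α then 1 else 0) (allFuns n n))

sameCycle : ∀ {n} → (Fin n → Fin n) → Fin n → Fin n → Bool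
sameCycle {n} β a b = or (map (λ k → iter β k a == b) (upTo n))

cycleLen : ∀ {n} → (Fin n → Fin n) → Fin n → ℕ
cycleLen {n} β a = countFin n (sameCycle β a)

isRep : ∀ {n} → (Fin n → Fin n) → Fin n → Bool
isRep {n} β a = allFin? n (λ b → not (sameCycle β a b) ∨ (toℕ a ≤ᵇ toℕ b))

-- c_i : number of cycles of β of length i (fixed points are 1-cycles; 0 for i = 0 or i > n)
cycleCount : ∀ {n} → (Fin n → Fin n) → ℕ → ℕ
cycleCount {n} β i = countFin n (λ a → isRep β a ∧ (cycleLen β a ≡ᵇ i))

centralizerSize : ∀ {n} → (Fin n → Fin n) → ℕ
centralizerSize {n} β = countPerms n (λ α → allFin? n (λ a → α (β a) == β (α a)))

isBad : ∀ {n} → (Fin n → Fin n) → (Fin n → Fin n) → Fin n → Bool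
isBad α β a = not (α (β a) == β (α a))

numBad : ∀ {n} → (Fin n → Fin n) → (Fin n → Fin n) → ℕ
numBad {n} α β = countFin n (isBad α β)

cK : ∀ {n} → ℕ → (Fin n → Fin n) → ℕ
cK {n} k β = countPerms n (λ α → numBad α β ≡ᵇ k)

badProfile : ∀ {n} → (Fin n → Fin n) → (Fin n → Fin n) → List ℕ
badProfile {n} α β = concatMap f (allFin n)
  where
  f : Fin n → List ℕ
  f r with isRep β r | countFin n (λ b → sameCycle β r b ∧ isBad α β b)
  ... | true  | suc m = suc m ∷ []
  ... | true  | zero  = []
  ... | false | _     = []

insert : ℕ → List ℕ → List ℕ
insert x [] = x ∷ []
insert x (y ∷ ys) = if x ≤ᵇ y then x ∷ y ∷ ys else y ∷ insert x ys

sortℕ : List ℕ → List ℕ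
sortℕ [] = []
sortℕ (x ∷ xs) = insert x (sortℕ xs)

_==L_ : List ℕ → List ℕ → Bool
[] ==L [] = true
(x ∷ xs) ==L (y ∷ ys) = (x ≡ᵇ y) ∧ (xs ==L ys)
_ ==L _ = false

-- c([k_1,…,k_h], β): α that k-commute with β (k = Σ k_i) and whose bad points lie in
-- exactly h cycles of β, containing k_1,…,k_h of them (as a multiset)
cPart : ∀ {n} → List ℕ → (Fin n → Fin n) → ℕ
cPart {n} ks β =
  countPerms n (λ α → (numBad α β ≡ᵇ sum ks) ∧ (sortℕ (badProfile α β) ==L sortℕ ks))

-- Σ_{i = lo}^{hi} f i  (empty if hi < lo)
sumFromTo : ℕ → ℕ → (ℕ → ℕ) → ℕ
sumFromTo lo hi f = sum (map (λ t → f (lo + t)) (upTo (suc hi ∸ lo)))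

{-# OPTIONS --safe #-}
module Submission where

open import Defs
open import Data.Bool using (Bool; true; false; _∧_; _∨_; not; if_then_else_; T)
open import Data.Bool.Properties using (T?; not-involutive; not-¬)
open import Data.Fin using (Fin; toℕ; cast) renaming (zero to fzero; suc to fsuc)
open import Data.Fin.Permutation.Components using (transpose; transpose-inverse)
open import Data.Fin.Properties using (_≟_; all?; any?; pigeonhole; toℕ<n; toℕ-injective; toℕ-cast)
open import Data.List as List using (List; filter; length; []; _∷_; _++_; map; concatMap; allFin; upTo)
open import Data.List.Membership.Propositional using (_∈_; lose)
open import Data.List.Membership.Propositional.Properties using (∈-lookup; ∈-filter⁺; ∈-filter⁻; ∈-allFin; ∈-upTo⁺; ∈-upTo⁻)
open import Data.List.Properties using (map-++; map-∘; map-cong; map-id; map-applyUpTo; concatMap-cong; length-upTo)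
open import Data.List.Relation.Unary.All as All using (All; []; _∷_)
import Data.List.Relation.Unary.All.Properties as All
open import Data.List.Relation.Unary.AllPairs using ([]; _∷_)
open import Data.List.Relation.Unary.Any using (here; there; satisfied; index)
import Data.List.Relation.Unary.Any as Any
open import Data.List.Relation.Unary.Any.Properties using (any⁺; any⁻; lookup-index)
open import Data.List.Relation.Unary.Unique.Propositional using (Unique)
open import Data.List.Relation.Unary.Unique.Propositional.Properties using (allFin⁺; upTo⁺; filter⁺)
open import Data.Nat using (ℕ; zero; suc; _+_; _*_; _∸_; _^_; _≤_; _<_; z≤n; s≤s; _≡ᵇ_; _≤ᵇ_; _≤?_; _<?_; NonZero; _%_; _/_)
open import Data.Nat.Combinatorics using (_C_; nC1≡n; k>n⇒nCk≡0; nCk+nC[k+1]≡[n+1]C[k+1])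
open import Data.Nat.DivMod using (m≡m%n+[m/n]*n; m%n<n)
open import Data.Nat.ListAction using (sum)
open import Data.Nat.ListAction.Properties using (sum-++)
open import Data.Nat.Properties hiding (_≟_; _≤?_; _<?_)
import Data.Nat.Properties as ℕ
open import Data.Nat.Solver using (module +-*-Solver)
open import Data.Product using (∃; ∃₂; _×_; _,_; proj₁; proj₂)
open import Data.Sum using (_⊎_; inj₁; inj₂; [_,_]′)
open import Data.Unit using (tt)
open import Function using (_∘_; id; mk⇔)
open import Function.Definitions using (Injective)
open import Relation.Binary using (Tri; tri<; tri≈; tri>)
open import Relation.Binary.PropositionalEquality using (_≡_; _≢_; refl; sym; trans; cong; cong₂; subst; subst₂; _≗_; ≢-sym;
  module ≡-Reasoning)
open import Relation.Nullary using (Dec; yes; no; does; ¬_; contradiction)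
open import Relation.Nullary.Decidable using (map′; _×-dec_; _⊎-dec_; ¬?; dec-true; dec-false; decidable-stable; does-⇔)
open +-*-Solver using (solve; _:=_; _:+_; _:*_; con)
open ≡-Reasoning

-- A permutation α commutes badly with β exactly where β and γ = α⁻¹βα differ, so c(·, β) is |C(β)| times the
-- number of conjugates γ of β with the prescribed differences. If γ = βτ moves four points, τ is a 4-cycle or a
-- product (a b)(c d); every transposition changes the number of cycles by one, so a parity argument excludes the
-- 4-cycle. Multiplying by a transposition splits a cycle of length p + q into cycles of lengths p and q, or merges
-- two such cycles; β(a b)(c d) is conjugate to β iff one transposition splits, the other merges, and the lengths
-- match. Each product arises from 8 quadruples (a, b, c, d), which are counted according to how β's cycles
-- partition them.

-- Every count is a sum of 0-1 indicators over points, exponents or self-maps, and sets are compared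
-- by exchanging sums and collapsing delta functions; self-maps are compared pointwise throughout.
-- Working in the natural numbers, without negative terms or division, shapes the lemmas: a change
-- of cycle counts is stated with the lost cycles on the other side, cycles are counted through
-- their points (those of length m carry m times as many), and multiplicities stay in front as
-- factors until they cancel. Whether (c d) splits or merges is decided by β(a b), not by β, so
-- lengths have to be followed through this intermediate permutation. If the four points lie on four
-- different cycles, both transpositions merge; this is why [1,1,1,1] is absent from the theorem.
-- Dually, in [2,2] the arrangement with a, b on one cycle and c, d on another contributes nothing,
-- since both transpositions split.

⟦_⟧ : Bool → ℕ
⟦ b ⟧ = if b then 1 else 0

⟨_⟩ : ∀ {P : Set} → Dec P → ℕ
⟨ p ⟩ = ⟦ does p ⟧

⟦∧⟧ : ∀ b c → ⟦ b ∧ c ⟧ ≡ ⟦ b ⟧ * ⟦ c ⟧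
⟦∧⟧ true  c = sym (+-identityʳ ⟦ c ⟧)
⟦∧⟧ false c = refl

⟦⟧-guard : ∀ b {x y} → (b ≡ true → x ≡ y) → ⟦ b ⟧ * x ≡ ⟦ b ⟧ * y
⟦⟧-guard true  eq = cong (1 *_) (eq refl)
⟦⟧-guard false eq = refl

module _ {P : Set} where

  ⟨⟩-yes : (p : Dec P) → P → ⟨ p ⟩ ≡ 1
  ⟨⟩-yes p x = cong ⟦_⟧ (dec-true p x)

  ⟨⟩-no : (p : Dec P) → ¬ P → ⟨ p ⟩ ≡ 0
  ⟨⟩-no p x = cong ⟦_⟧ (dec-false p x)

  -- Replaces summation over a restricted range: a summand may be rewritten with the help of the
  -- very condition that its indicator tests.
  ⟨⟩-guard : (p : Dec P) {x y : ℕ} → (P → x ≡ y) → ⟨ p ⟩ * x ≡ ⟨ p ⟩ * y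
  ⟨⟩-guard (yes p) eq = cong (1 *_) (eq p)
  ⟨⟩-guard (no _)  eq = refl

  ⟨⟩-case : (p : Dec P) {x y : ℕ} → (P → x ≡ y) → (¬ P → 0 ≡ y) → ⟨ p ⟩ * x ≡ y
  ⟨⟩-case (yes p) f g = trans (+-identityʳ _) (f p)
  ⟨⟩-case (no ¬p) f g = g ¬p

  ⟨⟩-is : (p : Dec P) {x : ℕ} → (P → x ≡ 1) → (¬ P → x ≡ 0) → ⟨ p ⟩ ≡ x
  ⟨⟩-is (yes p) f g = sym (f p)
  ⟨⟩-is (no ¬p) f g = sym (g ¬p)

  ⟨⟩-¬ : (p : Dec P) → ⟨ ¬? p ⟩ + ⟨ p ⟩ ≡ 1
  ⟨⟩-¬ (yes _) = refl
  ⟨⟩-¬ (no _)  = refl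

  ⟨⟩-cong : ∀ {Q : Set} → (P → Q) → (Q → P) → (p : Dec P) (q : Dec Q) → ⟨ p ⟩ ≡ ⟨ q ⟩
  ⟨⟩-cong f g p (yes y) = ⟨⟩-yes p (g y)
  ⟨⟩-cong f g p (no ¬y) = ⟨⟩-no p (¬y ∘ f)

  ⟨⟩-× : ∀ {Q : Set} (p : Dec P) (q : Dec Q) → ⟨ p ×-dec q ⟩ ≡ ⟨ p ⟩ * ⟨ q ⟩
  ⟨⟩-× p q = ⟦∧⟧ (does p) (does q)

  ⟨⟩-⊎ : ∀ {Q : Set} (p : Dec P) (q : Dec Q) → (P → ¬ Q) → ⟨ p ⊎-dec q ⟩ ≡ ⟨ p ⟩ + ⟨ q ⟩
  ⟨⟩-⊎ (yes x) (yes y) h = contradiction y (h x)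
  ⟨⟩-⊎ (yes _) (no _)  h = refl
  ⟨⟩-⊎ (no _)  (yes _) h = refl
  ⟨⟩-⊎ (no _)  (no _)  h = refl

⟦⟧-T : ∀ b {P : Set} (q : Dec P) → (T b → P) → (P → T b) → ⟦ b ⟧ ≡ ⟨ q ⟩
⟦⟧-T b q f g = ⟨⟩-cong f g (T? b) q

-- Finite sums of natural numbers

opaque

  -- Kept opaque so that sums over `allFin n` stay folded; `∑-def` connects them with the sums
  -- written out in the definitions.
  ∑ : {A : Set} → List A → (A → ℕ) → ℕ
  ∑ xs f = sum (map f xs)

  ∑-def : {A : Set} (xs : List A) (f : A → ℕ) → ∑ xs f ≡ sum (map f xs)
  ∑-def xs f = refl

module _ {A : Set} where

  opaque
    unfolding ∑

    ∑-cong-∈ : ∀ xs {f g : A → ℕ} → (∀ x → x ∈ xs → f x ≡ g x) → ∑ xs f ≡ ∑ xs g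
    ∑-cong-∈ []       eq = refl
    ∑-cong-∈ (x ∷ xs) eq = cong₂ _+_ (eq x (here refl)) (∑-cong-∈ xs (λ y → eq y ∘ there))

    ∑-cong : ∀ xs {f g : A → ℕ} → f ≗ g → ∑ xs f ≡ ∑ xs g
    ∑-cong xs eq = ∑-cong-∈ xs (λ x _ → eq x)

    ∑-zero : ∀ xs {f : A → ℕ} → (∀ x → f x ≡ 0) → ∑ xs f ≡ 0
    ∑-zero []       eq = refl
    ∑-zero (x ∷ xs) eq = cong₂ _+_ (eq x) (∑-zero xs eq)

    ∑-+ : ∀ xs (f g : A → ℕ) → ∑ xs (λ x → f x + g x) ≡ ∑ xs f + ∑ xs g
    ∑-+ []       f g = refl
    ∑-+ (x ∷ xs) f g = begin
      f x + g x + ∑ xs (λ x → f x + g x) ≡⟨ cong (f x + g x +_) (∑-+ xs f g) ⟩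
      f x + g x + (∑ xs f + ∑ xs g) ≡⟨ solve 4 (λ a b c d → a :+ b :+ (c :+ d) := a :+ c :+ (b :+ d)) refl (f x) (g x) (∑ xs f)
        (∑ xs g) ⟩
      f x + ∑ xs f + (g x + ∑ xs g) ∎

    ∑-*ˡ : ∀ xs k (f : A → ℕ) → ∑ xs (λ x → k * f x) ≡ k * ∑ xs f
    ∑-*ˡ []       k f = sym (*-zeroʳ k)
    ∑-*ˡ (x ∷ xs) k f = trans (cong (k * f x +_) (∑-*ˡ xs k f)) (sym (*-distribˡ-+ k (f x) (∑ xs f)))

    ∑-*ʳ : ∀ xs k (f : A → ℕ) → ∑ xs (λ x → f x * k) ≡ ∑ xs f * k
    ∑-*ʳ xs k f = trans (∑-cong xs (λ x → *-comm (f x) k)) (trans (∑-*ˡ xs k f) (*-comm k (∑ xs f)))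

    ∑-map : ∀ {B : Set} (g : B → A) (f : A → ℕ) ys → ∑ (map g ys) f ≡ ∑ ys (f ∘ g)
    ∑-map g f ys = cong sum (sym (map-∘ ys))

    ∑-++ : ∀ xs ys (f : A → ℕ) → ∑ (xs ++ ys) f ≡ ∑ xs f + ∑ ys f
    ∑-++ xs ys f = trans (cong sum (map-++ f xs ys)) (sum-++ (map f xs) (map f ys))

    ∑-≤ : ∀ xs {f g : A → ℕ} → (∀ x → f x ≤ g x) → ∑ xs f ≤ ∑ xs g
    ∑-≤ []       le = z≤n
    ∑-≤ (x ∷ xs) le = +-mono-≤ (le x) (∑-≤ xs le)

  module _ (_≈?_ : (x y : A) → Dec (x ≡ y)) where

    opaque
      unfolding ∑

      ∑-δ-∉ : ∀ {xs a} (f : A → ℕ) → ¬ a ∈ xs → ∑ xs (λ x → ⟨ x ≈? a ⟩ * f x) ≡ 0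
      ∑-δ-∉ {xs} {a} f a∉ = trans (∑-cong-∈ xs {g = λ _ → 0} (λ x x∈ → cong (_* f x) (⟨⟩-no (x ≈? a) (λ { refl → a∉ x∈ }))))
        (∑-zero xs (λ _ → refl))

      -- The sifting property of the Kronecker delta; uniqueness keeps `a` from being hit twice.
      -- Changes of variables are made by inserting such a sum and exchanging the order.
      ∑-δ : ∀ {xs a} (f : A → ℕ) → Unique xs → a ∈ xs → ∑ xs (λ x → ⟨ x ≈? a ⟩ * f x) ≡ f a
      ∑-δ {x ∷ xs} {a} f (x∉ ∷ u) (here refl) = begin
        ⟨ a ≈? a ⟩ * f a + ∑ xs (λ x → ⟨ x ≈? a ⟩ * f x) ≡⟨ cong₂ _+_ (cong (_* f a) (⟨⟩-yes (a ≈? a) refl))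
          (∑-δ-∉ f (λ a∈ → All.lookup x∉ a∈ refl)) ⟩
        1 * f a + 0 ≡⟨ trans (+-identityʳ _) (*-identityˡ (f a)) ⟩
        f a ∎
      ∑-δ {x ∷ xs} {a} f (x∉ ∷ u) (there a∈) = begin
        ⟨ x ≈? a ⟩ * f x + ∑ xs (λ x → ⟨ x ≈? a ⟩ * f x) ≡⟨ cong (λ z → z * f x + ∑ xs (λ x → ⟨ x ≈? a ⟩ * f x))
          (⟨⟩-no (x ≈? a) (All.lookup x∉ a∈)) ⟩
        ∑ xs (λ x → ⟨ x ≈? a ⟩ * f x) ≡⟨ ∑-δ f u a∈ ⟩
        f a ∎

opaque
  unfolding ∑

  ∑-1 : ∀ {A : Set} (xs : List A) → ∑ xs (λ _ → 1) ≡ length xs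
  ∑-1 []       = refl
  ∑-1 (x ∷ xs) = cong suc (∑-1 xs)

  ∑-swap : ∀ {A B : Set} xs ys (f : A → B → ℕ) → ∑ xs (λ x → ∑ ys (f x)) ≡ ∑ ys (λ y → ∑ xs (λ x → f x y))
  ∑-swap []       ys f = sym (∑-zero ys (λ _ → refl))
  ∑-swap (x ∷ xs) ys f = trans (cong (∑ ys (f x) +_) (∑-swap xs ys f)) (sym (∑-+ ys (f x) (λ y → ∑ xs (λ x → f x y))))

  ∑-concatMap : ∀ {A B : Set} (g : B → List A) (f : A → ℕ) ys → ∑ (concatMap g ys) f ≡ ∑ ys (λ y → ∑ (g y) f)
  ∑-concatMap g f []       = refl
  ∑-concatMap g f (y ∷ ys) = trans (∑-++ (g y) (concatMap g ys) f) (cong (∑ (g y) f +_) (∑-concatMap g f ys))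

∑ᶠ : ∀ {n} → (Fin n → ℕ) → ℕ
∑ᶠ {n} = ∑ (allFin n)

∑ᵘ : ℕ → (ℕ → ℕ) → ℕ
∑ᵘ n = ∑ (upTo n)

module _ {n : ℕ} where

  ∑ᶠ-cong : {f g : Fin n → ℕ} → f ≗ g → ∑ᶠ f ≡ ∑ᶠ g
  ∑ᶠ-cong = ∑-cong (allFin n)

  ∑ᶠ-+ : ∀ (f g : Fin n → ℕ) → ∑ᶠ (λ x → f x + g x) ≡ ∑ᶠ f + ∑ᶠ g
  ∑ᶠ-+ = ∑-+ (allFin n)

  ∑ᶠ-*ˡ : ∀ k (f : Fin n → ℕ) → ∑ᶠ (λ x → k * f x) ≡ k * ∑ᶠ f
  ∑ᶠ-*ˡ = ∑-*ˡ (allFin n)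

  ∑ᶠ-*ʳ : ∀ k (f : Fin n → ℕ) → ∑ᶠ (λ x → f x * k) ≡ ∑ᶠ f * k
  ∑ᶠ-*ʳ = ∑-*ʳ (allFin n)

  ∑ᶠ-swap : ∀ (f : Fin n → Fin n → ℕ) → ∑ᶠ (λ x → ∑ᶠ (f x)) ≡ ∑ᶠ (λ y → ∑ᶠ (λ x → f x y))
  ∑ᶠ-swap = ∑-swap (allFin n) (allFin n)

∑ᶠ-δ : ∀ {n} (a : Fin n) f → ∑ᶠ (λ x → ⟨ x ≟ a ⟩ * f x) ≡ f a
∑ᶠ-δ {n} a f = ∑-δ _≟_ f (allFin⁺ n) (∈-allFin a)

∑ᵘ-cong : ∀ n {f g} → (∀ k → k < n → f k ≡ g k) → ∑ᵘ n f ≡ ∑ᵘ n g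
∑ᵘ-cong n eq = ∑-cong-∈ (upTo n) (λ k k∈ → eq k (∈-upTo⁻ k∈))

∑ᵘ-δ : ∀ {n k} f → k < n → ∑ᵘ n (λ x → ⟨ x ℕ.≟ k ⟩ * f x) ≡ f k
∑ᵘ-δ {n} f k<n = ∑-δ ℕ._≟_ f (upTo⁺ n) (∈-upTo⁺ k<n)

opaque
  unfolding ∑

  ∑ᵘ-suc : ∀ n f → ∑ᵘ (suc n) f ≡ f 0 + ∑ᵘ n (f ∘ suc)
  ∑ᵘ-suc n f = cong (λ l → f 0 + sum l) (trans (map-applyUpTo suc f n) (sym (map-applyUpTo id (f ∘ suc) n)))

∑ᵘ-1 : ∀ n → ∑ᵘ n (λ _ → 1) ≡ n
∑ᵘ-1 n = trans (∑-1 (upTo n)) (length-upTo n)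

-- Orbits of an injective map

-- With an unbounded exponent, reflexivity and transitivity are immediate. The search of `sameCycle`
-- among exponents below `n` is matched in `same?`, because periods are at most `n`.
Same : ∀ {n} → (Fin n → Fin n) → Fin n → Fin n → Set
Same β a b = ∃ λ k → iter β k a ≡ b

-- A certificate of cycle length: exhibiting one for a proposed `L` is how lengths are computed, by
-- way of `len-unique`.
record Period {n} (β : Fin n → Fin n) (a : Fin n) (L : ℕ) : Set where
  field
    positive : 0 < L
    return   : iter β L a ≡ a
    minimal  : ∀ k → 0 < k → k < L → iter β k a ≢ a
open Period

module _ {n} (β : Fin n → Fin n) where

  iter-+ : ∀ j k a → iter β (j + k) a ≡ iter β j (iter β k a)
  iter-+ zero    k a = refl
  iter-+ (suc j) k a = cong β (iter-+ j k a)

  iter-* : ∀ {L a} → iter β L a ≡ a → ∀ q → iter β (q * L) a ≡ a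
  iter-* r zero = refl
  iter-* {L} {a} r (suc q) = trans (iter-+ L (q * L) a) (trans (cong (iter β L) (iter-* r q)) r)

least : ∀ {P : ℕ → Set} → (∀ k → Dec (P k)) → ∀ m → P m → ∃ λ k → k ≤ m × P k × (∀ j → j < k → ¬ P j)
least P? zero pm = 0 , z≤n , pm , λ j ()
least P? (suc m) pm with P? 0
... | yes p0 = 0 , z≤n , p0 , λ j ()
... | no ¬p0 with least (P? ∘ suc) m pm
...   | k , k≤m , pk , min = suc k , s≤s k≤m , pk , λ { zero _ → ¬p0 ; (suc j) (s≤s j<k) → min j j<k }

module Orbits {n} (β : Fin n → Fin n) (inj : Injective _≡_ _≡_ β) where

  iter-injective : ∀ k {a b} → iter β k a ≡ iter β k b → a ≡ b
  iter-injective zero    eq = eq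
  iter-injective (suc k) eq = iter-injective k (inj eq)

  iter-cancel : ∀ {j k} a → j ≤ k → iter β j a ≡ iter β k a → iter β (k ∸ j) a ≡ a
  iter-cancel {j} {k} a j≤k eq = iter-injective j (begin
    iter β j (iter β (k ∸ j) a) ≡⟨ iter-+ β j (k ∸ j) a ⟨
    iter β (j + (k ∸ j)) a ≡⟨ cong (λ z → iter β z a) (m+[n∸m]≡n j≤k) ⟩
    iter β k a ≡⟨ eq ⟨
    iter β j a ∎)

  private
    returns : ∀ a → ∃ λ k → 0 < k × k ≤ n × iter β k a ≡ a
    returns a with pigeonhole (n<1+n n) (λ i → iter β (toℕ i) a)
    ... | i , j , i<j , eq = toℕ j ∸ toℕ i , m<n⇒0<n∸m i<j , ≤-trans (m∸n≤m (toℕ j) (toℕ i)) (≤-pred (toℕ<n j)) , iter-cancel a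
      (<⇒≤ i<j) eq

  hasPeriod : ∀ a → ∃ λ L → L ≤ n × Period β a L
  hasPeriod a with returns a
  ... | k , 0<k , k≤n , eq with least (λ j → (0 <? j) ×-dec (iter β j a ≟ a)) k (0<k , eq)
  ...   | L , L≤k , (0<L , r) , min = L , ≤-trans L≤k k≤n , record
    { positive = 0<L ; return = r ; minimal = λ j 0<j j<L e → min j j<L (0<j , e) }

  module _ {a L} (P : Period β a L) where

    private instance
      L≢0 : NonZero L
      L≢0 = Data.Nat.>-nonZero (positive P)

    iter-% : ∀ k → iter β k a ≡ iter β (k % L) a
    iter-% k = begin
      iter β k a ≡⟨ cong (λ z → iter β z a) (m≡m%n+[m/n]*n k L) ⟩
      iter β (k % L + k / L * L) a ≡⟨ iter-+ β (k % L) (k / L * L) a ⟩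
      iter β (k % L) (iter β (k / L * L) a) ≡⟨ cong (iter β (k % L)) (iter-* β (return P) (k / L)) ⟩
      iter β (k % L) a ∎

    Same-< : ∀ {b} → Same β a b → ∃ λ k → k < L × iter β k a ≡ b
    Same-< (k , eq) = k % L , m%n<n k L , trans (sym (iter-% k)) eq

    iter-injective-< : ∀ {j k} → j < L → k < L → iter β j a ≡ iter β k a → j ≡ k
    iter-injective-< {j} {k} j<L k<L eq with <-cmp j k
    ... | tri≈ _ e _ = e
    ... | tri< j<k _ _ = contradiction (iter-cancel a (<⇒≤ j<k) eq) (minimal P _ (m<n⇒0<n∸m j<k) (≤-<-trans (m∸n≤m k j) k<L))
    ... | tri> _ _ k<j = contradiction (iter-cancel a (<⇒≤ k<j) (sym eq)) (minimal P _ (m<n⇒0<n∸m k<j)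
      (≤-<-trans (m∸n≤m j k) j<L))

  Same-refl : ∀ {a} → Same β a a
  Same-refl = 0 , refl

  Same-trans : ∀ {a b c} → Same β a b → Same β b c → Same β a c
  Same-trans {a} (j , refl) (k , refl) = k + j , iter-+ β k j a

  Same-sym : ∀ {a b} → Same β a b → Same β b a
  Same-sym {a} (k , refl) with hasPeriod a
  -- When the period is `suc L`, one step back is `L` steps forward.
  ... | suc L , _ , P = k * L , (begin
    iter β (k * L) (iter β k a) ≡⟨ iter-+ β (k * L) k a ⟨
    iter β (k * L + k) a ≡⟨ cong (λ z → iter β z a) (trans (+-comm (k * L) k) (sym (*-suc k L))) ⟩
    iter β (k * suc L) a ≡⟨ iter-* β (return P) k ⟩
    a ∎)
  ... | zero , _ , P with () ← positive P

  opaque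
    -- Built over the Boolean of the definitions, so that indicator sums over it are literally the
    -- counts in the theorem.
    same? : ∀ a b → Dec (Same β a b)
    same? a b = map′ to from (T? (sameCycle β a b))
      where
      to : T (sameCycle β a b) → Same β a b
      to t with satisfied (any⁻ (λ k → iter β k a == b) (upTo n) t)
      ... | k , eq with iter β k a ≟ b
      ...   | yes e = k , e
      from : Same β a b → T (sameCycle β a b)
      from s with hasPeriod a
      ... | L , L≤n , P with Same-< P s
      ...   | k , k<L , e = any⁺ (λ k → iter β k a == b) (lose (∈-upTo⁺ (<-≤-trans k<L L≤n))
        (subst T (sym (dec-true (iter β k a ≟ b) e)) tt))

    does-same? : ∀ a b → does (same? a b) ≡ sameCycle β a b
    does-same? a b = refl

  -- Each point of the cycle is `iter β k a` for exactly one `k` below the period.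
  ∑-orbit : ∀ {a L} → Period β a L → ∀ F → ∑ᶠ (λ b → ⟨ same? a b ⟩ * F b) ≡ ∑ᵘ L (λ k → F (iter β k a))
  ∑-orbit {a} {L} P F = begin
    ∑ᶠ (λ b → ⟨ same? a b ⟩ * F b) ≡⟨ ∑ᶠ-cong (λ b → trans (cong (_* F b) (hits b)) (sym (∑-*ʳ (upTo L) (F b) _))) ⟩
    ∑ᶠ (λ b → ∑ᵘ L (λ k → ⟨ b ≟ iter β k a ⟩ * F b)) ≡⟨ ∑-swap (allFin n) (upTo L) _ ⟩
    ∑ᵘ L (λ k → ∑ᶠ (λ b → ⟨ b ≟ iter β k a ⟩ * F b)) ≡⟨ ∑-cong (upTo L) (λ k → ∑ᶠ-δ (iter β k a) F) ⟩
    ∑ᵘ L (λ k → F (iter β k a)) ∎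
    where
    hits : ∀ b → ⟨ same? a b ⟩ ≡ ∑ᵘ L (λ k → ⟨ b ≟ iter β k a ⟩)
    hits b = ⟨⟩-is (same? a b) hit (λ ¬s → ∑-zero (upTo L) (λ k → ⟨⟩-no (b ≟ iter β k a) (λ e → ¬s (k , sym e))))
      where
      hit : Same β a b → ∑ᵘ L (λ k → ⟨ b ≟ iter β k a ⟩) ≡ 1
      hit s with Same-< P s
      ... | k₀ , k₀<L , refl = begin
        ∑ᵘ L (λ k → ⟨ iter β k₀ a ≟ iter β k a ⟩) ≡⟨ ∑ᵘ-cong L
          (λ k k<L → trans (⟨⟩-cong (λ e → iter-injective-< P k<L k₀<L (sym e)) (λ { refl → refl }) (iter β k₀ a ≟ iter β k a)
          (k ℕ.≟ k₀)) (sym (*-identityʳ _))) ⟩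
        ∑ᵘ L (λ k → ⟨ k ℕ.≟ k₀ ⟩ * 1) ≡⟨ ∑ᵘ-δ (λ _ → 1) k₀<L ⟩
        1 ∎

  opaque
    len : Fin n → ℕ
    len = cycleLen β

    len-def : ∀ a → len a ≡ cycleLen β a
    len-def a = refl

    len-∑ : ∀ a → len a ≡ ∑ᶠ (λ b → ⟨ same? a b ⟩)
    len-∑ a = sym (trans (∑-def (allFin n) _) (cong sum (map-cong (λ b → cong ⟦_⟧ (does-same? a b)) (allFin n))))

  ∑-same : ∀ {a L} → Period β a L → ∑ᶠ (λ b → ⟨ same? a b ⟩) ≡ L
  ∑-same {a} {L} P = begin
    ∑ᶠ (λ b → ⟨ same? a b ⟩) ≡⟨ ∑ᶠ-cong (λ b → *-identityʳ _) ⟨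
    ∑ᶠ (λ b → ⟨ same? a b ⟩ * 1) ≡⟨ ∑-orbit P (λ _ → 1) ⟩
    ∑ᵘ L (λ _ → 1) ≡⟨ ∑ᵘ-1 L ⟩
    L ∎

  -- Counting the orbit by exponents returns whatever period was certified, so the counting
  -- definition `cycleLen` and the dynamical notion of length coincide.
  len-unique : ∀ {a L} → Period β a L → len a ≡ L
  len-unique {a} P = trans (len-∑ a) (∑-same P)

  period : ∀ a → Period β a (len a)
  period a with hasPeriod a
  ... | L , _ , P = subst (Period β a) (sym (len-unique P)) P

  len≤n : ∀ a → len a ≤ n
  len≤n a with hasPeriod a
  ... | L , L≤n , P = subst (_≤ n) (sym (len-unique P)) L≤n

  len>0 : ∀ a → 0 < len a
  len>0 a = positive (period a)

  Period-shift : ∀ {a L} → Period β a L → ∀ k → Period β (iter β k a) L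
  Period-shift {a} {L} P k = record
    { positive = positive P
    ; return   = trans (commute L) (cong (iter β k) (return P))
    ; minimal  = λ j 0<j j<L e → minimal P j 0<j j<L (iter-injective k (trans (sym (commute j)) e)) }
    where
    commute : ∀ j → iter β j (iter β k a) ≡ iter β k (iter β j a)
    commute j = trans (sym (iter-+ β j k a)) (trans (cong (λ z → iter β z a) (+-comm j k)) (iter-+ β k j a))

  len-Same : ∀ {a b} → Same β a b → len a ≡ len b
  len-Same {a} (k , refl) = sym (len-unique (Period-shift (period a) k))

-- Cycle representatives and cycle counts

module Cycles {n} (β : Fin n → Fin n) (inj : Injective _≡_ _≡_ β) where
  open Orbits β inj public

  inv : Fin n → Fin n
  inv y = iter β (len y ∸ 1) y

  β-inv : ∀ y → β (inv y) ≡ y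
  β-inv y = trans (cong (λ k → iter β k y) (m+[n∸m]≡n (len>0 y))) (return (period y))

  inv-β : ∀ x → inv (β x) ≡ x
  inv-β x = inj (β-inv (β x))

  ∑-reindex : ∀ F → ∑ᶠ (F ∘ β) ≡ ∑ᶠ F
  ∑-reindex F = begin
    ∑ᶠ (F ∘ β) ≡⟨ ∑ᶠ-cong (λ x → ∑ᶠ-δ (β x) F) ⟨
    ∑ᶠ (λ x → ∑ᶠ (λ y → ⟨ y ≟ β x ⟩ * F y)) ≡⟨ ∑ᶠ-swap _ ⟩
    ∑ᶠ (λ y → ∑ᶠ (λ x → ⟨ y ≟ β x ⟩ * F y)) ≡⟨ ∑ᶠ-cong (λ y → ∑ᶠ-cong (λ x → cong (_* F y)
            (⟨⟩-cong (λ e → trans (sym (inv-β x)) (cong inv (sym e))) (λ e → trans (sym (β-inv y)) (cong β (sym e))) (y ≟ β x)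
              (x ≟ inv y)))) ⟩
    ∑ᶠ (λ y → ∑ᶠ (λ x → ⟨ x ≟ inv y ⟩ * F y)) ≡⟨ ∑ᶠ-cong (λ y → ∑ᶠ-δ (inv y) (λ _ → F y)) ⟩
    ∑ᶠ F ∎

  -- These `b` are the partners for which the transposition (a b) splits the cycle of `a`.
  Other : Fin n → Fin n → Set
  Other a b = Same β a b × b ≢ a

  other? : ∀ a b → Dec (Other a b)
  other? a b = same? a b ×-dec ¬? (b ≟ a)

  ∑-other : ∀ {a L} → Period β a (suc L) → ∀ (F : Fin n → ℕ) → ∑ᶠ (λ b → ⟨ other? a b ⟩ * F b) ≡ ∑ᵘ L
    (λ k → F (iter β (suc k) a))
  ∑-other {a} {L} P F = begin
    ∑ᶠ (λ b → ⟨ other? a b ⟩ * F b) ≡⟨ ∑ᶠ-cong (λ b → trans (cong (_* F b) (⟨⟩-× (same? a b) (¬? (b ≟ a))))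
      (*-assoc ⟨ same? a b ⟩ _ _)) ⟩
    ∑ᶠ (λ b → ⟨ same? a b ⟩ * (⟨ ¬? (b ≟ a) ⟩ * F b)) ≡⟨ ∑-orbit P _ ⟩
    ∑ᵘ (suc L) (λ k → ⟨ ¬? (iter β k a ≟ a) ⟩ * F (iter β k a)) ≡⟨ ∑ᵘ-suc L _ ⟩
    ⟨ ¬? (a ≟ a) ⟩ * F a + ∑ᵘ L (λ k → ⟨ ¬? (iter β (suc k) a ≟ a) ⟩ * F (iter β (suc k) a))
      ≡⟨ cong₂ _+_ (cong (_* F a) (⟨⟩-no (¬? (a ≟ a)) (λ ne → ne refl)))
        (∑ᵘ-cong L (λ k k<L → trans (cong (_* F (iter β (suc k) a)) (⟨⟩-yes (¬? (iter β (suc k) a ≟ a))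
        (minimal P (suc k) (s≤s z≤n) (s≤s k<L)))) (*-identityˡ _))) ⟩
    ∑ᵘ L (λ k → F (iter β (suc k) a)) ∎

  period-pred : ∀ a → Period β a (suc (len a ∸ 1))
  period-pred a = subst (Period β a) (sym (m+[n∸m]≡n (len>0 a))) (period a)

  count-other : ∀ a → ∑ᶠ (λ b → ⟨ other? a b ⟩) ≡ len a ∸ 1
  count-other a = trans (∑ᶠ-cong (λ b → sym (*-identityʳ _))) (trans (∑-other (period-pred a) (λ _ → 1)) (∑ᵘ-1 (len a ∸ 1)))

  IsRep : Fin n → Set
  IsRep r = ∀ b → Same β r b → toℕ r ≤ toℕ b

  opaque
    rep? : ∀ r → Dec (IsRep r)
    rep? r = map′ to from (T? (isRep β r))
      where
      clause : Fin n → Bool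
      clause b = not (sameCycle β r b) ∨ (toℕ r ≤ᵇ toℕ b)
      to : T (isRep β r) → IsRep r
      to t b s with All.lookup (All.all⁺ clause (allFin n) t) (∈-allFin b)
      ... | tb rewrite trans (sym (does-same? r b)) (dec-true (same? r b) s) = ≤ᵇ⇒≤ (toℕ r) (toℕ b) tb
      from : IsRep r → T (isRep β r)
      from h = All.all⁻ clause {xs = allFin n} (All.tabulate (λ {b} _ → go b (same? r b) (does-same? r b)))
        where
        go : ∀ b (d : Dec (Same β r b)) → does d ≡ sameCycle β r b → T (clause b)
        go b (yes s) e rewrite sym e = ≤⇒≤ᵇ (h b s)
        go b (no _)  e rewrite sym e = tt

    does-rep? : ∀ r → does (rep? r) ≡ isRep β r
    does-rep? r = refl

  opaque
    rep : ∀ x → ∃ λ r → IsRep r × Same β r x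
    rep x with least (λ k → any? (λ y → (toℕ y ℕ.≟ k) ×-dec same? x y)) (toℕ x) (x , refl , Same-refl)
    ... | _ , _ , (r , refl , s) , min = r , (λ b r~b → ≮⇒≥ (λ b<r → min (toℕ b) b<r (b , refl , Same-trans s r~b))) , Same-sym
      s

  rep-unique : ∀ {r r′} → IsRep r → IsRep r′ → Same β r r′ → r ≡ r′
  rep-unique R R′ s = toℕ-injective (≤-antisym (R _ s) (R′ _ (Same-sym s)))

  ∑-rep : ∀ x → ∑ᶠ (λ r → ⟨ rep? r ⟩ * ⟨ same? r x ⟩) ≡ 1
  ∑-rep x with rep x
  ... | r₀ , R₀ , s₀ = begin
    ∑ᶠ (λ r → ⟨ rep? r ⟩ * ⟨ same? r x ⟩) ≡⟨ ∑ᶠ-cong (λ r → trans (sym (⟨⟩-× (rep? r) (same? r x)))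
            (trans (⟨⟩-cong (λ (R , s) → rep-unique R R₀ (Same-trans s (Same-sym s₀))) (λ { refl → R₀ , s₀ })
              (rep? r ×-dec same? r x) (r ≟ r₀)) (sym (*-identityʳ _)))) ⟩
    ∑ᶠ (λ r → ⟨ r ≟ r₀ ⟩ * 1) ≡⟨ ∑ᶠ-δ r₀ (λ _ → 1) ⟩
    1 ∎

  -- Every point lies on the cycle of exactly one representative, so the factor 1 from `∑-rep` can
  -- be inserted and the sums exchanged.
  ∑-cycles : ∀ F → ∑ᶠ F ≡ ∑ᶠ (λ r → ⟨ rep? r ⟩ * ∑ᶠ (λ x → ⟨ same? r x ⟩ * F x))
  ∑-cycles F = begin
    ∑ᶠ F ≡⟨ ∑ᶠ-cong (λ x → trans (cong (_* F x) (∑-rep x)) (*-identityˡ (F x))) ⟨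
    ∑ᶠ (λ x → ∑ᶠ (λ r → ⟨ rep? r ⟩ * ⟨ same? r x ⟩) * F x) ≡⟨ ∑ᶠ-cong (λ x → sym (∑ᶠ-*ʳ (F x) _)) ⟩
    ∑ᶠ (λ x → ∑ᶠ (λ r → ⟨ rep? r ⟩ * ⟨ same? r x ⟩ * F x)) ≡⟨ ∑ᶠ-swap _ ⟩
    ∑ᶠ (λ r → ∑ᶠ (λ x → ⟨ rep? r ⟩ * ⟨ same? r x ⟩ * F x)) ≡⟨ ∑ᶠ-cong
      (λ r → trans (∑ᶠ-cong (λ x → *-assoc ⟨ rep? r ⟩ ⟨ same? r x ⟩ (F x))) (∑ᶠ-*ˡ ⟨ rep? r ⟩ _)) ⟩
    ∑ᶠ (λ r → ⟨ rep? r ⟩ * ∑ᶠ (λ x → ⟨ same? r x ⟩ * F x)) ∎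

  opaque
    count : ℕ → ℕ
    count m = cycleCount β m

    count-def : ∀ m → count m ≡ cycleCount β m
    count-def m = refl

    count-∑ : ∀ m → count m ≡ ∑ᶠ (λ r → ⟨ rep? r ⟩ * ⟨ len r ℕ.≟ m ⟩)
    count-∑ m = trans (cong sum (map-cong (λ r → trans (⟦∧⟧ (isRep β r) (cycleLen β r ≡ᵇ m))
      (cong₂ (λ u l → ⟦ u ⟧ * ⟨ l ℕ.≟ m ⟩) (sym (does-rep? r)) (sym (len-def r)))) (allFin n))) (sym (∑-def (allFin n) _))

  points : ℕ → ℕ
  points m = ∑ᶠ (λ x → ⟨ len x ℕ.≟ m ⟩)

  points-onCycle : ∀ r m → ∑ᶠ (λ x → ⟨ same? r x ⟩ * ⟨ len x ℕ.≟ m ⟩) ≡ ⟨ len r ℕ.≟ m ⟩ * m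
  points-onCycle r m = begin
    ∑ᶠ (λ x → ⟨ same? r x ⟩ * ⟨ len x ℕ.≟ m ⟩) ≡⟨ ∑ᶠ-cong (λ x → ⟨⟩-guard (same? r x) (λ s → cong (λ l → ⟨ l ℕ.≟ m ⟩)
      (sym (len-Same s)))) ⟩
    ∑ᶠ (λ x → ⟨ same? r x ⟩ * ⟨ len r ℕ.≟ m ⟩) ≡⟨ ∑ᶠ-*ʳ ⟨ len r ℕ.≟ m ⟩ _ ⟩
    ∑ᶠ (λ x → ⟨ same? r x ⟩) * ⟨ len r ℕ.≟ m ⟩ ≡⟨ trans (cong (_* ⟨ len r ℕ.≟ m ⟩) (sym (len-∑ r))) (*-comm _ ⟨ len r ℕ.≟ m ⟩) ⟩
    ⟨ len r ℕ.≟ m ⟩ * len r ≡⟨ ⟨⟩-guard (len r ℕ.≟ m) id ⟩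
    ⟨ len r ℕ.≟ m ⟩ * m ∎

  -- A cycle of length `m` contributes `m` points. All later counting runs over points and returns
  -- to cycles here; for positive `m` the factor can be cancelled.
  points-count : ∀ m → points m ≡ m * count m
  points-count m = begin
    points m ≡⟨ ∑-cycles _ ⟩
    ∑ᶠ (λ r → ⟨ rep? r ⟩ * ∑ᶠ (λ x → ⟨ same? r x ⟩ * ⟨ len x ℕ.≟ m ⟩)) ≡⟨ ∑ᶠ-cong (λ r → cong (⟨ rep? r ⟩ *_)
      (points-onCycle r m)) ⟩
    ∑ᶠ (λ r → ⟨ rep? r ⟩ * (⟨ len r ℕ.≟ m ⟩ * m)) ≡⟨ ∑ᶠ-cong (λ r → sym (*-assoc ⟨ rep? r ⟩ _ m)) ⟩
    ∑ᶠ (λ r → ⟨ rep? r ⟩ * ⟨ len r ℕ.≟ m ⟩ * m) ≡⟨ ∑ᶠ-*ʳ m _ ⟩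
    ∑ᶠ (λ r → ⟨ rep? r ⟩ * ⟨ len r ℕ.≟ m ⟩) * m ≡⟨ cong (_* m) (count-∑ m) ⟨
    count m * m ≡⟨ *-comm _ m ⟩
    m * count m ∎

  count-absent : ∀ m → (∀ x → len x ≢ m) → count m ≡ 0
  count-absent m h = trans (count-∑ m) (∑-zero (allFin n) (λ r → trans (cong (⟨ rep? r ⟩ *_) (⟨⟩-no (len r ℕ.≟ m) (h r)))
    (*-zeroʳ ⟨ rep? r ⟩)))

  count-0 : count 0 ≡ 0
  count-0 = count-absent 0 (λ x e → <-irrefl (sym e) (len>0 x))

  -- The sign of β is (-1) to the power n - `numCycles`, so the parity of this number is the
  -- invariant that excludes 4-cycles.
  numCycles : ℕ
  numCycles = ∑ᵘ (suc n) count

-- Multiplication by a transposition: merging and splitting cycles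

-- δ = β ∘ (a b)
record IsSwap {n} (β δ : Fin n → Fin n) (a b : Fin n) : Set where
  field
    at-a  : δ a ≡ β b
    at-b  : δ b ≡ β a
    other : ∀ {x} → x ≢ a → x ≢ b → δ x ≡ β x

module _ {n} {β δ : Fin n → Fin n} {a b : Fin n} where
  open IsSwap

  swap-sym : IsSwap β δ a b → IsSwap δ β a b
  swap-sym sw = record { at-a = sym (at-b sw) ; at-b = sym (at-a sw) ; other = λ p q → sym (other sw p q) }

  -- β and δ differ only at `a` and `b`, so walks with a common first image stay together until they
  -- have met one of these; the endpoint itself may be `a` or `b`. The starts `x` and `y` may
  -- differ: with `y` = a and `x` = b this is the crossing from one cycle to the other.
  swap-walk : IsSwap β δ a b → ∀ {x y} → δ y ≡ β x → ∀ k →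
    (∀ i → i < k → iter β (suc i) x ≢ a) → (∀ i → i < k → iter β (suc i) x ≢ b) → iter δ (suc k) y ≡ iter β (suc k) x
  swap-walk sw st zero    _  _  = st
  swap-walk sw st (suc k) ≢a ≢b = trans
    (cong δ (swap-walk sw st k (λ i i<k → ≢a i (m<n⇒m<1+n i<k)) (λ i i<k → ≢b i (m<n⇒m<1+n i<k))))
    (other sw (≢a k (n<1+n k)) (≢b k (n<1+n k)))

  outside-iter : IsSwap β δ a b → ∀ {x} → ¬ Same β x a → ¬ Same β x b → ∀ k → iter δ k x ≡ iter β k x
  outside-iter sw ≁a ≁b zero    = refl
  outside-iter sw ≁a ≁b (suc k) = trans (cong δ (outside-iter sw ≁a ≁b k)) (other sw (λ e → ≁a (k , e)) (λ e → ≁b (k , e)))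

  outside-Same : IsSwap β δ a b → ∀ {x y} → ¬ Same β x a → ¬ Same β x b → Same δ x y → Same β x y
  outside-Same sw ≁a ≁b (k , e) = k , trans (sym (outside-iter sw ≁a ≁b k)) e

  outside-Same′ : IsSwap β δ a b → ∀ {x y} → ¬ Same β x a → ¬ Same β x b → Same β x y → Same δ x y
  outside-Same′ sw ≁a ≁b (k , e) = k , trans (outside-iter sw ≁a ≁b k) e

module Swap {n} {β δ : Fin n → Fin n} (injβ : Injective _≡_ _≡_ β) (injδ : Injective _≡_ _≡_ δ)
            {a b : Fin n} (sw : IsSwap β δ a b) where
  private
    module β = Cycles β injβ
    module δ = Cycles δ injδ
  open IsSwap sw

  outside-len : ∀ {x} → ¬ Same β x a → ¬ Same β x b → δ.len x ≡ β.len x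
  outside-len {x} ≁a ≁b = δ.len-unique record
    { positive = positive P
    ; return   = trans (outside-iter sw ≁a ≁b (β.len x)) (return P)
    ; minimal  = λ k 0<k k<L e → minimal P k 0<k k<L (trans (sym (outside-iter sw ≁a ≁b k)) e) }
    where
    P : Period β x (β.len x)
    P = β.period x

  -- Under δ the point `a` first runs through the β-cycle of `b`, arrives at `b` after `B` steps,
  -- and then runs through its own β-cycle back to `a`.
  module Merge (a≁b : ¬ Same β a b) where
    private
      A = β.len a
      B = β.len b
      PA = β.period a
      PB = β.period b

    walk-a : ∀ j → 0 < j → j ≤ B → iter δ j a ≡ iter β j b
    walk-a (suc j) _ j<B = swap-walk sw at-a j (λ i _ e → a≁b (β.Same-sym (suc i , e))) (λ i i<j → minimal PB (suc i) (s≤s z≤n)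
      (≤-trans (s≤s i<j) j<B))

    walk-b : ∀ j → 0 < j → j ≤ A → iter δ j b ≡ iter β j a
    walk-b (suc j) _ j<A = swap-walk sw at-b j (λ i i<j → minimal PA (suc i) (s≤s z≤n) (≤-trans (s≤s i<j) j<A))
      (λ i _ e → a≁b (suc i , e))

    to-b : iter δ B a ≡ b
    to-b = trans (walk-a B (positive PB) ≤-refl) (return PB)

    walk-ab : ∀ j → 0 < j → j ≤ A → iter δ (j + B) a ≡ iter β j a
    walk-ab j 0<j j≤A = trans (iter-+ δ j B a) (trans (cong (iter δ j) to-b) (walk-b j 0<j j≤A))

    merged : Same δ a b
    merged = B , to-b

    merged-period : Period δ a (A + B)
    merged-period = record
      { positive = ≤-trans (positive PA) (m≤m+n A B)
      ; return   = trans (walk-ab A (positive PA) ≤-refl) (return PA)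
      ; minimal  = min }
      where
      min : ∀ j → 0 < j → j < A + B → iter δ j a ≢ a
      min j 0<j j<S e with j ≤? B
      ... | yes j≤B = a≁b (β.Same-sym (j , trans (sym (walk-a j 0<j j≤B)) e))
      ... | no  j≰B = minimal PA (j ∸ B) (m<n⇒0<n∸m B<j) j-B<A
          (trans (sym (walk-ab (j ∸ B) (m<n⇒0<n∸m B<j) (<⇒≤ j-B<A))) (trans (cong (λ k → iter δ k a) (m∸n+n≡m (<⇒≤ B<j))) e))
        where
        B<j = ≰⇒> j≰B
        j-B<A : j ∸ B < A
        j-B<A = +-cancelʳ-< B (j ∸ B) A (subst (_< A + B) (sym (m∸n+n≡m (<⇒≤ B<j))) j<S)

    merged-len : δ.len a ≡ A + B
    merged-len = δ.len-unique merged-period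

  -- The arc of the β-cycle from `a` to `b` closes up at `b`, with length `p`; the arc from `b` on
  -- closes up at `a`, with length `L ∸ p`.
  module Split {p} (0<p : 0 < p) (p<L : p < β.len a) (at-p : iter β p a ≡ b) where
    private
      L = β.len a
      P = β.period a

    walk-b : ∀ j → 0 < j → j ≤ p → iter δ j b ≡ iter β j a
    walk-b (suc j) _ j<p = swap-walk sw at-b j
      (λ i i<j → minimal P (suc i) (s≤s z≤n) (≤-trans (s≤s i<j) (<⇒≤ (≤-<-trans j<p p<L))))
      (λ i i<j e → <-irrefl (β.iter-injective-< P (≤-trans (s≤s i<j) (<⇒≤ (≤-<-trans j<p p<L))) p<L (trans e (sym at-p)))
        (≤-trans (s≤s i<j) j<p))

    period-b : Period δ b p
    period-b = record
      { positive = 0<p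
      ; return   = trans (walk-b p 0<p ≤-refl) at-p
      ; minimal  = λ j 0<j j<p e → <-irrefl (β.iter-injective-< P (<-trans j<p p<L) p<L (trans (sym (walk-b j 0<j (<⇒≤ j<p)))
        (trans e (sym at-p)))) j<p }

    private
      <L : ∀ {j} → j < L ∸ p → j + p < L
      <L {j} h = subst (j + p <_) (m∸n+n≡m (<⇒≤ p<L)) (+-monoˡ-< p h)

      after-b : ∀ j → iter β j b ≡ iter β (j + p) a
      after-b j = sym (trans (iter-+ β j p a) (cong (iter β j) at-p))

    walk-a : ∀ j → 0 < j → j ≤ L ∸ p → iter δ j a ≡ iter β (j + p) a
    walk-a (suc j) _ j<q = trans (swap-walk sw at-a j
      (λ i i<j e → minimal P (suc i + p) (s≤s z≤n) (<L (≤-trans (s≤s i<j) j<q)) (trans (sym (after-b (suc i))) e))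
      (λ i i<j e → m+1+n≢m p (trans (+-comm p (suc i)) (β.iter-injective-< P (<L (≤-trans (s≤s i<j) j<q)) p<L
        (trans (sym (after-b (suc i))) (trans e (sym at-p)))))))
      (after-b (suc j))

    period-a : Period δ a (L ∸ p)
    period-a = record
      { positive = m<n⇒0<n∸m p<L
      ; return   = trans (walk-a (L ∸ p) (m<n⇒0<n∸m p<L) ≤-refl) (trans (cong (λ k → iter β k a) (m∸n+n≡m (<⇒≤ p<L)))
        (return P))
      ; minimal  = λ j 0<j j<q e → minimal P (j + p) (≤-trans 0<j (m≤m+n j p)) (<L j<q) (trans (sym (walk-a j 0<j (<⇒≤ j<q))) e)
        }

    separated : ¬ Same δ a b
    separated s with δ.Same-< period-a s
    ... | zero  , _   , e = minimal P p 0<p p<L (trans at-p (sym e))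
    ... | suc k , k<q , e = m+1+n≢m p (trans (+-comm p (suc k)) (β.iter-injective-< P (<L k<q) p<L
      (trans (sym (walk-a (suc k) (s≤s z≤n) (<⇒≤ k<q))) (trans e (sym at-p)))))

    len-a : δ.len a ≡ L ∸ p
    len-a = δ.len-unique period-a

    len-b : δ.len b ≡ p
    len-b = δ.len-unique period-b

    len-sum : β.len a ≡ δ.len a + δ.len b
    len-sum = sym (trans (cong₂ _+_ len-a len-b) (m∸n+n≡m (<⇒≤ p<L)))

  module _ (a~b : Same β a b) where

    outside : ∀ {x} → ¬ Same β a x → ¬ Same β x a × ¬ Same β x b
    outside ≁ = ≁ ∘ β.Same-sym , λ s → ≁ (β.Same-trans a~b (β.Same-sym s))

    -- A point off both δ-cycles never meets `a` or `b` under δ, so β moves it in the same way and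
    -- cannot carry it to `a` either.
    to-pieces : ∀ {x} → Same β a x → Same δ a x ⊎ Same δ b x
    to-pieces {x} s with δ.same? a x | δ.same? b x
    ... | yes a~x | _ = inj₁ a~x
    ... | no _ | yes b~x = inj₂ b~x
    ... | no a≁x | no b≁x = contradiction (outside-Same (swap-sym sw) x≁a (b≁x ∘ δ.Same-sym) (β.Same-sym s)) x≁a
      where x≁a = a≁x ∘ δ.Same-sym

    from-pieces : ∀ {x} → Same δ a x ⊎ Same δ b x → Same β a x
    from-pieces {x} s with β.same? a x
    ... | yes a~x = a~x
    ... | no a≁x with outside a≁x | s
    ...   | x≁a , x≁b | inj₁ t = contradiction (outside-Same sw x≁a x≁b (δ.Same-sym t)) x≁a
    ...   | x≁a , x≁b | inj₂ t = contradiction (outside-Same sw x≁a x≁b (δ.Same-sym t)) x≁b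

  -- Points on cycles of length `m` are compared: off the β-cycle of `a` nothing changes, on it the
  -- points are redistributed between two pieces. Cancelling `m` requires length 0 to be treated
  -- apart. The hypotheses describe the split without naming an exponent, so that merging can use
  -- the lemma with β and δ exchanged.
  count-split : Same β a b → ¬ Same δ a b → β.len a ≡ δ.len a + δ.len b → ∀ m →
    δ.count m + ⟨ β.len a ℕ.≟ m ⟩ ≡ β.count m + (⟨ δ.len a ℕ.≟ m ⟩ + ⟨ δ.len b ℕ.≟ m ⟩)
  count-split a~b a≁b len-eq zero = begin
    δ.count 0 + ⟨ β.len a ℕ.≟ 0 ⟩ ≡⟨ cong₂ _+_ δ.count-0 (nonzero (β.len>0 a)) ⟩
    0 ≡⟨ cong₂ _+_ β.count-0 (cong₂ _+_ (nonzero (δ.len>0 a)) (nonzero (δ.len>0 b))) ⟨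
    β.count 0 + (⟨ δ.len a ℕ.≟ 0 ⟩ + ⟨ δ.len b ℕ.≟ 0 ⟩) ∎
    where
    nonzero : ∀ {l} → 0 < l → ⟨ l ℕ.≟ 0 ⟩ ≡ 0
    nonzero {l} 0<l = ⟨⟩-no (l ℕ.≟ 0) (λ e → <-irrefl (sym e) 0<l)
  count-split a~b a≁b len-eq m@(suc _) = *-cancelˡ-≡ _ _ m (begin
    m * (δ.count m + ⟨ β.len a ℕ.≟ m ⟩) ≡⟨ *-distribˡ-+ m (δ.count m) _ ⟩
    m * δ.count m + m * ⟨ β.len a ℕ.≟ m ⟩ ≡⟨ cong₂ _+_ (trans (sym (δ.points-count m)) δ-points) (*-comm m _) ⟩
    rest + (Da * m + Db * m) + ⟨ β.len a ℕ.≟ m ⟩ * m ≡⟨ solve 5 (λ r x y z m → r :+ (x :* m :+ y :* m) :+ z :* m := r :+ z :* m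
      :+ m :* (x :+ y)) refl rest Da Db ⟨ β.len a ℕ.≟ m ⟩ m ⟩
    rest + ⟨ β.len a ℕ.≟ m ⟩ * m + m * (Da + Db) ≡⟨ cong (_+ m * (Da + Db)) (trans (sym β-points) (β.points-count m)) ⟩
    m * β.count m + m * (Da + Db) ≡⟨ *-distribˡ-+ m (β.count m) _ ⟨
    m * (β.count m + (Da + Db)) ∎)
    where
    Da = ⟨ δ.len a ℕ.≟ m ⟩
    Db = ⟨ δ.len b ℕ.≟ m ⟩
    out? : ∀ x → Dec (¬ Same β a x)
    out? x = ¬? (β.same? a x)
    rest = ∑ᶠ (λ x → ⟨ out? x ⟩ * ⟨ β.len x ℕ.≟ m ⟩)

    β-points : β.points m ≡ rest + ⟨ β.len a ℕ.≟ m ⟩ * m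
    β-points = begin
      β.points m ≡⟨ ∑ᶠ-cong (λ x → trans (sym (*-identityˡ _)) (trans (cong (_* ⟨ β.len x ℕ.≟ m ⟩) (sym (⟨⟩-¬ (β.same? a x))))
        (*-distribʳ-+ ⟨ β.len x ℕ.≟ m ⟩ ⟨ out? x ⟩ _))) ⟩
      ∑ᶠ (λ x → ⟨ out? x ⟩ * ⟨ β.len x ℕ.≟ m ⟩ + ⟨ β.same? a x ⟩ * ⟨ β.len x ℕ.≟ m ⟩) ≡⟨ ∑ᶠ-+ _ _ ⟩
      rest + ∑ᶠ (λ x → ⟨ β.same? a x ⟩ * ⟨ β.len x ℕ.≟ m ⟩) ≡⟨ cong (rest +_) (β.points-onCycle a m) ⟩
      rest + ⟨ β.len a ℕ.≟ m ⟩ * m ∎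

    pieces : ∀ x → ⟨ β.same? a x ⟩ ≡ ⟨ δ.same? a x ⟩ + ⟨ δ.same? b x ⟩
    pieces x = trans (⟨⟩-cong (to-pieces a~b) (from-pieces a~b) (β.same? a x) (δ.same? a x ⊎-dec δ.same? b x))
      (⟨⟩-⊎ (δ.same? a x) (δ.same? b x) (λ s t → a≁b (δ.Same-trans s (δ.Same-sym t))))

    δ-points : δ.points m ≡ rest + (Da * m + Db * m)
    δ-points = begin
      δ.points m ≡⟨ ∑ᶠ-cong (λ x → trans (sym (*-identityˡ _)) (trans (cong (_* ⟨ δ.len x ℕ.≟ m ⟩) (sym (⟨⟩-¬ (β.same? a x))))
            (trans (*-distribʳ-+ ⟨ δ.len x ℕ.≟ m ⟩ ⟨ out? x ⟩ _) (cong₂ _+_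
            (⟨⟩-guard (out? x) (λ o → cong (λ l → ⟨ l ℕ.≟ m ⟩) (outside-len (proj₁ (outside a~b o)) (proj₂ (outside a~b o)))))
            (trans (cong (_* ⟨ δ.len x ℕ.≟ m ⟩) (pieces x)) (*-distribʳ-+ ⟨ δ.len x ℕ.≟ m ⟩ ⟨ δ.same? a x ⟩ _)))))) ⟩
      ∑ᶠ (λ x → ⟨ out? x ⟩ * ⟨ β.len x ℕ.≟ m ⟩ + (⟨ δ.same? a x ⟩ * ⟨ δ.len x ℕ.≟ m ⟩ + ⟨ δ.same? b x ⟩ * ⟨ δ.len x ℕ.≟ m ⟩)) ≡⟨
        trans (∑ᶠ-+ _ _) (cong (rest +_) (∑ᶠ-+ _ _)) ⟩
      rest + (∑ᶠ (λ x → ⟨ δ.same? a x ⟩ * ⟨ δ.len x ℕ.≟ m ⟩) + ∑ᶠ (λ x → ⟨ δ.same? b x ⟩ * ⟨ δ.len x ℕ.≟ m ⟩)) ≡⟨ cong (rest +_)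
        (cong₂ _+_ (δ.points-onCycle a m) (δ.points-onCycle b m)) ⟩
      rest + (Da * m + Db * m) ∎

  -- Sum `count-split` over all lengths up to `n`; each of the three indicators contributes exactly
  -- 1.
  numCycles-split : Same β a b → ¬ Same δ a b → β.len a ≡ δ.len a + δ.len b → δ.numCycles ≡ suc β.numCycles
  numCycles-split a~b a≁b len-eq = +-cancelʳ-≡ 1 _ _ (begin
    δ.numCycles + 1 ≡⟨ cong (δ.numCycles +_) (one (β.len≤n a)) ⟨
    δ.numCycles + ∑ᵘ (suc n) (λ m → ⟨ β.len a ℕ.≟ m ⟩) ≡⟨ ∑-+ (upTo (suc n)) _ _ ⟨
    ∑ᵘ (suc n) (λ m → δ.count m + ⟨ β.len a ℕ.≟ m ⟩) ≡⟨ ∑-cong (upTo (suc n)) (count-split a~b a≁b len-eq) ⟩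
    ∑ᵘ (suc n) (λ m → β.count m + (⟨ δ.len a ℕ.≟ m ⟩ + ⟨ δ.len b ℕ.≟ m ⟩)) ≡⟨ trans (∑-+ (upTo (suc n)) _ _)
      (cong (β.numCycles +_) (∑-+ (upTo (suc n)) _ _)) ⟩
    β.numCycles + (∑ᵘ (suc n) (λ m → ⟨ δ.len a ℕ.≟ m ⟩) + ∑ᵘ (suc n) (λ m → ⟨ δ.len b ℕ.≟ m ⟩)) ≡⟨ cong (β.numCycles +_)
      (cong₂ _+_ (one (δ.len≤n a)) (one (δ.len≤n b))) ⟩
    β.numCycles + 2 ≡⟨ +-suc β.numCycles 1 ⟩
    suc β.numCycles + 1 ∎)
    where
    one : ∀ {l} → l ≤ n → ∑ᵘ (suc n) (λ m → ⟨ l ℕ.≟ m ⟩) ≡ 1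
    one {l} l≤n = trans (∑-cong (upTo (suc n)) (λ m → trans (⟨⟩-cong sym sym (l ℕ.≟ m) (m ℕ.≟ l)) (sym (*-identityʳ _))))
      (∑ᵘ-δ (λ _ → 1) (s≤s l≤n))

-- Conjugacy and cycle type

lookup-injective : ∀ {A : Set} {xs : List A} → Unique xs → ∀ {i j} → List.lookup xs i ≡ List.lookup xs j → i ≡ j
lookup-injective (x∉ ∷ u) {fzero}  {fzero}  e = refl
lookup-injective (x∉ ∷ u) {fzero}  {fsuc j} e = contradiction e (All.lookup x∉ (∈-lookup j))
lookup-injective (x∉ ∷ u) {fsuc i} {fzero}  e = contradiction (sym e) (All.lookup x∉ (∈-lookup i))
lookup-injective (x∉ ∷ u) {fsuc i} {fsuc j} e = cong fsuc (lookup-injective u e)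

opaque
  unfolding ∑

  length-filter : ∀ {A : Set} {P : A → Set} (p? : ∀ x → Dec (P x)) xs → length (filter p? xs) ≡ ∑ xs (λ x → ⟨ p? x ⟩)
  length-filter p? [] = refl
  length-filter p? (x ∷ xs) with does (p? x)
  ... | true  = cong suc (length-filter p? xs)
  ... | false = length-filter p? xs

module _ {n} {P Q : Fin n → Set} (p? : ∀ x → Dec (P x)) (q? : ∀ x → Dec (Q x)) where

  -- Both subsets are listed in increasing order, and the k-th element of one is sent to the k-th
  -- element of the other.
  equinumerous⇒injection : ∑ᶠ (λ x → ⟨ p? x ⟩) ≡ ∑ᶠ (λ x → ⟨ q? x ⟩) →
    ∃ λ (φ : Fin n → Fin n) → (∀ x → P x → Q (φ x)) × (∀ x y → P x → P y → φ x ≡ φ y → x ≡ y)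
  equinumerous⇒injection eq = φ , φ-Q , φ-injective
    where
    ps = filter p? (allFin n)
    qs = filter q? (allFin n)
    same-length : length ps ≡ length qs
    same-length = trans (length-filter p? (allFin n)) (trans eq (sym (length-filter q? (allFin n))))
    pos : ∀ x → P x → Fin (length ps)
    pos x px = index (∈-filter⁺ p? (∈-allFin x) px)
    ψ : ∀ x → Dec (P x) → Fin n
    ψ x (yes px) = List.lookup qs (cast same-length (pos x px))
    -- An arbitrary default: both claims about `φ` concern points satisfying `P`.
    ψ x (no _)   = x
    φ = λ x → ψ x (p? x)
    φ-Q : ∀ x → P x → Q (φ x)
    φ-Q x px with p? x
    ... | yes _  = proj₂ (∈-filter⁻ q? {xs = allFin n} (∈-lookup {xs = qs} _))
    ... | no ¬px = contradiction px ¬px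
    φ-injective : ∀ x y → P x → P y → φ x ≡ φ y → x ≡ y
    φ-injective x y px py e with p? x | p? y
    ... | no ¬px | _      = contradiction px ¬px
    ... | yes _  | no ¬py = contradiction py ¬py
    ... | yes a  | yes b  = trans (lookup-index (∈-filter⁺ p? (∈-allFin x) a)) (trans (cong (List.lookup ps) same-pos)
      (sym (lookup-index (∈-filter⁺ p? (∈-allFin y) b))))
      where
      same-pos : pos x a ≡ pos y b
      same-pos = toℕ-injective (trans (sym (toℕ-cast same-length (pos x a))) (trans
        (cong toℕ (lookup-injective (filter⁺ q? (allFin⁺ n)) e)) (toℕ-cast same-length (pos y b))))

module Conjugacy {n} {β γ : Fin n → Fin n} (injβ : Injective _≡_ _≡_ β) (injγ : Injective _≡_ _≡_ γ) where
  private
    module β = Cycles β injβ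
    module γ = Cycles γ injγ

  -- Such an α carries γ-cycles to β-cycles of the same length, so reindexing along α matches the
  -- points of each length.
  conjugate⇒count : ∀ {α} → Injective _≡_ _≡_ α → (∀ x → α (γ x) ≡ β (α x)) → ∀ m → γ.count m ≡ β.count m
  conjugate⇒count {α} injα eq zero      = trans γ.count-0 (sym β.count-0)
  conjugate⇒count {α} injα eq m@(suc _) = *-cancelˡ-≡ _ _ m (begin
    m * γ.count m ≡⟨ γ.points-count m ⟨
    γ.points m ≡⟨ ∑ᶠ-cong (λ x → cong (λ l → ⟨ l ℕ.≟ m ⟩) (sym (len-α x))) ⟩
    ∑ᶠ (λ x → ⟨ β.len (α x) ℕ.≟ m ⟩) ≡⟨ Cycles.∑-reindex α injα (λ y → ⟨ β.len y ℕ.≟ m ⟩) ⟩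
    β.points m ≡⟨ β.points-count m ⟩
    m * β.count m ∎)
    where
    iter-α : ∀ k x → iter β k (α x) ≡ α (iter γ k x)
    iter-α zero    x = refl
    iter-α (suc k) x = trans (cong β (iter-α k x)) (sym (eq (iter γ k x)))
    len-α : ∀ x → β.len (α x) ≡ γ.len x
    len-α x = β.len-unique record
      { positive = γ.len>0 x
      ; return   = trans (iter-α (γ.len x) x) (cong α (return (γ.period x)))
      ; minimal  = λ k 0<k k<L e → minimal (γ.period x) k 0<k k<L (injα (trans (sym (iter-α k x)) e)) }

  -- Representatives of equal length are matched, and the matching is extended equivariantly: the
  -- point k steps after a representative goes to the point k steps after its image.
  count⇒conjugate : (∀ m → γ.count m ≡ β.count m) → ∃ λ α → Injective _≡_ _≡_ α × (∀ x → α (γ x) ≡ β (α x))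
  count⇒conjugate eq = α , α-injective , α-equivariant
    where
    match : ∀ m → _
    match m = equinumerous⇒injection (λ r → γ.rep? r ×-dec (γ.len r ℕ.≟ m)) (λ r → β.rep? r ×-dec (β.len r ℕ.≟ m)) (begin
      ∑ᶠ (λ r → ⟨ γ.rep? r ×-dec (γ.len r ℕ.≟ m) ⟩) ≡⟨ ∑ᶠ-cong (λ r → ⟨⟩-× (γ.rep? r) (γ.len r ℕ.≟ m)) ⟩
      ∑ᶠ (λ r → ⟨ γ.rep? r ⟩ * ⟨ γ.len r ℕ.≟ m ⟩) ≡⟨ γ.count-∑ m ⟨
      γ.count m ≡⟨ eq m ⟩
      β.count m ≡⟨ β.count-∑ m ⟩
      ∑ᶠ (λ r → ⟨ β.rep? r ⟩ * ⟨ β.len r ℕ.≟ m ⟩) ≡⟨ ∑ᶠ-cong (λ r → ⟨⟩-× (β.rep? r) (β.len r ℕ.≟ m)) ⟨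
      ∑ᶠ (λ r → ⟨ β.rep? r ×-dec (β.len r ℕ.≟ m) ⟩) ∎)
  
    Φ : Fin n → Fin n
    Φ r = proj₁ (match (γ.len r)) r
  
    Φ-rep : ∀ {r} → γ.IsRep r → β.IsRep (Φ r)
    Φ-rep {r} R = proj₁ (proj₁ (proj₂ (match (γ.len r))) r (R , refl))
  
    Φ-len : ∀ {r} → γ.IsRep r → β.len (Φ r) ≡ γ.len r
    Φ-len {r} R = proj₂ (proj₁ (proj₂ (match (γ.len r))) r (R , refl))
  
    Φ-injective : ∀ {r s} → γ.IsRep r → γ.IsRep s → Φ r ≡ Φ s → r ≡ s
    Φ-injective {r} {s} R S e = proj₂ (proj₂ (match (γ.len r))) r s (R , refl) (S , sym l)
      (trans e (cong (λ m → proj₁ (match m) s) (sym l)))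
      where
      l : γ.len r ≡ γ.len s
      l = trans (sym (Φ-len R)) (trans (cong β.len e) (Φ-len S))
  
    -- Iterates depend only on the exponent modulo the common period `L`, so both orbits have the
    -- same coincidences. Read from γ to β this makes `α` independent of the chosen heights; read
    -- from β to γ it makes `α` injective.
    transfer : ∀ {β γ : Fin n → Fin n} (injβ : Injective _≡_ _≡_ β) (injγ : Injective _≡_ _≡_ γ) {r s L} → Period γ r L → Period
      β s L →
      ∀ j k → iter γ j r ≡ iter γ k r → iter β j s ≡ iter β k s
    transfer {β} {γ} injβ injγ {r} {s} {suc L} P Q j k e = begin
      iter β j s ≡⟨ Orbits.iter-% β injβ Q j ⟩
      iter β (j % suc L) s ≡⟨ cong (λ i → iter β i s) (Orbits.iter-injective-< γ injγ P (m%n<n j (suc L)) (m%n<n k (suc L))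
            (trans (sym (Orbits.iter-% γ injγ P j)) (trans e (Orbits.iter-% γ injγ P k)))) ⟩
      iter β (k % suc L) s ≡⟨ Orbits.iter-% β injβ Q k ⟨
      iter β k s ∎
    transfer injβ injγ {L = zero} P Q j k e with () ← positive P
  
    root : Fin n → Fin n
    root x = proj₁ (γ.rep x)
  
    root-rep : ∀ x → γ.IsRep (root x)
    root-rep x = proj₁ (proj₂ (γ.rep x))
  
    height : Fin n → ℕ
    height x = proj₁ (proj₂ (proj₂ (γ.rep x)))
  
    root-height : ∀ x → iter γ (height x) (root x) ≡ x
    root-height x = proj₂ (proj₂ (proj₂ (γ.rep x)))
  
    α : Fin n → Fin n
    α x = iter β (height x) (Φ (root x))
  
    Φ-period : ∀ {r} → γ.IsRep r → Period β (Φ r) (γ.len r)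
    Φ-period {r} R = subst (Period β (Φ r)) (Φ-len R) (β.period (Φ r))
  
    α-iter : ∀ {r} → γ.IsRep r → ∀ j → α (iter γ j r) ≡ iter β j (Φ r)
    α-iter {r} R j = trans (cong (λ s → iter β (height x) (Φ s)) root≡r)
      (transfer injβ injγ (γ.period r) (Φ-period R) (height x) j (trans (cong (iter γ (height x)) (sym root≡r))
        (root-height x)))
      where
      x = iter γ j r
      root≡r : root x ≡ r
      root≡r = γ.rep-unique (root-rep x) R (γ.Same-trans (height x , root-height x) (γ.Same-sym (j , refl)))
  
    α-equivariant : ∀ x → α (γ x) ≡ β (α x)
    α-equivariant x = trans (cong (α ∘ γ) (sym (root-height x))) (α-iter (root-rep x) (suc (height x)))
  
    α-injective : Injective _≡_ _≡_ α
    α-injective {x} {y} e = begin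
      x ≡⟨ root-height x ⟨
      iter γ (height x) (root x) ≡⟨ transfer injγ injβ (Φ-period (root-rep x)) (γ.period (root x)) (height x) (height y)
        (trans e (cong (λ r → iter β (height y) (Φ r)) (sym same-root))) ⟩
      iter γ (height y) (root x) ≡⟨ cong (iter γ (height y)) same-root ⟩
      iter γ (height y) (root y) ≡⟨ root-height y ⟩
      y ∎
      where
      same-root : root x ≡ root y
      same-root = Φ-injective (root-rep x) (root-rep y) (β.rep-unique (Φ-rep (root-rep x)) (Φ-rep (root-rep y))
        (β.Same-trans (height x , e) (β.Same-sym (height y , refl))))

-- Sums over all self-maps

module _ {m n : ℕ} where

  -- Names the extended lambda of allFuns.
  extension : ∃ λ (k : Fin n → (Fin m → Fin n) → Fin (suc m) → Fin n) →
    allFuns (suc m) n ≡ concatMap (λ b → map (k b) (allFuns m n)) (allFin n)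
  extension = _ , refl

  extend : Fin n → (Fin m → Fin n) → Fin (suc m) → Fin n
  extend = proj₁ extension

_≗?_ : ∀ {m n} (f g : Fin m → Fin n) → Dec (f ≗ g)
f ≗? g = all? (λ x → f x ≟ g x)

opaque
  unfolding ∑

  -- `allFuns` lists every map once up to pointwise equality: agreement with `g` means agreement of
  -- the value at zero and of the remaining map.
  ∑-funs-1 : ∀ m n (g : Fin m → Fin n) → ∑ (allFuns m n) (λ f → ⟨ f ≗? g ⟩) ≡ 1
  ∑-funs-1 zero    n g = cong (_+ 0) (⟨⟩-yes ((λ ()) ≗? g) (λ ()))
  ∑-funs-1 (suc m) n g = begin
    ∑ (allFuns (suc m) n) (λ f → ⟨ f ≗? g ⟩) ≡⟨ ∑-concatMap (λ b → map (extend b) (allFuns m n)) (λ f → ⟨ f ≗? g ⟩) (allFin n) ⟩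
    ∑ᶠ (λ b → ∑ (map (extend b) (allFuns m n)) (λ f → ⟨ f ≗? g ⟩)) ≡⟨ ∑ᶠ-cong (λ b → ∑-map (extend b) (λ f → ⟨ f ≗? g ⟩)
      (allFuns m n)) ⟩
    ∑ᶠ (λ b → ∑ (allFuns m n) (λ f → ⟨ extend b f ≗? g ⟩)) ≡⟨ ∑ᶠ-cong (λ b → ∑-cong (allFuns m n) (λ f → trans
            (⟨⟩-cong (λ e → e fzero , e ∘ fsuc) (λ (e₀ , e) → λ { fzero → e₀ ; (fsuc i) → e i }) (extend b f ≗? g)
              ((b ≟ g fzero) ×-dec (f ≗? (g ∘ fsuc))))
            (⟨⟩-× (b ≟ g fzero) (f ≗? (g ∘ fsuc))))) ⟩
    ∑ᶠ (λ b → ∑ (allFuns m n) (λ f → ⟨ b ≟ g fzero ⟩ * ⟨ f ≗? (g ∘ fsuc) ⟩)) ≡⟨ ∑ᶠ-cong (λ b → ∑-*ˡ (allFuns m n) ⟨ b ≟ g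
      fzero ⟩ _) ⟩
    ∑ᶠ (λ b → ⟨ b ≟ g fzero ⟩ * ∑ (allFuns m n) (λ f → ⟨ f ≗? (g ∘ fsuc) ⟩)) ≡⟨ ∑ᶠ-δ (g fzero) _ ⟩
    ∑ (allFuns m n) (λ f → ⟨ f ≗? (g ∘ fsuc) ⟩) ≡⟨ ∑-funs-1 m n (g ∘ fsuc) ⟩
    1 ∎

∑-funs-δ : ∀ {m n} (g : Fin m → Fin n) {H : (Fin m → Fin n) → ℕ} → (∀ f → f ≗ g → H f ≡ H g) →
  ∑ (allFuns m n) (λ f → ⟨ f ≗? g ⟩ * H f) ≡ H g
∑-funs-δ {m} {n} g {H} resp = begin
  ∑ (allFuns m n) (λ f → ⟨ f ≗? g ⟩ * H f) ≡⟨ ∑-cong (allFuns m n) (λ f → ⟨⟩-guard (f ≗? g) (resp f)) ⟩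
  ∑ (allFuns m n) (λ f → ⟨ f ≗? g ⟩ * H g) ≡⟨ ∑-*ʳ (allFuns m n) (H g) _ ⟩
  ∑ (allFuns m n) (λ f → ⟨ f ≗? g ⟩) * H g ≡⟨ cong (_* H g) (∑-funs-1 m n g) ⟩
  1 * H g ≡⟨ *-identityˡ (H g) ⟩
  H g ∎

module _ {n : ℕ} where

  funs : List (Fin n → Fin n)
  funs = allFuns n n

  -- Up to pointwise equality, precomposition with a permutation permutes the maps: after the delta
  -- is inserted, g = f ∘ σ turns into f = g ∘ σ⁻¹.
  ∑-funs-precompose : ∀ {σ} → Injective _≡_ _≡_ σ → ∀ {H : (Fin n → Fin n) → ℕ} → (∀ f g → f ≗ g → H f ≡ H g) →
    ∑ funs (λ f → H (f ∘ σ)) ≡ ∑ funs H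
  ∑-funs-precompose {σ} injσ {H} resp = begin
    ∑ funs (λ f → H (f ∘ σ)) ≡⟨ ∑-cong funs (λ f → ∑-funs-δ (f ∘ σ) (λ g → resp g (f ∘ σ))) ⟨
    ∑ funs (λ f → ∑ funs (λ g → ⟨ g ≗? (f ∘ σ) ⟩ * H g)) ≡⟨ ∑-swap funs funs _ ⟩
    ∑ funs (λ g → ∑ funs (λ f → ⟨ g ≗? (f ∘ σ) ⟩ * H g)) ≡⟨ ∑-cong funs (λ g → ∑-cong funs (λ f → cong (_* H g) (⟨⟩-cong
            (λ e x → trans (cong f (sym (σ.β-inv x))) (sym (e (σ.inv x)))) (λ e x → sym (trans (e (σ x)) (cong g (σ.inv-β x))))
              (g ≗? (f ∘ σ)) (f ≗? (g ∘ σ.inv))))) ⟩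
    ∑ funs (λ g → ∑ funs (λ f → ⟨ f ≗? (g ∘ σ.inv) ⟩ * H g)) ≡⟨ ∑-cong funs (λ g → ∑-funs-δ (g ∘ σ.inv) {λ _ → H g}
      (λ _ _ → refl)) ⟩
    ∑ funs H ∎
    where module σ = Cycles σ injσ

  opaque
    perm? : (f : Fin n → Fin n) → Dec (Injective _≡_ _≡_ f)
    perm? f = map′ to from (T? (isPerm f))
      where
      clause : Fin n → Fin n → Bool
      clause a b = not (f a == f b) ∨ (a == b)
      to : T (isPerm f) → Injective _≡_ _≡_ f
      to t {a} {b} e with All.lookup (All.all⁺ (clause a) (allFin n) (All.lookup (All.all⁺ (λ a → allFin? n (clause a))
        (allFin n) t) (∈-allFin a))) (∈-allFin b)
      ... | tab rewrite dec-true (f a ≟ f b) e with a ≟ b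
      ...   | yes a≡b = a≡b
      from : Injective _≡_ _≡_ f → T (isPerm f)
      from inj = All.all⁻ (λ a → allFin? n (clause a)) {xs = allFin n}
        (All.tabulate (λ {a} _ → All.all⁻ (clause a) {xs = allFin n} (All.tabulate (λ {b} _ → go a b))))
        where
        go : ∀ a b → T (clause a b)
        go a b with f a ≟ f b
        ... | no _ = tt
        ... | yes e rewrite dec-true (a ≟ b) (inj e) = tt

    does-perm? : ∀ f → does (perm? f) ≡ isPerm f
    does-perm? f = refl

  perm-resp : ∀ {f g : Fin n → Fin n} → f ≗ g → Injective _≡_ _≡_ f → Injective _≡_ _≡_ g
  perm-resp eq inj {x} {y} e = inj (trans (eq x) (trans e (sym (eq y))))

  countPerms-∑ : ∀ P → countPerms n P ≡ ∑ funs (λ α → ⟨ perm? α ⟩ * ⟦ P α ⟧)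
  countPerms-∑ P = trans (cong sum (map-cong (λ α → trans (⟦∧⟧ (isPerm α) (P α)) (cong (λ b → ⟦ b ⟧ * ⟦ P α ⟧)
    (sym (does-perm? α)))) funs)) (sym (∑-def funs _))

  conj? : ∀ (β γ α : Fin n → Fin n) → Dec (∀ x → α (γ x) ≡ β (α x))
  conj? β γ α = all? (λ x → α (γ x) ≟ β (α x))

  -- The permutations α with γ = α⁻¹βα. They form a coset of the centralizer of β, or the empty set.
  conjugators : (β γ : Fin n → Fin n) → ℕ
  conjugators β γ = ∑ funs (λ α → ⟨ perm? α ⟩ * ⟨ conj? β γ α ⟩)

  conjugators-cong : ∀ {β γ γ′} → γ ≗ γ′ → conjugators β γ ≡ conjugators β γ′
  conjugators-cong {β} {γ} {γ′} eq = ∑-cong funs (λ α → cong (⟨ perm? α ⟩ *_)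
    (⟨⟩-cong (λ h x → trans (cong α (sym (eq x))) (h x)) (λ h x → trans (cong α (eq x)) (h x)) (conj? β γ α) (conj? β γ′ α)))

  centralizer-conjugators : ∀ β → centralizerSize β ≡ conjugators β β
  centralizer-conjugators β = trans (countPerms-∑ _) (∑-cong funs (λ α → cong (⟨ perm? α ⟩ *_)
    (⟦⟧-T _ (conj? β β α) (to α) (from α))))
    where
    clause : (Fin n → Fin n) → Fin n → Bool
    clause α a = α (β a) == β (α a)
    to : ∀ α → T (allFin? n (clause α)) → ∀ x → α (β x) ≡ β (α x)
    to α t x with All.lookup (All.all⁺ (clause α) (allFin n) t) (∈-allFin x)
    ... | tx with α (β x) ≟ β (α x)
    ...   | yes e = e
    from : ∀ α → (∀ x → α (β x) ≡ β (α x)) → T (allFin? n (clause α))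
    from α h = All.all⁻ (clause α) {xs = allFin n} (All.tabulate (λ {x} _ → subst T (sym (dec-true (α (β x) ≟ β (α x)) (h x)))
      tt))

  conjugators-none : ∀ {β γ} → (∀ α → Injective _≡_ _≡_ α → ¬ (∀ x → α (γ x) ≡ β (α x))) → conjugators β γ ≡ 0
  conjugators-none {β} {γ} none = ∑-zero funs (λ α → ⟨⟩-case (perm? α) (λ injα → ⟨⟩-no (conj? β γ α) (none α injα))
    (λ _ → refl))

  -- If σ is one conjugator, then α ∘ σ is another exactly when α commutes with β, so precomposition
  -- with σ identifies the two counts.
  conjugators-some : ∀ {β γ α} → Injective _≡_ _≡_ α → (∀ x → α (γ x) ≡ β (α x)) → conjugators β γ ≡ conjugators β β
  conjugators-some {β} {γ} {σ} injσ eq = begin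
    ∑ funs H ≡⟨ ∑-funs-precompose injσ {H} resp ⟨
    ∑ funs (λ α → H (α ∘ σ)) ≡⟨ ∑-cong funs (λ α → cong₂ _*_ (same-perm α) (same-conj α)) ⟩
    conjugators β β ∎
    where
    module σ = Cycles σ injσ
    H : (Fin n → Fin n) → ℕ
    H α = ⟨ perm? α ⟩ * ⟨ conj? β γ α ⟩
    resp : ∀ f g → f ≗ g → H f ≡ H g
    resp f g e = cong₂ _*_ (⟨⟩-cong (perm-resp e) (perm-resp (sym ∘ e)) (perm? f) (perm? g))
      (⟨⟩-cong (λ h x → trans (sym (e (γ x))) (trans (h x) (cong β (e x))))
        (λ h x → trans (e (γ x)) (trans (h x) (cong β (sym (e x))))) (conj? β γ f) (conj? β γ g))
    to : ∀ α → Injective _≡_ _≡_ (α ∘ σ) → Injective _≡_ _≡_ α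
    to α i {x} {y} e = trans (sym (σ.β-inv x))
      (trans (cong σ (i {σ.inv x} {σ.inv y} (trans (cong α (σ.β-inv x)) (trans e (cong α (sym (σ.β-inv y))))))) (σ.β-inv y))
    to′ : ∀ α → (∀ x → α (σ (γ x)) ≡ β (α (σ x))) → ∀ x → α (β x) ≡ β (α x)
    to′ α h x = begin
      α (β x) ≡⟨ cong (α ∘ β) (σ.β-inv x) ⟨
      α (β (σ (σ.inv x))) ≡⟨ cong α (eq (σ.inv x)) ⟨
      α (σ (γ (σ.inv x))) ≡⟨ h (σ.inv x) ⟩
      β (α (σ (σ.inv x))) ≡⟨ cong (β ∘ α) (σ.β-inv x) ⟩
      β (α x) ∎
    from′ : ∀ α → (∀ x → α (β x) ≡ β (α x)) → ∀ x → α (σ (γ x)) ≡ β (α (σ x))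
    from′ α h x = trans (cong α (eq x)) (h (σ x))
    same-perm : ∀ α → ⟨ perm? (α ∘ σ) ⟩ ≡ ⟨ perm? α ⟩
    same-perm α = ⟨⟩-cong (to α) (λ i {x} {y} e → injσ (i {σ x} {σ y} e)) (perm? (α ∘ σ)) (perm? α)
    same-conj : ∀ α → ⟨ conj? β γ (α ∘ σ) ⟩ ≡ ⟨ conj? β β α ⟩
    same-conj α = ⟨⟩-cong (to′ α) (from′ α) (conj? β γ (α ∘ σ)) (conj? β β α)

  module _ {β γ : Fin n → Fin n} (injβ : Injective _≡_ _≡_ β) (injγ : Injective _≡_ _≡_ γ) where
    private
      module β = Cycles β injβ
      module γ = Cycles γ injγ
    open Conjugacy injβ injγ

    conjugators-same-type : (∀ m → γ.count m ≡ β.count m) → conjugators β γ ≡ centralizerSize β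
    conjugators-same-type eq = let α , injα , conj = count⇒conjugate eq in
      trans (conjugators-some {β} {γ} {α} injα conj) (sym (centralizer-conjugators β))

    conjugators-other-type : ¬ (∀ m → γ.count m ≡ β.count m) → conjugators β γ ≡ 0
    conjugators-other-type ne = conjugators-none {β} {γ} (λ α injα conj → ne (conjugate⇒count {α} injα conj))

-- Transpositions and the parity of the number of cycles

module _ {n} (a b : Fin n) where

  transpose-at-a : transpose a b a ≡ b
  transpose-at-a rewrite dec-true (a ≟ a) refl = refl

  transpose-at-b : transpose a b b ≡ a
  transpose-at-b with b ≟ a
  ... | yes b≡a = b≡a
  ... | no _ rewrite dec-true (b ≟ b) refl = refl

  transpose-other : ∀ {x} → x ≢ a → x ≢ b → transpose a b x ≡ x
  transpose-other {x} x≢a x≢b rewrite dec-false (x ≟ a) x≢a | dec-false (x ≟ b) x≢b = refl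

  transpose-injective : Injective _≡_ _≡_ (transpose a b)
  transpose-injective {x} {y} e = trans (sym (transpose-inverse b a)) (trans (cong (transpose b a) e) (transpose-inverse b a))

  transpose-IsSwap : ∀ β → IsSwap β (β ∘ transpose a b) a b
  transpose-IsSwap β = record
    { at-a = cong β transpose-at-a ; at-b = cong β transpose-at-b ; other = λ p q → cong β (transpose-other p q) }

Adjacent : ℕ → ℕ → Set
Adjacent k l = l ≡ suc k ⊎ k ≡ suc l

even : ℕ → Bool
even zero    = true
even (suc k) = not (even k)

Adjacent-even : ∀ {k l} → Adjacent k l → even l ≡ not (even k)
Adjacent-even (inj₁ refl) = refl
Adjacent-even {l = l} (inj₂ refl) = sym (not-involutive (even l))

module SwapCycles {n} {β δ : Fin n → Fin n} (injβ : Injective _≡_ _≡_ β) (injδ : Injective _≡_ _≡_ δ)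
                  {a b : Fin n} (a≢b : a ≢ b) (sw : IsSwap β δ a b) where
  private
    module β = Cycles β injβ
    module δ = Cycles δ injδ
    module Back = Swap {β = δ} {δ = β} injδ injβ {a} {b} (swap-sym sw)
  open Swap {β = β} {δ = δ} injβ injδ {a} {b} sw public

  splits : Same β a b → ¬ Same δ a b × β.len a ≡ δ.len a + δ.len b
  splits s = helper (β.Same-< (β.period a) s)
    where
    helper : (∃ λ k → k < β.len a × iter β k a ≡ b) → ¬ Same δ a b × β.len a ≡ δ.len a + δ.len b
    helper (zero  , _   , e) = contradiction e a≢b
    helper (suc p , p<L , e) = separated , len-sum
      where open Split (s≤s z≤n) p<L e

  numCycles-up : Same β a b → δ.numCycles ≡ suc β.numCycles
  numCycles-up s = numCycles-split s (proj₁ (splits s)) (proj₂ (splits s))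

  count-up : Same β a b → ∀ m → δ.count m + ⟨ β.len a ℕ.≟ m ⟩ ≡ β.count m + (⟨ δ.len a ℕ.≟ m ⟩ + ⟨ δ.len b ℕ.≟ m ⟩)
  count-up s = count-split s (proj₁ (splits s)) (proj₂ (splits s))

  -- Merging is splitting read from δ back to β.
  numCycles-down : ¬ Same β a b → β.numCycles ≡ suc δ.numCycles
  numCycles-down ¬s = Back.numCycles-split merged ¬s merged-len
    where open Merge ¬s

  count-down : ¬ Same β a b → ∀ m → β.count m + ⟨ δ.len a ℕ.≟ m ⟩ ≡ δ.count m + (⟨ β.len a ℕ.≟ m ⟩ + ⟨ β.len b ℕ.≟ m ⟩)
  count-down ¬s = Back.count-split merged ¬s merged-len
    where open Merge ¬s

  numCycles-swap : Adjacent β.numCycles δ.numCycles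
  numCycles-swap = helper (β.same? a b)
    where
    helper : Dec (Same β a b) → Adjacent β.numCycles δ.numCycles
    helper (yes s) = inj₁ (numCycles-up s)
    helper (no ¬s) = inj₂ (numCycles-down ¬s)

-- Permutations moving exactly four points

Distinct : ∀ {n} (a b c d : Fin n) → Set
Distinct a b c d = a ≢ b × a ≢ c × a ≢ d × b ≢ c × b ≢ d × c ≢ d

distinct? : ∀ {n} (a b c d : Fin n) → Dec (Distinct a b c d)
distinct? a b c d = ¬? (a ≟ b) ×-dec ¬? (a ≟ c) ×-dec ¬? (a ≟ d) ×-dec ¬? (b ≟ c) ×-dec ¬? (b ≟ d) ×-dec ¬? (c ≟ d)

module _ {n} {S : Fin n → Set} (S? : ∀ x → Dec (S x)) where

  card-≥ : ∀ xs → Unique xs → All S xs → length xs ≤ ∑ᶠ (λ x → ⟨ S? x ⟩)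
  card-≥ xs u all = subst (_≤ ∑ᶠ (λ x → ⟨ S? x ⟩)) (begin
    ∑ᶠ (λ x → ∑ xs (λ y → ⟨ y ≟ x ⟩ * 1)) ≡⟨ ∑-swap (allFin n) xs _ ⟩
    ∑ xs (λ y → ∑ᶠ (λ x → ⟨ y ≟ x ⟩ * 1)) ≡⟨ ∑-cong xs (λ y → ∑ᶠ-cong (λ x → cong (_* 1) (⟨⟩-cong sym sym (y ≟ x) (x ≟ y)))) ⟩
    ∑ xs (λ y → ∑ᶠ (λ x → ⟨ x ≟ y ⟩ * 1)) ≡⟨ ∑-cong xs (λ y → ∑ᶠ-δ y (λ _ → 1)) ⟩
    ∑ xs (λ _ → 1) ≡⟨ ∑-1 xs ⟩
    length xs ∎)
    (∑-≤ (allFin n) (λ x → bound x (any≟? x)))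
    where
    any≟? : ∀ x → Dec (x ∈ xs)
    any≟? x = Any.any? (x ≟_) xs
    bound : ∀ x → Dec (x ∈ xs) → ∑ xs (λ y → ⟨ y ≟ x ⟩ * 1) ≤ ⟨ S? x ⟩
    bound x (yes x∈) = ≤-reflexive (trans (∑-δ _≟_ (λ _ → 1) u x∈) (sym (⟨⟩-yes (S? x) (All.lookup all x∈))))
    bound x (no x∉)  = subst (_≤ ⟨ S? x ⟩) (sym (∑-δ-∉ _≟_ (λ _ → 1) x∉)) z≤n

  four-points : ∑ᶠ (λ x → ⟨ S? x ⟩) ≡ 4 → ∀ {a b c d} → Distinct a b c d → S a → S b → S c → S d →
    ∀ {x} → x ≢ a → x ≢ b → x ≢ c → x ≢ d → ¬ S x
  four-points card (ab , ac , ad , bc , bd , cd) sa sb sc sd xa xb xc xd sx = <-irrefl refl (subst (5 ≤_) card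
    (card-≥ (_ ∷ _ ∷ _ ∷ _ ∷ _ ∷ [])
      ((xa ∷ xb ∷ xc ∷ xd ∷ []) ∷ (ab ∷ ac ∷ ad ∷ []) ∷ (bc ∷ bd ∷ []) ∷ (cd ∷ []) ∷ [] ∷ [])
      (sx ∷ sa ∷ sb ∷ sc ∷ sd ∷ [])))

  fourth-point : ∑ᶠ (λ x → ⟨ S? x ⟩) ≡ 4 → ∀ a b c → ∃ λ x → S x × x ≢ a × x ≢ b × x ≢ c
  fourth-point card a b c = helper (any? (λ x → S? x ×-dec ¬? (x ≟ a) ×-dec ¬? (x ≟ b) ×-dec ¬? (x ≟ c)))
    where
    helper : Dec (∃ λ x → S x × x ≢ a × x ≢ b × x ≢ c) → ∃ λ x → S x × x ≢ a × x ≢ b × x ≢ c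
    helper (yes h) = h
    helper (no ¬h) = contradiction (subst₂ _≤_ card sum≡3 (∑-≤ (allFin n) bound)) (<⇒≱ (n<1+n 3))
      where
      hits : Fin n → ℕ
      hits x = ⟨ x ≟ a ⟩ * 1 + (⟨ x ≟ b ⟩ * 1 + ⟨ x ≟ c ⟩ * 1)
      sum≡3 : ∑ᶠ hits ≡ 3
      sum≡3 = trans (∑ᶠ-+ _ _) (cong₂ _+_ (∑ᶠ-δ a (λ _ → 1))
        (trans (∑ᶠ-+ _ _) (cong₂ _+_ (∑ᶠ-δ b (λ _ → 1)) (∑ᶠ-δ c (λ _ → 1)))))
      bound : ∀ x → ⟨ S? x ⟩ ≤ hits x
      bound x with S? x
      ... | no _ = z≤n
      ... | yes sx with x ≟ a | x ≟ b | x ≟ c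
      ...   | yes _ | _     | _     = s≤s z≤n
      ...   | no _  | yes _ | _     = s≤s z≤n
      ...   | no _  | no _  | yes _ = s≤s z≤n
      ...   | no xa | no xb | no xc = contradiction (x , sx , xa , xb , xc) ¬h

module FourMoved {n} {τ : Fin n → Fin n} (injτ : Injective _≡_ _≡_ τ)
                 (card : ∑ᶠ (λ x → ⟨ ¬? (τ x ≟ x) ⟩) ≡ 4) where

  moved? : ∀ x → Dec (τ x ≢ x)
  moved? x = ¬? (τ x ≟ x)

  IsFourCycle : Set
  IsFourCycle = ∃₂ λ a b → ∃₂ λ c d → Distinct a b c d × τ a ≡ b × τ b ≡ c × τ c ≡ d × τ d ≡ a ×
    (∀ {x} → x ≢ a → x ≢ b → x ≢ c → x ≢ d → τ x ≡ x)

  private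
    -- The points `a`, τ a, τ² a, τ³ a turn out to be distinct; they are then all the moved points,
    -- and injectivity leaves only `a` as the image of the last.
    nonInvolutive : ∀ a → τ (τ a) ≢ a → IsFourCycle
    nonInvolutive a ττa≢a = a , b , c , d , dist , refl , refl , refl , τd≡a , fixed
      where
      b = τ a
      c = τ b
      d = τ c
      a≢b : a ≢ b
      a≢b e = ττa≢a (trans (cong τ (sym e)) (sym e))
      a≢c : a ≢ c
      a≢c e = ττa≢a (sym e)
      b≢c : b ≢ c
      b≢c e = a≢b (injτ e)
      b≢d : b ≢ d
      b≢d e = a≢c (injτ e)
      c≢d : c ≢ d
      c≢d e = b≢c (injτ e)
      -- a 3-cycle would leave a single further moved point, which has nowhere to go
      a≢d : a ≢ d
      a≢d e with fourth-point moved? card a b c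
      ... | x , τx≢x , x≢a , x≢b , x≢c = four-points moved? card {a} {b} {c} {x}
        (a≢b , a≢c , ≢-sym x≢a , b≢c , ≢-sym x≢b , ≢-sym x≢c) (a≢b ∘ sym) (b≢c ∘ sym) (λ f → a≢c (trans e f)) τx≢x {τ x}
        (λ f → x≢c (injτ (trans f e))) (λ f → x≢a (injτ f)) (λ f → x≢b (injτ f)) τx≢x (λ f → τx≢x (injτ f))
      dist : Distinct a b c d
      dist = a≢b , a≢c , a≢d , b≢c , b≢d , c≢d
      fixed : ∀ {x} → x ≢ a → x ≢ b → x ≢ c → x ≢ d → τ x ≡ x
      fixed {x} xa xb xc xd = decidable-stable (τ x ≟ x) (four-points moved? card dist (a≢b ∘ sym) (b≢c ∘ sym) (c≢d ∘ sym) τd≢d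
        xa xb xc xd)
        where
        τd≢d : τ d ≢ d
        τd≢d e = c≢d (injτ (sym e))
      τd≡a : τ d ≡ a
      τd≡a = decidable-stable (τ d ≟ a) (λ τd≢a → four-points moved? card dist (a≢b ∘ sym) (b≢c ∘ sym) (c≢d ∘ sym) τd≢d
        τd≢a (λ e → a≢d (sym (injτ e))) (λ e → b≢d (sym (injτ e))) τd≢d (λ e → τd≢d (injτ e)))
        where
        τd≢d : τ d ≢ d
        τd≢d e = c≢d (injτ (sym e))

  involutive-or-fourCycle : (∀ x → τ (τ x) ≡ x) ⊎ IsFourCycle
  involutive-or-fourCycle with all? (λ x → τ (τ x) ≟ x)
  ... | yes inv = inj₁ inv
  ... | no ¬inv with any? (λ x → ¬? (τ (τ x) ≟ x))
  ...   | yes (a , ne) = inj₂ (nonInvolutive a ne)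
  ...   | no ¬any = contradiction (λ x → decidable-stable (τ (τ x) ≟ x) (λ ne → ¬any (x , ne))) ¬inv

  module Involutive (invol : ∀ x → τ (τ x) ≡ x) where

    private
      τ-moved : ∀ {x} → τ x ≢ x → τ (τ x) ≢ τ x
      τ-moved ne e = ne (injτ e)

    second? : ∀ a c → Dec (τ c ≢ c × c ≢ a × c ≢ τ a)
    second? a c = moved? c ×-dec ¬? (c ≟ a) ×-dec ¬? (c ≟ τ a)

    -- Parametrises the quadruples with τ = (a b)(c d): 4 choices for `a`, then 2 for `c` outside
    -- {a, τ a}, while `b` and `d` are forced. This is the origin of the factor 8.
    Chosen : (a b c d : Fin n) → Set
    Chosen a b c d = τ a ≢ a × b ≡ τ a × (τ c ≢ c × c ≢ a × c ≢ τ a) × d ≡ τ c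

    chosen? : ∀ a b c d → Dec (Chosen a b c d)
    chosen? a b c d = moved? a ×-dec (b ≟ τ a) ×-dec second? a c ×-dec (d ≟ τ c)

    ∑-second : ∀ a → τ a ≢ a → ∑ᶠ (λ c → ⟨ second? a c ⟩) ≡ 2
    -- The excluded points `a` and `τ a` are added back to reach the total of 4 moved points.
    ∑-second a τa≢a = +-cancelʳ-≡ 2 _ 2 (begin
      ∑ᶠ (λ c → ⟨ second? a c ⟩) + 2 ≡⟨ cong (∑ᶠ (λ c → ⟨ second? a c ⟩) +_) (cong₂ _+_ (∑ᶠ-δ a (λ _ → 1))
        (∑ᶠ-δ (τ a) (λ _ → 1))) ⟨
      ∑ᶠ (λ c → ⟨ second? a c ⟩) + (∑ᶠ (λ c → ⟨ c ≟ a ⟩ * 1) + ∑ᶠ (λ c → ⟨ c ≟ τ a ⟩ * 1)) ≡⟨ trans (∑ᶠ-+ _ _)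
        (cong (∑ᶠ (λ c → ⟨ second? a c ⟩) +_) (∑ᶠ-+ _ _)) ⟨
      ∑ᶠ (λ c → ⟨ second? a c ⟩ + (⟨ c ≟ a ⟩ * 1 + ⟨ c ≟ τ a ⟩ * 1)) ≡⟨ ∑ᶠ-cong (λ c → sym (pointwise c)) ⟩
      ∑ᶠ (λ c → ⟨ moved? c ⟩) ≡⟨ card ⟩
      4 ∎)
      where
      pointwise : ∀ c → ⟨ moved? c ⟩ ≡ ⟨ second? a c ⟩ + (⟨ c ≟ a ⟩ * 1 + ⟨ c ≟ τ a ⟩ * 1)
      pointwise c = begin
        ⟨ moved? c ⟩ ≡⟨ ⟨⟩-cong to from (moved? c) (second? a c ⊎-dec ((c ≟ a) ⊎-dec (c ≟ τ a))) ⟩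
        ⟨ second? a c ⊎-dec ((c ≟ a) ⊎-dec (c ≟ τ a)) ⟩ ≡⟨ ⟨⟩-⊎ (second? a c) ((c ≟ a) ⊎-dec (c ≟ τ a))
          (λ { (_ , ca , cb) → [ ca , cb ]′ }) ⟩
        ⟨ second? a c ⟩ + ⟨ (c ≟ a) ⊎-dec (c ≟ τ a) ⟩ ≡⟨ cong (⟨ second? a c ⟩ +_)
          (⟨⟩-⊎ (c ≟ a) (c ≟ τ a) (λ { refl e → τa≢a (sym e) })) ⟩
        ⟨ second? a c ⟩ + (⟨ c ≟ a ⟩ + ⟨ c ≟ τ a ⟩) ≡⟨ cong (⟨ second? a c ⟩ +_) (cong₂ _+_ (*-identityʳ ⟨ c ≟ a ⟩)
          (*-identityʳ ⟨ c ≟ τ a ⟩)) ⟨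
        ⟨ second? a c ⟩ + (⟨ c ≟ a ⟩ * 1 + ⟨ c ≟ τ a ⟩ * 1) ∎
        where
        to : τ c ≢ c → (τ c ≢ c × c ≢ a × c ≢ τ a) ⊎ c ≡ a ⊎ c ≡ τ a
        to m with c ≟ a | c ≟ τ a
        ... | yes e | _     = inj₂ (inj₁ e)
        ... | no _  | yes e = inj₂ (inj₂ e)
        ... | no p  | no q  = inj₁ (m , p , q)
        from : (τ c ≢ c × c ≢ a × c ≢ τ a) ⊎ c ≡ a ⊎ c ≡ τ a → τ c ≢ c
        from (inj₁ (m , _))      = m
        from (inj₂ (inj₁ refl)) = τa≢a
        from (inj₂ (inj₂ refl)) = τ-moved τa≢a

    ∑-chosen : ∑ᶠ (λ a → ∑ᶠ (λ b → ∑ᶠ (λ c → ∑ᶠ (λ d → ⟨ chosen? a b c d ⟩)))) ≡ 8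
    ∑-chosen = begin
      ∑ᶠ (λ a → ∑ᶠ (λ b → ∑ᶠ (λ c → ∑ᶠ (λ d → ⟨ chosen? a b c d ⟩))))
        ≡⟨ ∑ᶠ-cong (λ a → ∑ᶠ-cong (λ b → ∑ᶠ-cong (λ c → sum-d a b c))) ⟩
      ∑ᶠ (λ a → ∑ᶠ (λ b → ∑ᶠ (λ c → ⟨ b ≟ τ a ⟩ * (⟨ moved? a ⟩ * ⟨ second? a c ⟩))))
        ≡⟨ ∑ᶠ-cong (λ a → trans (∑ᶠ-cong (λ b → ∑ᶠ-*ˡ ⟨ b ≟ τ a ⟩ _)) (∑ᶠ-δ (τ a) _)) ⟩
      ∑ᶠ (λ a → ∑ᶠ (λ c → ⟨ moved? a ⟩ * ⟨ second? a c ⟩))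
        ≡⟨ ∑ᶠ-cong (λ a → trans (∑ᶠ-*ˡ ⟨ moved? a ⟩ _) (⟨⟩-guard (moved? a) (∑-second a))) ⟩
      ∑ᶠ (λ a → ⟨ moved? a ⟩ * 2)
        ≡⟨ trans (∑ᶠ-*ʳ 2 _) (cong (_* 2) card) ⟩
      8 ∎
      where
      sum-d : ∀ a b c → ∑ᶠ (λ d → ⟨ chosen? a b c d ⟩) ≡ ⟨ b ≟ τ a ⟩ * (⟨ moved? a ⟩ * ⟨ second? a c ⟩)
      sum-d a b c = trans (∑ᶠ-cong (λ d → trans (⟨⟩-× (moved? a) ((b ≟ τ a) ×-dec second? a c ×-dec (d ≟ τ c)))
          (trans (cong (⟨ moved? a ⟩ *_) (trans (⟨⟩-× (b ≟ τ a) (second? a c ×-dec (d ≟ τ c)))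
            (cong (⟨ b ≟ τ a ⟩ *_) (⟨⟩-× (second? a c) (d ≟ τ c)))))
            (solve 4 (λ m e s d → m :* (e :* (s :* d)) := d :* (e :* (m :* s))) refl ⟨ moved? a ⟩ ⟨ b ≟ τ a ⟩ ⟨ second? a c ⟩ ⟨
              d ≟ τ c ⟩))))
        (∑ᶠ-δ (τ c) _)

    chosen⇒distinct : ∀ {a b c d} → Chosen a b c d → Distinct a b c d
    chosen⇒distinct {a} {b} {c} {d} (ma , refl , (mc , c≢a , c≢b) , refl) =
      (ma ∘ sym) , (c≢a ∘ sym) , (λ e → c≢b (trans (sym (invol c)) (cong τ (sym e)))) , (c≢b ∘ sym) , (λ e → c≢a (sym (injτ e)))
        , (mc ∘ sym)

    chosen⇒product : ∀ {a b c d} → Chosen a b c d → ∀ x → transpose a b (transpose c d x) ≡ τ x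
    chosen⇒product {a} {b} {c} {d} ch@(ma , refl , (mc , _) , refl) x = by-cases (x ≟ a) (x ≟ b) (x ≟ c) (x ≟ d)
      where
      dist = chosen⇒distinct ch
      by-cases : Dec (x ≡ a) → Dec (x ≡ b) → Dec (x ≡ c) → Dec (x ≡ d) → transpose a b (transpose c d x) ≡ τ x
      by-cases with dist
      ... | ab , ac , ad , bc , bd , cd = λ where
        (yes refl) _ _ _ → trans (cong (transpose a b) (transpose-other c d ac ad)) (transpose-at-a a b)
        (no _) (yes refl) _ _ → trans (cong (transpose a b) (transpose-other c d bc bd)) (trans (transpose-at-b a b)
          (sym (invol a)))
        (no _) (no _) (yes refl) _ → trans (cong (transpose a b) (transpose-at-a c d)) (transpose-other a b (ad ∘ sym)
          (bd ∘ sym))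
        (no _) (no _) (no _) (yes refl) → trans (cong (transpose a b) (transpose-at-b c d))
          (trans (transpose-other a b (ac ∘ sym) (bc ∘ sym)) (sym (invol c)))
        (no xa) (no xb) (no xc) (no xd) → trans (cong (transpose a b) (transpose-other c d xc xd))
          (trans (transpose-other a b xa xb)
          (sym (decidable-stable (τ x ≟ x) (four-points moved? card dist ma (τ-moved ma) mc (τ-moved mc) xa xb xc xd))))

  product⇒chosen : (invol : ∀ x → τ (τ x) ≡ x) → ∀ {a b c d} → Distinct a b c d → (∀ x → transpose a b (transpose c d x) ≡ τ x)
    → Involutive.Chosen invol a b c d
  product⇒chosen invol {a} {b} {c} {d} (ab , ac , ad , bc , bd , cd) eq =
    (λ e → ab (trans (sym e) τa)) , sym τa , ((λ e → cd (trans (sym e) τc)) , (ac ∘ sym) , (λ e → bc (sym (trans e τa)))) , sym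
      τc
    where
    τa : τ a ≡ b
    τa = trans (sym (eq a)) (trans (cong (transpose a b) (transpose-other c d ac ad)) (transpose-at-a a b))
    τc : τ c ≡ d
    τc = trans (sym (eq c)) (trans (cong (transpose a b) (transpose-at-a c d)) (transpose-other a b (ad ∘ sym) (bd ∘ sym)))

-- Reduction to products of two transpositions

∑⁴ : ∀ {n} → (Fin n → Fin n → Fin n → Fin n → ℕ) → ℕ
∑⁴ f = ∑ᶠ (λ a → ∑ᶠ (λ b → ∑ᶠ (λ c → ∑ᶠ (λ d → f a b c d))))

module _ {n : ℕ} where

  ∑⁴-cong : ∀ {f g : Fin n → Fin n → Fin n → Fin n → ℕ} → (∀ a b c d → f a b c d ≡ g a b c d) → ∑⁴ f ≡ ∑⁴ g
  ∑⁴-cong eq = ∑ᶠ-cong (λ a → ∑ᶠ-cong (λ b → ∑ᶠ-cong (λ c → ∑ᶠ-cong (eq a b c))))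

  ∑⁴-*ˡ : ∀ k (f : Fin n → Fin n → Fin n → Fin n → ℕ) → ∑⁴ (λ a b c d → k * f a b c d) ≡ k * ∑⁴ f
  ∑⁴-*ˡ k f = trans (∑ᶠ-cong (λ a → trans (∑ᶠ-cong (λ b → trans (∑ᶠ-cong (λ c →
    ∑ᶠ-*ˡ k (f a b c))) (∑ᶠ-*ˡ k _))) (∑ᶠ-*ˡ k _))) (∑ᶠ-*ˡ k _)

  ∑⁴-+ : ∀ (f g : Fin n → Fin n → Fin n → Fin n → ℕ) → ∑⁴ (λ a b c d → f a b c d + g a b c d) ≡ ∑⁴ f + ∑⁴ g
  ∑⁴-+ f g = trans (∑ᶠ-cong (λ a → trans (∑ᶠ-cong (λ b → trans (∑ᶠ-cong (λ c →
    ∑ᶠ-+ (f a b c) (g a b c))) (∑ᶠ-+ _ _))) (∑ᶠ-+ _ _))) (∑ᶠ-+ _ _)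

  ∑⁴-swap : ∀ {A : Set} (xs : List A) (f : A → Fin n → Fin n → Fin n → Fin n → ℕ) →
    ∑ xs (λ x → ∑⁴ (f x)) ≡ ∑⁴ (λ a b c d → ∑ xs (λ x → f x a b c d))
  ∑⁴-swap xs f = trans (∑-swap xs (allFin n) _) (∑ᶠ-cong (λ a → trans (∑-swap xs (allFin n) _) (∑ᶠ-cong (λ b →
    trans (∑-swap xs (allFin n) _) (∑ᶠ-cong (λ c → ∑-swap xs (allFin n) (λ x → f x a b c)))))))

  product : Fin n → Fin n → Fin n → Fin n → Fin n → Fin n
  product a b c d x = transpose a b (transpose c d x)

  product-moves : ∀ {a b c d} → Distinct a b c d → ∀ x → ⟨ ¬? (product a b c d x ≟ x) ⟩ ≡ (⟨ x ≟ a ⟩ + ⟨ x ≟ b ⟩) +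
    (⟨ x ≟ c ⟩ + ⟨ x ≟ d ⟩)
  product-moves {a} {b} {c} {d} (ab , ac , ad , bc , bd , cd) x = begin
    ⟨ ¬? (product a b c d x ≟ x) ⟩ ≡⟨ ⟨⟩-cong to from (¬? (product a b c d x ≟ x)) (((x ≟ a) ⊎-dec (x ≟ b)) ⊎-dec
      ((x ≟ c) ⊎-dec (x ≟ d))) ⟩
    ⟨ ((x ≟ a) ⊎-dec (x ≟ b)) ⊎-dec ((x ≟ c) ⊎-dec (x ≟ d)) ⟩ ≡⟨ ⟨⟩-⊎ ((x ≟ a) ⊎-dec (x ≟ b)) ((x ≟ c) ⊎-dec (x ≟ d)) disjoint ⟩
    ⟨ (x ≟ a) ⊎-dec (x ≟ b) ⟩ + ⟨ (x ≟ c) ⊎-dec (x ≟ d) ⟩ ≡⟨ cong₂ _+_ (⟨⟩-⊎ (x ≟ a) (x ≟ b) (λ { refl → ab }))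
      (⟨⟩-⊎ (x ≟ c) (x ≟ d) (λ { refl → cd })) ⟩
    (⟨ x ≟ a ⟩ + ⟨ x ≟ b ⟩) + (⟨ x ≟ c ⟩ + ⟨ x ≟ d ⟩) ∎
    where
    disjoint : x ≡ a ⊎ x ≡ b → ¬ (x ≡ c ⊎ x ≡ d)
    disjoint (inj₁ refl) = [ ac , ad ]′
    disjoint (inj₂ refl) = [ bc , bd ]′
    from : (x ≡ a ⊎ x ≡ b) ⊎ (x ≡ c ⊎ x ≡ d) → product a b c d x ≢ x
    from (inj₁ (inj₁ refl)) e = ab
      (sym (trans (sym (trans (cong (transpose a b) (transpose-other c d ac ad)) (transpose-at-a a b))) e))
    from (inj₁ (inj₂ refl)) e = ab (trans (sym (trans (cong (transpose a b) (transpose-other c d bc bd)) (transpose-at-b a b)))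
      e)
    from (inj₂ (inj₁ refl)) e = cd
      (sym (trans (sym (trans (cong (transpose a b) (transpose-at-a c d)) (transpose-other a b (ad ∘ sym) (bd ∘ sym)))) e))
    from (inj₂ (inj₂ refl)) e = cd
      (trans (sym (trans (cong (transpose a b) (transpose-at-b c d)) (transpose-other a b (ac ∘ sym) (bc ∘ sym)))) e)
    to : product a b c d x ≢ x → (x ≡ a ⊎ x ≡ b) ⊎ (x ≡ c ⊎ x ≡ d)
    to ne = by-cases (x ≟ a) (x ≟ b) (x ≟ c) (x ≟ d)
      where
      by-cases : Dec (x ≡ a) → Dec (x ≡ b) → Dec (x ≡ c) → Dec (x ≡ d) → (x ≡ a ⊎ x ≡ b) ⊎ (x ≡ c ⊎ x ≡ d)
      by-cases (yes e) _ _ _ = inj₁ (inj₁ e)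
      by-cases _ (yes e) _ _ = inj₁ (inj₂ e)
      by-cases _ _ (yes e) _ = inj₂ (inj₁ e)
      by-cases _ _ _ (yes e) = inj₂ (inj₂ e)
      by-cases (no xa) (no xb) (no xc) (no xd) = contradiction (trans (cong (transpose a b) (transpose-other c d xc xd))
        (transpose-other a b xa xb)) ne

module _ {n} (β : Fin n → Fin n) (injβ : Injective _≡_ _≡_ β) where
  private module β = Cycles β injβ

  twisted : Fin n → Fin n → Fin n → Fin n → Fin n → Fin n
  twisted a b c d x = β (product a b c d x)

  twisted-injective : ∀ a b c d → Injective _≡_ _≡_ (twisted a b c d)
  twisted-injective a b c d e = transpose-injective c d (transpose-injective a b (injβ e))

  bad? : ∀ (α : Fin n → Fin n) x → Dec (α (β x) ≢ β (α x))
  bad? α x = ¬? (α (β x) ≟ β (α x))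

  numBad-∑ : ∀ (α : Fin n → Fin n) → numBad α β ≡ ∑ᶠ (λ x → ⟨ bad? α x ⟩)
  numBad-∑ α = sym (∑-def (allFin n) _)

  module _ {α : Fin n → Fin n} (injα : Injective _≡_ _≡_ α) where
    private module α = Cycles α injα

    -- The 4-cycle is (a b)(b c)(c d), and three transpositions change the parity of the number of
    -- cycles, whereas conjugation by α preserves that number.
    noFourCycle : ∀ {a b c d} → Distinct a b c d → ¬ (∀ x → α (β (transpose a b (transpose b c (transpose c d x)))) ≡ β (α x))
    noFourCycle {a} {b} {c} {d} (ab , ac , ad , bc , bd , cd) conj = not-¬ {even β.numCycles} refl (begin
      even β.numCycles ≡⟨ cong even same-number ⟨
      even δ₃.numCycles ≡⟨ Adjacent-even (SwapCycles.numCycles-swap {β = δ₂} {δ = δ₃} inj₂′ inj₃ cd (transpose-IsSwap c d δ₂)) ⟩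
      not (even δ₂.numCycles) ≡⟨ cong not (Adjacent-even (SwapCycles.numCycles-swap {β = δ₁} {δ = δ₂} inj₁′ inj₂′ bc
        (transpose-IsSwap b c δ₁))) ⟩
      not (not (even δ₁.numCycles)) ≡⟨ not-involutive _ ⟩
      even δ₁.numCycles ≡⟨ Adjacent-even (SwapCycles.numCycles-swap {β = β} {δ = δ₁} injβ inj₁′ ab (transpose-IsSwap a b β)) ⟩
      not (even β.numCycles) ∎)
      where
      δ₁ δ₂ δ₃ : Fin n → Fin n
      δ₁ = β ∘ transpose a b
      δ₂ = δ₁ ∘ transpose b c
      δ₃ = δ₂ ∘ transpose c d
      inj₁′ : Injective _≡_ _≡_ δ₁
      inj₁′ e = transpose-injective a b (injβ e)
      inj₂′ : Injective _≡_ _≡_ δ₂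
      inj₂′ {x} {y} e = transpose-injective b c (inj₁′ {transpose b c x} {transpose b c y} e)
      inj₃ : Injective _≡_ _≡_ δ₃
      inj₃ {x} {y} e = transpose-injective c d (inj₂′ {transpose c d x} {transpose c d y} e)
      module δ₁ = Cycles δ₁ inj₁′
      module δ₂ = Cycles δ₂ inj₂′
      module δ₃ = Cycles δ₃ inj₃
      same-number : δ₃.numCycles ≡ β.numCycles
      same-number = ∑-cong (upTo (suc n)) (Conjugacy.conjugate⇒count {β = β} {γ = δ₃} injβ inj₃ {α} injα conj)

    -- The permutation τ = β⁻¹α⁻¹βα, for which βτ = α⁻¹βα; the points that it moves are the bad
    -- commuting points.
    commutator : Fin n → Fin n
    commutator x = β.inv (α.inv (β (α x)))

    commutator-spec : ∀ x → α (β (commutator x)) ≡ β (α x)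
    commutator-spec x = trans (cong α (β.β-inv _)) (α.β-inv _)

    commutator-unique : ∀ {x y} → α (β y) ≡ β (α x) → y ≡ commutator x
    commutator-unique {x} e = injβ (injα (trans e (sym (commutator-spec x))))

    commutator-injective : Injective _≡_ _≡_ commutator
    commutator-injective {x} {y} e = injα (injβ (trans (sym (commutator-spec x)) (trans (cong (α ∘ β) e) (commutator-spec y))))

    bad⇔moved : ∀ x → ⟨ bad? α x ⟩ ≡ ⟨ ¬? (commutator x ≟ x) ⟩
    bad⇔moved x = ⟨⟩-cong (λ ne e → ne (trans (cong (α ∘ β) (sym e)) (commutator-spec x)))
      (λ ne e → ne (sym (commutator-unique {x} {x} e))) (bad? α x) (¬? (commutator x ≟ x))

    -- With four bad points the commutator is either an involution, for which the quadruples are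
    -- those of `∑-chosen`, or a 4-cycle, which `noFourCycle` rules out.
    eight-twists : numBad α β ≡ 4 → ∑⁴ (λ a b c d → ⟨ distinct? a b c d ⟩ * ⟨ conj? β (twisted a b c d) α ⟩) ≡ 8
    eight-twists four = helper involutive-or-fourCycle
      where
      open FourMoved {τ = commutator} commutator-injective (trans (∑ᶠ-cong {g = λ x → ⟨ bad? α x ⟩} (λ x → sym (bad⇔moved x)))
        (trans (sym (numBad-∑ α)) four))
      helper : (∀ x → commutator (commutator x) ≡ x) ⊎ IsFourCycle → ∑⁴ (λ a b c d → ⟨ distinct? a b c d ⟩ * ⟨ conj? β
        (twisted a b c d) α ⟩) ≡ 8
      helper (inj₁ invol) = trans (∑⁴-cong (λ a b c d → trans (sym (⟨⟩-× (distinct? a b c d) (conj? β (twisted a b c d) α)))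
        (⟨⟩-cong (λ (dist , conj) → product⇒chosen invol dist (λ x → commutator-unique (conj x)))
                 (λ ch → chosen⇒distinct ch , λ x → trans (cong (α ∘ β) (chosen⇒product ch x)) (commutator-spec x))
                 (distinct? a b c d ×-dec conj? β (twisted a b c d) α) (chosen? a b c d)))) ∑-chosen
        where open Involutive invol
      helper (inj₂ (a , b , c , d , dist@(ab , ac , ad , bc , bd , cd) , τa , τb , τc , τd , fixed)) =
        contradiction (λ x → trans (cong (α ∘ β) (by-cases x (x ≟ a) (x ≟ b) (x ≟ c) (x ≟ d))) (commutator-spec x))
          (noFourCycle dist)
        where
        by-cases : ∀ x → Dec (x ≡ a) → Dec (x ≡ b) → Dec (x ≡ c) → Dec (x ≡ d) → transpose a b (transpose b c (transpose c d x))
          ≡ commutator x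
        by-cases x (yes refl) _ _ _ = trans (cong (transpose a b ∘ transpose b c) (transpose-other c d ac ad))
          (trans (cong (transpose a b) (transpose-other b c ab ac)) (trans (transpose-at-a a b) (sym τa)))
        by-cases x (no _) (yes refl) _ _ = trans (cong (transpose a b ∘ transpose b c) (transpose-other c d bc bd))
          (trans (cong (transpose a b) (transpose-at-a b c)) (trans (transpose-other a b (ac ∘ sym) (bc ∘ sym)) (sym τb)))
        by-cases x (no _) (no _) (yes refl) _ = trans (cong (transpose a b ∘ transpose b c) (transpose-at-a c d))
          (trans (cong (transpose a b) (transpose-other b c (bd ∘ sym) (cd ∘ sym)))
          (trans (transpose-other a b (ad ∘ sym) (bd ∘ sym)) (sym τc)))
        by-cases x (no _) (no _) (no _) (yes refl) = trans (cong (transpose a b ∘ transpose b c) (transpose-at-b c d))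
          (trans (cong (transpose a b) (transpose-at-b b c)) (trans (transpose-at-b a b) (sym τd)))
        by-cases x (no xa) (no xb) (no xc) (no xd) = trans (cong (transpose a b ∘ transpose b c) (transpose-other c d xc xd))
          (trans (cong (transpose a b) (transpose-other b c xb xc)) (trans (transpose-other a b xa xb)
          (sym (fixed xa xb xc xd))))

    ∑-bad : ∀ {a b c d} → Distinct a b c d → (∀ x → α (twisted a b c d x) ≡ β (α x)) → ∀ F →
      ∑ᶠ (λ x → ⟨ bad? α x ⟩ * F x) ≡ (F a + F b) + (F c + F d)
    ∑-bad {a} {b} {c} {d} dist conj F = begin
      ∑ᶠ (λ x → ⟨ bad? α x ⟩ * F x) ≡⟨ ∑ᶠ-cong
        (λ x → trans (cong (_* F x) (trans (bad⇔moved x) (trans (moved-cong x) (product-moves dist x))))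
          (solve 5 (λ p q r s f → ((p :+ q) :+ (r :+ s)) :* f := (p :* f :+ q :* f) :+ (r :* f :+ s :* f)) refl ⟨ x ≟ a ⟩ ⟨ x ≟
            b ⟩ ⟨ x ≟ c ⟩ ⟨ x ≟ d ⟩ (F x))) ⟩
      ∑ᶠ (λ x → (⟨ x ≟ a ⟩ * F x + ⟨ x ≟ b ⟩ * F x) + (⟨ x ≟ c ⟩ * F x + ⟨ x ≟ d ⟩ * F x)) ≡⟨ trans (∑ᶠ-+ _ _)
        (cong₂ _+_ (∑ᶠ-+ _ _) (∑ᶠ-+ _ _)) ⟩
      (∑ᶠ (λ x → ⟨ x ≟ a ⟩ * F x) + ∑ᶠ (λ x → ⟨ x ≟ b ⟩ * F x)) + (∑ᶠ (λ x → ⟨ x ≟ c ⟩ * F x) + ∑ᶠ (λ x → ⟨ x ≟ d ⟩ * F x)) ≡⟨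
        cong₂ _+_ (cong₂ _+_ (∑ᶠ-δ a F) (∑ᶠ-δ b F)) (cong₂ _+_ (∑ᶠ-δ c F) (∑ᶠ-δ d F)) ⟩
      (F a + F b) + (F c + F d) ∎
      where
      moved-cong : ∀ x → ⟨ ¬? (commutator x ≟ x) ⟩ ≡ ⟨ ¬? (product a b c d x ≟ x) ⟩
      moved-cong x = cong (λ y → ⟨ ¬? (y ≟ x) ⟩) (sym (commutator-unique (conj x)))

    numBad-twisted : ∀ {a b c d} → Distinct a b c d → (∀ x → α (twisted a b c d x) ≡ β (α x)) → numBad α β ≡ 4
    numBad-twisted dist conj = trans (numBad-∑ α) (trans (∑ᶠ-cong (λ x → sym (*-identityʳ _))) (∑-bad dist conj (λ _ → 1)))

  -- Double counting of pairs of a permutation and a quadruple describing its commutator. On such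
  -- pairs `P` depends on the quadruple alone, which frees the sum over α to become a number of
  -- conjugators.
  countPerms-twisted : ∀ (P : (Fin n → Fin n) → Bool) (q : Fin n → Fin n → Fin n → Fin n → Bool) →
    (∀ α → P α ≡ true → numBad α β ≡ 4) →
    (∀ α → Injective _≡_ _≡_ α → ∀ a b c d → Distinct a b c d → (∀ x → α (twisted a b c d x) ≡ β (α x)) → P α ≡ q a b c d) →
    8 * countPerms n P ≡ ∑⁴ (λ a b c d → ⟨ distinct? a b c d ⟩ * (⟦ q a b c d ⟧ * conjugators β (twisted a b c d)))
  countPerms-twisted P q P⇒4 P≡q = begin
    8 * countPerms n P
      ≡⟨ trans (cong (8 *_) (countPerms-∑ P)) (sym (∑-*ˡ funs 8 _)) ⟩
    ∑ funs (λ α → 8 * (⟨ perm? α ⟩ * ⟦ P α ⟧))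
      ≡⟨ ∑-cong funs expand ⟩
    ∑ funs (λ α → ∑⁴ (λ a b c d → ⟨ perm? α ⟩ * ⟦ P α ⟧ * (⟨ distinct? a b c d ⟩ * ⟨ conj? β (twisted a b c d) α ⟩)))
      ≡⟨ ∑⁴-swap funs _ ⟩
    ∑⁴ (λ a b c d → ∑ funs (λ α → ⟨ perm? α ⟩ * ⟦ P α ⟧ * (⟨ distinct? a b c d ⟩ * ⟨ conj? β (twisted a b c d) α ⟩)))
      ≡⟨ ∑⁴-cong (λ a b c d → trans (∑-cong funs (rearrange a b c d)) (trans (∑-*ˡ funs ⟨ distinct? a b c d ⟩ _)
        (cong (⟨ distinct? a b c d ⟩ *_) (∑-*ˡ funs ⟦ q a b c d ⟧ _)))) ⟩
    ∑⁴ (λ a b c d → ⟨ distinct? a b c d ⟩ * (⟦ q a b c d ⟧ * conjugators β (twisted a b c d))) ∎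
    where
    expand : ∀ α → 8 * (⟨ perm? α ⟩ * ⟦ P α ⟧) ≡ ∑⁴ (λ a b c d → ⟨ perm? α ⟩ * ⟦ P α ⟧ * (⟨ distinct? a b c d ⟩ * ⟨ conj? β
      (twisted a b c d) α ⟩))
    expand α = begin
      8 * (⟨ perm? α ⟩ * ⟦ P α ⟧) ≡⟨ solve 2 (λ p q → con 8 :* (p :* q) := p :* (q :* con 8)) refl ⟨ perm? α ⟩ ⟦ P α ⟧ ⟩
      ⟨ perm? α ⟩ * (⟦ P α ⟧ * 8) ≡⟨ ⟨⟩-guard (perm? α) (λ injα → ⟦⟧-guard (P α) (λ Pα → sym (eight-twists injα (P⇒4 α Pα)))) ⟩
      ⟨ perm? α ⟩ * (⟦ P α ⟧ * ∑⁴ (λ a b c d → ⟨ distinct? a b c d ⟩ * ⟨ conj? β (twisted a b c d) α ⟩)) ≡⟨ *-assoc ⟨ perm? α ⟩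
        ⟦ P α ⟧ _ ⟨
      ⟨ perm? α ⟩ * ⟦ P α ⟧ * ∑⁴ (λ a b c d → ⟨ distinct? a b c d ⟩ * ⟨ conj? β (twisted a b c d) α ⟩) ≡⟨ ∑⁴-*ˡ
        (⟨ perm? α ⟩ * ⟦ P α ⟧) _ ⟨
      ∑⁴ (λ a b c d → ⟨ perm? α ⟩ * ⟦ P α ⟧ * (⟨ distinct? a b c d ⟩ * ⟨ conj? β (twisted a b c d) α ⟩)) ∎
    rearrange : ∀ a b c d α → ⟨ perm? α ⟩ * ⟦ P α ⟧ * (⟨ distinct? a b c d ⟩ * ⟨ conj? β (twisted a b c d) α ⟩)
      ≡ ⟨ distinct? a b c d ⟩ * (⟦ q a b c d ⟧ * (⟨ perm? α ⟩ * ⟨ conj? β (twisted a b c d) α ⟩))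
    rearrange a b c d α = begin
      ⟨ perm? α ⟩ * ⟦ P α ⟧ * (D * C) ≡⟨ solve 4 (λ p q d c → p :* q :* (d :* c) := d :* (p :* (c :* q))) refl ⟨ perm? α ⟩ ⟦ P α
        ⟧ D C ⟩
      D * (⟨ perm? α ⟩ * (C * ⟦ P α ⟧)) ≡⟨ ⟨⟩-guard (distinct? a b c d) (λ dist → ⟨⟩-guard (perm? α)
        (λ injα → ⟨⟩-guard (conj? β (twisted a b c d) α) (λ conj → cong ⟦_⟧ (P≡q α injα a b c d dist conj)))) ⟩
      D * (⟨ perm? α ⟩ * (C * ⟦ q a b c d ⟧)) ≡⟨ solve 4 (λ p q d c → d :* (p :* (c :* q)) := d :* (q :* (p :* c))) refl ⟨ perm?
        α ⟩ ⟦ q a b c d ⟧ D C ⟩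
      D * (⟦ q a b c d ⟧ * (⟨ perm? α ⟩ * C)) ∎
      where
      D = ⟨ distinct? a b c d ⟩
      C = ⟨ conj? β (twisted a b c d) α ⟩

-- The cycle pattern of the bad points

-- The sum of squares separates the partitions of 4: it is 16, 10, 8, 6, 4 on [4], [3,1], [2,2], [2,1,1], [1,1,1,1].
sumSq : List ℕ → ℕ
sumSq l = sum (map (λ k → k * k) l)

-- A profile lists its cycles in the order of their representatives, so all eight compositions of 4
-- can occur and not merely the five partitions.
compositions-of-4 : ∀ (C : List ℕ → Set) →
  C (4 ∷ []) → C (3 ∷ 1 ∷ []) → C (1 ∷ 3 ∷ []) → C (2 ∷ 2 ∷ []) →
  C (2 ∷ 1 ∷ 1 ∷ []) → C (1 ∷ 2 ∷ 1 ∷ []) → C (1 ∷ 1 ∷ 2 ∷ []) → C (1 ∷ 1 ∷ 1 ∷ 1 ∷ []) →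
  ∀ l → All (0 <_) l → sum l ≡ 4 → C l
compositions-of-4 C c4 c31 c13 c22 c211 c121 c112 c1111 = go
  where
  zero-sum : ∀ l → All (0 <_) l → sum l ≡ 0 → l ≡ []
  zero-sum [] _ _ = refl
  zero-sum (suc _ ∷ _) _ ()
  zero-sum (zero ∷ _) (() ∷ _) _
  sum-1 : ∀ l → All (0 <_) l → sum l ≡ 1 → l ≡ 1 ∷ []
  sum-1 [] _ ()
  sum-1 (zero ∷ _) (() ∷ _) _
  sum-1 (1 ∷ l) (_ ∷ p) e = cong (1 ∷_) (zero-sum l p (suc-injective e))
  sum-1 (suc (suc _) ∷ _) _ ()
  go : ∀ l → All (0 <_) l → sum l ≡ 4 → C l
  go [] _ ()
  go (zero ∷ _) (() ∷ _) _
  go (4 ∷ l) (_ ∷ p) e rewrite zero-sum l p (+-cancelˡ-≡ 4 _ _ e) = c4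
  go (3 ∷ l) (_ ∷ p) e rewrite sum-1 l p (+-cancelˡ-≡ 3 _ _ e) = c31
  go (2 ∷ []) _ ()
  go (2 ∷ zero ∷ _) (_ ∷ () ∷ _) _
  go (2 ∷ 1 ∷ l) (_ ∷ _ ∷ p) e rewrite sum-1 l p (+-cancelˡ-≡ 3 _ _ e) = c211
  go (2 ∷ 2 ∷ l) (_ ∷ _ ∷ p) e rewrite zero-sum l p (+-cancelˡ-≡ 4 _ _ e) = c22
  go (2 ∷ suc (suc (suc _)) ∷ _) _ ()
  go (1 ∷ []) _ ()
  go (1 ∷ zero ∷ _) (_ ∷ () ∷ _) _
  go (1 ∷ 3 ∷ l) (_ ∷ _ ∷ p) e rewrite zero-sum l p (+-cancelˡ-≡ 4 _ _ e) = c13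
  go (1 ∷ 2 ∷ l) (_ ∷ _ ∷ p) e rewrite sum-1 l p (+-cancelˡ-≡ 3 _ _ e) = c121
  go (1 ∷ 1 ∷ []) _ ()
  go (1 ∷ 1 ∷ zero ∷ _) (_ ∷ _ ∷ () ∷ _) _
  go (1 ∷ 1 ∷ 1 ∷ l) (_ ∷ _ ∷ _ ∷ p) e rewrite sum-1 l p (+-cancelˡ-≡ 3 _ _ e) = c1111
  go (1 ∷ 1 ∷ 2 ∷ l) (_ ∷ _ ∷ _ ∷ p) e rewrite zero-sum l p (+-cancelˡ-≡ 4 _ _ e) = c112
  go (1 ∷ 1 ∷ suc (suc (suc _)) ∷ _) _ ()
  go (1 ∷ suc (suc (suc (suc _))) ∷ _) _ ()
  go (suc (suc (suc (suc (suc _)))) ∷ _) _ ()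

-- Trades the comparison of sorted profiles for that of a single number, which can be computed from
-- the bad points directly.
Detects : List ℕ → ℕ → Set
Detects ks e = ∀ l → All (0 <_) l → sum l ≡ 4 → (sortℕ l ==L sortℕ ks) ≡ (sumSq l ≡ᵇ e)

detects : ∀ ks e → _ → _ → _ → _ → _ → _ → _ → _ → Detects ks e
detects ks e = compositions-of-4 (λ l → (sortℕ l ==L sortℕ ks) ≡ (sumSq l ≡ᵇ e))

detects-4 : Detects (4 ∷ []) 16
detects-4 = detects (4 ∷ []) 16 refl refl refl refl refl refl refl refl

detects-31 : Detects (3 ∷ 1 ∷ []) 10
detects-31 = detects (3 ∷ 1 ∷ []) 10 refl refl refl refl refl refl refl refl

detects-22 : Detects (2 ∷ 2 ∷ []) 8
detects-22 = detects (2 ∷ 2 ∷ []) 8 refl refl refl refl refl refl refl refl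

detects-211 : Detects (2 ∷ 1 ∷ 1 ∷ []) 6
detects-211 = detects (2 ∷ 1 ∷ 1 ∷ []) 6 refl refl refl refl refl refl refl refl

module _ {n} (α β : Fin n → Fin n) where

  -- The local function of badProfile has no name outside Defs: unification recovers it.
  cyclePart : ∃ λ (f : Fin n → List ℕ) → badProfile α β ≡ concatMap f (allFin n)
  cyclePart = _ , refl

  badInCycle : Fin n → ℕ
  badInCycle r = countFin n (λ b → sameCycle β r b ∧ isBad α β b)

  cyclePart-shape : ∀ r → proj₁ cyclePart r ≡ (if isRep β r then (if badInCycle r ≡ᵇ 0 then [] else badInCycle r ∷ []) else [])
  cyclePart-shape r with isRep β r | badInCycle r
  ... | true  | suc m = refl
  ... | true  | zero  = refl
  ... | false | _     = refl

  private
    shape : Bool → ℕ → List ℕ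
    shape b m = if b then (if m ≡ᵇ 0 then [] else m ∷ []) else []

    badProfile-shape : badProfile α β ≡ concatMap (λ r → shape (isRep β r) (badInCycle r)) (allFin n)
    badProfile-shape = trans (proj₂ cyclePart) (concatMap-cong cyclePart-shape (allFin n))

    ∑-shape : ∀ f → f 0 ≡ 0 → ∀ b m → ∑ (shape b m) f ≡ ⟦ b ⟧ * f m
    ∑-shape f f0 true zero    = trans (∑-def [] f) (sym (trans (*-identityˡ (f 0)) f0))
    ∑-shape f f0 true (suc m) = ∑-def (suc m ∷ []) f
    ∑-shape f f0 false m      = ∑-def [] f

    shape-positive : ∀ b m → All (0 <_) (shape b m)
    shape-positive true zero    = []
    shape-positive true (suc m) = s≤s z≤n ∷ []
    shape-positive false m      = []

  badProfile-positive : All (0 <_) (badProfile α β)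
  badProfile-positive = subst (All (0 <_)) (sym badProfile-shape)
    (All.concat⁺ (All.map⁺ (All.tabulate {xs = allFin n} (λ {r} _ → shape-positive (isRep β r) (badInCycle r)))))

  ∑-badProfile : ∀ f → f 0 ≡ 0 → ∑ (badProfile α β) f ≡ ∑ᶠ (λ r → ⟦ isRep β r ⟧ * f (badInCycle r))
  ∑-badProfile f f0 = trans (cong (λ l → ∑ l f) badProfile-shape) (trans (∑-concatMap _ f (allFin n))
    (∑ᶠ-cong (λ r → ∑-shape f f0 (isRep β r) (badInCycle r))))

module _ {n} (β : Fin n → Fin n) (injβ : Injective _≡_ _≡_ β) where
  private module β = Cycles β injβ

  sameᵇ : Fin n → Fin n → Bool
  sameᵇ a b = does (β.same? a b)

  sameᵇ-sym : ∀ a b → sameᵇ a b ≡ sameᵇ b a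
  sameᵇ-sym a b = does-⇔ (mk⇔ β.Same-sym β.Same-sym) (β.same? a b) (β.same? b a)

  four : (Fin n → ℕ) → (a b c d : Fin n) → ℕ
  four F a b c d = (F a + F b) + (F c + F d)

  -- Ordered pairs, equal entries included, that lie on a common cycle: this is the sum of the
  -- squared block sizes of the partition that the cycles of β induce on the four points.
  samePairs : (a b c d : Fin n) → ℕ
  samePairs a b c d = four (λ x → four (λ y → ⟦ sameᵇ x y ⟧) a b c d) a b c d

  module _ {α : Fin n → Fin n} where

    badInCycle-∑ : ∀ r → badInCycle α β r ≡ ∑ᶠ (λ x → ⟨ β.same? r x ⟩ * ⟨ bad? β injβ α x ⟩)
    badInCycle-∑ r = trans (cong sum (map-cong (λ x → trans (⟦∧⟧ (sameCycle β r x) (isBad α β x))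
      (cong (λ b → ⟦ b ⟧ * ⟨ bad? β injβ α x ⟩) (sym (β.does-same? r x)))) (allFin n))) (sym (∑-def (allFin n) _))

    sum-badProfile : sum (badProfile α β) ≡ numBad α β
    sum-badProfile = begin
      sum (badProfile α β) ≡⟨ cong sum (map-id (badProfile α β)) ⟨
      sum (map id (badProfile α β)) ≡⟨ ∑-def (badProfile α β) id ⟨
      ∑ (badProfile α β) id ≡⟨ ∑-badProfile α β id refl ⟩
      ∑ᶠ (λ r → ⟦ isRep β r ⟧ * badInCycle α β r) ≡⟨ ∑ᶠ-cong (λ r → cong₂ (λ u v → ⟦ u ⟧ * v) (sym (β.does-rep? r))
        (badInCycle-∑ r)) ⟩
      ∑ᶠ (λ r → ⟨ β.rep? r ⟩ * ∑ᶠ (λ x → ⟨ β.same? r x ⟩ * ⟨ bad? β injβ α x ⟩)) ≡⟨ β.∑-cycles _ ⟨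
      ∑ᶠ (λ x → ⟨ bad? β injβ α x ⟩) ≡⟨ numBad-∑ β injβ α ⟨
      numBad α β ∎

    badInCycle-Same : ∀ {r x} → Same β r x → badInCycle α β r ≡ badInCycle α β x
    badInCycle-Same {r} {x} r~x = trans (badInCycle-∑ r) (trans (∑ᶠ-cong (λ y → cong (_* ⟨ bad? β injβ α y ⟩)
      (⟨⟩-cong (β.Same-trans (β.Same-sym r~x)) (β.Same-trans r~x) (β.same? r y) (β.same? x y)))) (sym (badInCycle-∑ x)))

    -- A cycle with k bad points accounts for k * k, that is, k for each of its bad points.
    sumSq-badProfile : sumSq (badProfile α β) ≡ ∑ᶠ (λ x → ⟨ bad? β injβ α x ⟩ * badInCycle α β x)
    sumSq-badProfile = begin
      sumSq (badProfile α β) ≡⟨ ∑-def (badProfile α β) _ ⟨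
      ∑ (badProfile α β) (λ k → k * k) ≡⟨ ∑-badProfile α β (λ k → k * k) refl ⟩
      ∑ᶠ (λ r → ⟦ isRep β r ⟧ * (badInCycle α β r * badInCycle α β r)) ≡⟨ ∑ᶠ-cong (λ r → cong₂ (λ u v → ⟦ u ⟧ * v)
        (sym (β.does-rep? r)) (square r)) ⟩
      ∑ᶠ (λ r → ⟨ β.rep? r ⟩ * ∑ᶠ (λ x → ⟨ β.same? r x ⟩ * (⟨ bad? β injβ α x ⟩ * badInCycle α β x))) ≡⟨ β.∑-cycles _ ⟨
      ∑ᶠ (λ x → ⟨ bad? β injβ α x ⟩ * badInCycle α β x) ∎
      where
      square : ∀ r → badInCycle α β r * badInCycle α β r ≡ ∑ᶠ (λ x → ⟨ β.same? r x ⟩ * (⟨ bad? β injβ α x ⟩ * badInCycle α β x))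
      square r = begin
        badInCycle α β r * badInCycle α β r ≡⟨ cong (_* badInCycle α β r) (badInCycle-∑ r) ⟩
        ∑ᶠ (λ x → ⟨ β.same? r x ⟩ * ⟨ bad? β injβ α x ⟩) * badInCycle α β r ≡⟨ ∑ᶠ-*ʳ (badInCycle α β r) _ ⟨
        ∑ᶠ (λ x → ⟨ β.same? r x ⟩ * ⟨ bad? β injβ α x ⟩ * badInCycle α β r) ≡⟨ ∑ᶠ-cong
          (λ x → trans (*-assoc ⟨ β.same? r x ⟩ _ _) (⟨⟩-guard (β.same? r x) (λ r~x → cong (⟨ bad? β injβ α x ⟩ *_)
          (badInCycle-Same r~x)))) ⟩
        ∑ᶠ (λ x → ⟨ β.same? r x ⟩ * (⟨ bad? β injβ α x ⟩ * badInCycle α β x)) ∎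

    sumSq-twisted : Injective _≡_ _≡_ α → ∀ {a b c d} → Distinct a b c d → (∀ x → α (twisted β injβ a b c d x) ≡ β (α x)) →
      sumSq (badProfile α β) ≡ samePairs a b c d
    sumSq-twisted injα {a} {b} {c} {d} dist conj = trans sumSq-badProfile
      (trans (∑ᶠ-cong (λ x → cong (⟨ bad? β injβ α x ⟩ *_) (inner x)))
      (∑-bad β injβ injα dist conj (λ x → four (λ y → ⟦ sameᵇ x y ⟧) a b c d)))
      where
      inner : ∀ x → badInCycle α β x ≡ four (λ y → ⟦ sameᵇ x y ⟧) a b c d
      inner x = trans (badInCycle-∑ x) (trans (∑ᶠ-cong (λ y → *-comm ⟨ β.same? x y ⟩ _)) (∑-bad β injβ injα dist conj
        (λ y → ⟨ β.same? x y ⟩)))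

  twists : (a b c d : Fin n) → ℕ
  twists a b c d = ⟨ distinct? a b c d ⟩ * conjugators β (twisted β injβ a b c d)

  cPart-twists : ∀ ks e → sum ks ≡ 4 → Detects ks e → 8 * cPart ks β ≡ ∑⁴ (λ a b c d → ⟦ samePairs a b c d ≡ᵇ e ⟧ * twists a b c
    d)
  cPart-twists ks e four≡ det = trans (countPerms-twisted β injβ _ (λ a b c d → samePairs a b c d ≡ᵇ e) isFour agree)
    (∑⁴-cong (λ a b c d → solve 3 (λ x y z → x :* (y :* z) := y :* (x :* z)) refl ⟨ distinct? a b c d ⟩ ⟦ samePairs a b c d ≡ᵇ e
      ⟧ _))
    where
    isFour : ∀ α → ((numBad α β ≡ᵇ sum ks) ∧ (sortℕ (badProfile α β) ==L sortℕ ks)) ≡ true → numBad α β ≡ 4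
    isFour α t = trans (≡ᵇ⇒≡ (numBad α β) (sum ks) (subst T (sym (∧-true (numBad α β ≡ᵇ sum ks) t)) tt)) four≡
      where
      ∧-true : ∀ b {c} → b ∧ c ≡ true → b ≡ true
      ∧-true true _ = refl
    agree : ∀ α → Injective _≡_ _≡_ α → ∀ a b c d → Distinct a b c d → (∀ x → α (twisted β injβ a b c d x) ≡ β (α x)) →
      ((numBad α β ≡ᵇ sum ks) ∧ (sortℕ (badProfile α β) ==L sortℕ ks)) ≡ (samePairs a b c d ≡ᵇ e)
    agree α injα a b c d dist conj = begin
      (numBad α β ≡ᵇ sum ks) ∧ (sortℕ (badProfile α β) ==L sortℕ ks) ≡⟨ cong (_∧ (sortℕ (badProfile α β) ==L sortℕ ks))
        (cong₂ _≡ᵇ_ bad4 four≡) ⟩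
      (sortℕ (badProfile α β) ==L sortℕ ks) ≡⟨ det (badProfile α β) (badProfile-positive α β) (trans (sum-badProfile {α})
        bad4) ⟩
      (sumSq (badProfile α β) ≡ᵇ e) ≡⟨ cong (_≡ᵇ e) (sumSq-twisted injα dist conj) ⟩
      (samePairs a b c d ≡ᵇ e) ∎
      where
      bad4 : numBad α β ≡ 4
      bad4 = numBad-twisted β injβ injα dist conj

  cK-twists : 8 * cK 4 β ≡ ∑⁴ twists
  cK-twists = trans (countPerms-twisted β injβ (λ α → numBad α β ≡ᵇ 4) (λ _ _ _ _ → true)
      (λ α t → ≡ᵇ⇒≡ (numBad α β) 4 (subst T (sym t) tt))
      (λ α injα a b c d dist conj → cong (_≡ᵇ 4) (numBad-twisted β injβ injα dist conj)))
    (∑⁴-cong (λ a b c d → cong (⟨ distinct? a b c d ⟩ *_) (*-identityˡ _)))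

-- Exhaustive checks over Booleans

∀ᵇ : (Bool → Bool) → Bool
∀ᵇ f = f true ∧ f false

∀ᵇ-elim : ∀ {f} → T (∀ᵇ f) → ∀ b → T (f b)
∀ᵇ-elim {f} t true  with f true | t
... | true | _ = tt
∀ᵇ-elim {f} t false with f true | t
... | true | u = u

-- Six Booleans record which of the six pairs among four points share a cycle.
∀⁶ : (Bool → Bool → Bool → Bool → Bool → Bool → Bool) → Bool
∀⁶ P = ∀ᵇ λ a → ∀ᵇ λ b → ∀ᵇ λ c → ∀ᵇ λ d → ∀ᵇ λ e → ∀ᵇ λ f → P a b c d e f

∀⁶-elim : ∀ P → T (∀⁶ P) → ∀ a b c d e f → T (P a b c d e f)
∀⁶-elim P t a b c d e f = ∀ᵇ-elim {λ f → P a b c d e f} (∀ᵇ-elim {λ e → ∀ᵇ λ f → P a b c d e f}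
  (∀ᵇ-elim {λ d → ∀ᵇ λ e → ∀ᵇ λ f → P a b c d e f}
  (∀ᵇ-elim {λ c → ∀ᵇ λ d → ∀ᵇ λ e → ∀ᵇ λ f → P a b c d e f} (∀ᵇ-elim {λ b → ∀ᵇ λ c → ∀ᵇ λ d → ∀ᵇ λ e → ∀ᵇ λ f → P a b c d e f}
    (∀ᵇ-elim {λ a → ∀ᵇ λ b → ∀ᵇ λ c → ∀ᵇ λ d → ∀ᵇ λ e → ∀ᵇ λ f → P a b c d e f} t a) b) c) d) e) f

-- Relabelling the four points

module _ {n : ℕ} where

  Fun⁴ : Set
  Fun⁴ = Fin n → Fin n → Fin n → Fin n → ℕ

  ∑⁴-bacd : ∀ (f : Fun⁴) → ∑⁴ f ≡ ∑⁴ (λ a b c d → f b a c d)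
  ∑⁴-bacd f = ∑ᶠ-swap _

  ∑⁴-acbd : ∀ (f : Fun⁴) → ∑⁴ f ≡ ∑⁴ (λ a b c d → f a c b d)
  ∑⁴-acbd f = ∑ᶠ-cong (λ a → ∑ᶠ-swap _)

  ∑⁴-abdc : ∀ (f : Fun⁴) → ∑⁴ f ≡ ∑⁴ (λ a b c d → f a b d c)
  ∑⁴-abdc f = ∑ᶠ-cong (λ a → ∑ᶠ-cong (λ b → ∑ᶠ-swap _))

  ∑⁴-cdab : ∀ (f : Fun⁴) → ∑⁴ f ≡ ∑⁴ (λ a b c d → f c d a b)
  ∑⁴-cdab f = begin
    ∑⁴ f ≡⟨ ∑⁴-acbd f ⟩
    ∑⁴ (λ a b c d → f a c b d) ≡⟨ ∑⁴-bacd _ ⟩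
    ∑⁴ (λ a b c d → f b c a d) ≡⟨ ∑⁴-abdc _ ⟩
    ∑⁴ (λ a b c d → f b d a c) ≡⟨ ∑⁴-acbd _ ⟩
    ∑⁴ (λ a b c d → f c d a b) ∎

  transpose-comm : ∀ (a b x : Fin n) → transpose a b x ≡ transpose b a x
  transpose-comm a b x = by-cases (x ≟ a) (x ≟ b)
    where
    by-cases : Dec (x ≡ a) → Dec (x ≡ b) → transpose a b x ≡ transpose b a x
    by-cases (yes refl) _         = trans (transpose-at-a x b) (sym (transpose-at-b b x))
    by-cases _         (yes refl) = trans (transpose-at-b a x) (sym (transpose-at-a x a))
    by-cases (no xa)   (no xb)    = trans (transpose-other a b xa xb) (sym (transpose-other b a xb xa))

  product-cdab : ∀ {a b c d : Fin n} → Distinct a b c d → ∀ x → product c d a b x ≡ product a b c d x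
  product-cdab {a} {b} {c} {d} (ab , ac , ad , bc , bd , cd) x = by-cases (x ≟ a) (x ≟ b) (x ≟ c) (x ≟ d)
    where
    by-cases : Dec (x ≡ a) → Dec (x ≡ b) → Dec (x ≡ c) → Dec (x ≡ d) → product c d a b x ≡ product a b c d x
    by-cases (yes refl) _ _ _ = trans (cong (transpose c d) (transpose-at-a a b)) (trans (transpose-other c d bc bd)
      (sym (trans (cong (transpose a b) (transpose-other c d ac ad)) (transpose-at-a a b))))
    by-cases _ (yes refl) _ _ = trans (cong (transpose c d) (transpose-at-b a b)) (trans (transpose-other c d ac ad)
      (sym (trans (cong (transpose a b) (transpose-other c d bc bd)) (transpose-at-b a b))))
    by-cases _ _ (yes refl) _ = trans (cong (transpose c d) (transpose-other a b (ac ∘ sym) (bc ∘ sym)))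
      (trans (transpose-at-a c d)
      (sym (trans (cong (transpose a b) (transpose-at-a c d)) (transpose-other a b (ad ∘ sym) (bd ∘ sym)))))
    by-cases _ _ _ (yes refl) = trans (cong (transpose c d) (transpose-other a b (ad ∘ sym) (bd ∘ sym)))
      (trans (transpose-at-b c d)
      (sym (trans (cong (transpose a b) (transpose-at-b c d)) (transpose-other a b (ac ∘ sym) (bc ∘ sym)))))
    by-cases (no xa) (no xb) (no xc) (no xd) = trans (cong (transpose c d) (transpose-other a b xa xb))
      (trans (transpose-other c d xc xd)
      (sym (trans (cong (transpose a b) (transpose-other c d xc xd)) (transpose-other a b xa xb))))

  distinct-bacd : ∀ {a b c d : Fin n} → Distinct a b c d → Distinct b a c d
  distinct-bacd (ab , ac , ad , bc , bd , cd) = (ab ∘ sym) , bc , bd , ac , ad , cd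

  distinct-abdc : ∀ {a b c d : Fin n} → Distinct a b c d → Distinct a b d c
  distinct-abdc (ab , ac , ad , bc , bd , cd) = ab , ad , ac , bd , bc , (cd ∘ sym)

  distinct-cdab : ∀ {a b c d : Fin n} → Distinct a b c d → Distinct c d a b
  distinct-cdab (ab , ac , ad , bc , bd , cd) = cd , (ac ∘ sym) , (bc ∘ sym) , (ad ∘ sym) , (bd ∘ sym) , ab

module _ {n} (β : Fin n → Fin n) (injβ : Injective _≡_ _≡_ β) where
  private
    module β = Cycles β injβ
    S = sameᵇ β injβ
    W = twists β injβ

    twists-cong : ∀ {a b c d a′ b′ c′ d′} → (Distinct a b c d → Distinct a′ b′ c′ d′) → (Distinct a′ b′ c′ d′ → Distinct a b c
      d) →
      (Distinct a b c d → ∀ x → product a b c d x ≡ product a′ b′ c′ d′ x) → W a b c d ≡ W a′ b′ c′ d′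
    twists-cong {a} {b} {c} {d} {a′} {b′} {c′} {d′} f g eq = trans
      (⟨⟩-guard (distinct? a b c d) (λ dist → conjugators-cong {β = β} (λ x → cong β (eq dist x))))
      (cong (_* conjugators β (twisted β injβ a′ b′ c′ d′)) (⟨⟩-cong f g (distinct? a b c d) (distinct? a′ b′ c′ d′)))

  twists-bacd : ∀ a b c d → twists β injβ b a c d ≡ twists β injβ a b c d
  twists-bacd a b c d = twists-cong {b} {a} {c} {d} {a} {b} {c} {d} distinct-bacd distinct-bacd (λ _ x → transpose-comm b a
    (transpose c d x))

  twists-abdc : ∀ a b c d → twists β injβ a b d c ≡ twists β injβ a b c d
  twists-abdc a b c d = twists-cong {a} {b} {d} {c} {a} {b} {c} {d} distinct-abdc distinct-abdc (λ _ x → cong (transpose a b)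
    (transpose-comm d c x))

  twists-cdab : ∀ a b c d → twists β injβ c d a b ≡ twists β injβ a b c d
  twists-cdab a b c d = twists-cong {c} {d} {a} {b} {a} {b} {c} {d} distinct-cdab distinct-cdab
    (λ dist → product-cdab (distinct-cdab dist))

  -- The patterns carrying a nonzero number of twists, up to relabelling, are p₁, …, p₄.
  p₄ p₃ p₂ p₁ split₂ merge₂ : (a b c d : Fin n) → Bool
  p₄ a b c d = S a b ∧ S a c ∧ S a d
  p₃ a b c d = S a b ∧ S a c ∧ not (S a d)
  p₂ a b c d = S a c ∧ S b d ∧ not (S a b)
  p₁ a b c d = S a b ∧ not (S a c) ∧ not (S a d) ∧ not (S c d)
  split₂ a b c d = S a b ∧ S c d ∧ not (S a c)
  merge₂ a b c d = not (S a b) ∧ not (S a d) ∧ not (S b d) ∧ not (S c d)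

  private
    implies : Bool → Bool → Bool
    implies x y = not x ∨ y

    -- For each of the four triples, any two related pairs force the third. Of the 64 valuations
    -- exactly the 15 set partitions of the four points satisfy this.
    transitive : Bool → Bool → Bool → Bool → Bool → Bool → Bool
    transitive ab ac ad bc bd cd =
      implies (ab ∧ bc) ac ∧ implies (ab ∧ ac) bc ∧ implies (ac ∧ bc) ab ∧
      implies (ab ∧ bd) ad ∧ implies (ab ∧ ad) bd ∧ implies (ad ∧ bd) ab ∧
      implies (ac ∧ cd) ad ∧ implies (ac ∧ ad) cd ∧ implies (ad ∧ cd) ac ∧
      implies (bc ∧ cd) bd ∧ implies (bc ∧ bd) cd ∧ implies (bd ∧ cd) bc

    T-implies : ∀ {P Q R : Set} (p : Dec P) (q : Dec Q) (r : Dec R) → (P → Q → R) → T (implies (does p ∧ does q) (does r))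
    T-implies (yes p) (yes q) (yes r) h = tt
    T-implies (yes p) (yes q) (no ¬r) h = ¬r (h p q)
    T-implies (yes p) (no _) r h = tt
    T-implies (no _) q r h = tt

    T-∧ : ∀ {x y} → T x → T y → T (x ∧ y)
    T-∧ {true} _ u = u

    S-transitive : ∀ a b c d → T (transitive (S a b) (S a c) (S a d) (S b c) (S b d) (S c d))
    S-transitive a b c d =
      T-∧ (T-implies (β.same? a b) (β.same? b c) (β.same? a c) β.Same-trans) (
      T-∧ (T-implies (β.same? a b) (β.same? a c) (β.same? b c) (λ x y → β.Same-trans (β.Same-sym x) y)) (
      T-∧ (T-implies (β.same? a c) (β.same? b c) (β.same? a b) (λ x y → β.Same-trans x (β.Same-sym y))) (
      T-∧ (T-implies (β.same? a b) (β.same? b d) (β.same? a d) β.Same-trans) (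
      T-∧ (T-implies (β.same? a b) (β.same? a d) (β.same? b d) (λ x y → β.Same-trans (β.Same-sym x) y)) (
      T-∧ (T-implies (β.same? a d) (β.same? b d) (β.same? a b) (λ x y → β.Same-trans x (β.Same-sym y))) (
      T-∧ (T-implies (β.same? a c) (β.same? c d) (β.same? a d) β.Same-trans) (
      T-∧ (T-implies (β.same? a c) (β.same? a d) (β.same? c d) (λ x y → β.Same-trans (β.Same-sym x) y)) (
      T-∧ (T-implies (β.same? a d) (β.same? c d) (β.same? a c) (λ x y → β.Same-trans x (β.Same-sym y))) (
      T-∧ (T-implies (β.same? b c) (β.same? c d) (β.same? b d) β.Same-trans) (
      T-∧ (T-implies (β.same? b c) (β.same? b d) (β.same? c d) (λ x y → β.Same-trans (β.Same-sym x) y))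
          (T-implies (β.same? b d) (β.same? c d) (β.same? b c) (λ x y → β.Same-trans x (β.Same-sym y)))))))))))))

    Fun⁶ : Set
    Fun⁶ = Bool → Bool → Bool → Bool → Bool → Bool → ℕ

    -- Proof by reflection: both sides are evaluated on all 64 valuations, and only those that come
    -- from an equivalence relation have to agree. Each application is therefore closed by `tt`.
    S-identity : ∀ (f g : Fun⁶) → T (∀⁶ (λ ab ac ad bc bd cd → implies (transitive ab ac ad bc bd cd) (f ab ac ad bc bd cd ≡ᵇ g
      ab ac ad bc bd cd))) →
      ∀ a b c d → f (S a b) (S a c) (S a d) (S b c) (S b d) (S c d) ≡ g (S a b) (S a c) (S a d) (S b c) (S b d) (S c d)
    S-identity f g t a b c d = ≡ᵇ⇒≡ (f (S a b) (S a c) (S a d) (S b c) (S b d) (S c d)) _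
      (modus-ponens (transitive (S a b) (S a c) (S a d) (S b c) (S b d) (S c d))
      (∀⁶-elim (λ ab ac ad bc bd cd → implies (transitive ab ac ad bc bd cd) (f ab ac ad bc bd cd ≡ᵇ g ab ac ad bc bd cd)) t
        (S a b) (S a c) (S a d) (S b c) (S b d) (S c d)) (S-transitive a b c d))
      where
      modus-ponens : ∀ x {y} → T (implies x y) → T x → T y
      modus-ponens true t _ = t

    pairs : Fun⁶
    pairs ab ac ad bc bd cd =
      (((1 + ⟦ ab ⟧) + (⟦ ac ⟧ + ⟦ ad ⟧)) + ((⟦ ab ⟧ + 1) + (⟦ bc ⟧ + ⟦ bd ⟧))) +
      (((⟦ ac ⟧ + ⟦ bc ⟧) + (1 + ⟦ cd ⟧)) + ((⟦ ad ⟧ + ⟦ bd ⟧) + (⟦ cd ⟧ + 1)))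

    s-refl : ∀ x → S x x ≡ true
    s-refl x = dec-true (β.same? x x) β.Same-refl

    samePairs-pairs : ∀ a b c d → samePairs β injβ a b c d ≡ pairs (S a b) (S a c) (S a d) (S b c) (S b d) (S c d)
    samePairs-pairs a b c d rewrite s-refl a | s-refl b | s-refl c | s-refl d
      | sameᵇ-sym β injβ b a | sameᵇ-sym β injβ c a | sameᵇ-sym β injβ d a | sameᵇ-sym β injβ c b | sameᵇ-sym β injβ d b |
        sameᵇ-sym β injβ d c = refl

    value : ∀ e a b c d → ⟦ samePairs β injβ a b c d ≡ᵇ e ⟧ ≡ ⟦ pairs (S a b) (S a c) (S a d) (S b c) (S b d) (S c d) ≡ᵇ e ⟧
    value e a b c d = cong (λ k → ⟦ k ≡ᵇ e ⟧) (samePairs-pairs a b c d)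

  pattern-4 : ∀ a b c d → ⟦ samePairs β injβ a b c d ≡ᵇ 16 ⟧ ≡ ⟦ p₄ a b c d ⟧
  pattern-4 a b c d = trans (value 16 a b c d) (S-identity
    (λ ab ac ad bc bd cd → ⟦ pairs ab ac ad bc bd cd ≡ᵇ 16 ⟧)
    (λ ab ac ad bc bd cd → ⟦ ab ∧ ac ∧ ad ⟧) tt a b c d)

  -- One term for each point that may be alone on its cycle: `d`, `c`, `b`, `a` in this order.
  pattern-31 : ∀ a b c d → ⟦ samePairs β injβ a b c d ≡ᵇ 10 ⟧ ≡ (⟦ p₃ a b c d ⟧ + ⟦ p₃ a b d c ⟧) + (⟦ p₃ c d a b ⟧ + ⟦ p₃ d c b
    a ⟧)
  pattern-31 a b c d = trans (value 10 a b c d) rest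
    where
    rest : ⟦ pairs (S a b) (S a c) (S a d) (S b c) (S b d) (S c d) ≡ᵇ 10 ⟧ ≡ (⟦ p₃ a b c d ⟧ + ⟦ p₃ a b d c ⟧) +
      (⟦ p₃ c d a b ⟧ + ⟦ p₃ d c b a ⟧)
    rest rewrite sameᵇ-sym β injβ c a | sameᵇ-sym β injβ d a | sameᵇ-sym β injβ c b | sameᵇ-sym β injβ d b | sameᵇ-sym β injβ d
      c = S-identity
      (λ ab ac ad bc bd cd → ⟦ pairs ab ac ad bc bd cd ≡ᵇ 10 ⟧)
      (λ ab ac ad bc bd cd → (⟦ ab ∧ ac ∧ not ad ⟧ + ⟦ ab ∧ ad ∧ not ac ⟧) + (⟦ cd ∧ ac ∧ not bc ⟧ + ⟦ cd ∧ bd ∧ not ad ⟧)) tt a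
        b c d

  -- The three terms are the three ways of pairing off four points; in the first, each transposition
  -- stays inside one cycle.
  pattern-22 : ∀ a b c d → ⟦ samePairs β injβ a b c d ≡ᵇ 8 ⟧ ≡ ⟦ split₂ a b c d ⟧ + (⟦ p₂ a b c d ⟧ + ⟦ p₂ b a c d ⟧)
  pattern-22 a b c d = trans (value 8 a b c d) rest
    where
    rest : ⟦ pairs (S a b) (S a c) (S a d) (S b c) (S b d) (S c d) ≡ᵇ 8 ⟧ ≡ ⟦ split₂ a b c d ⟧ + (⟦ p₂ a b c d ⟧ + ⟦ p₂ b a c d
      ⟧)
    rest rewrite sameᵇ-sym β injβ b a = S-identity
      (λ ab ac ad bc bd cd → ⟦ pairs ab ac ad bc bd cd ≡ᵇ 8 ⟧)
      (λ ab ac ad bc bd cd → ⟦ ab ∧ cd ∧ not ac ⟧ + (⟦ ac ∧ bd ∧ not ab ⟧ + ⟦ bc ∧ ad ∧ not ab ⟧)) tt a b c d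

  -- One term for each choice of the two points that share a cycle. In the last four this pair
  -- consists of one point from each transposition, so both transpositions merge.
  pattern-211 : ∀ a b c d → ⟦ samePairs β injβ a b c d ≡ᵇ 6 ⟧ ≡ (⟦ p₁ a b c d ⟧ + ⟦ p₁ c d a b ⟧) +
    ((⟦ S a c ∧ merge₂ a b c d ⟧ + ⟦ S b c ∧ merge₂ b a c d ⟧) + (⟦ S a d ∧ merge₂ a b d c ⟧ + ⟦ S b d ∧ merge₂ b a d c ⟧))
  pattern-211 a b c d = trans (value 6 a b c d) rest
    where
    rest : ⟦ pairs (S a b) (S a c) (S a d) (S b c) (S b d) (S c d) ≡ᵇ 6 ⟧ ≡ (⟦ p₁ a b c d ⟧ + ⟦ p₁ c d a b ⟧) +
      ((⟦ S a c ∧ merge₂ a b c d ⟧ + ⟦ S b c ∧ merge₂ b a c d ⟧) + (⟦ S a d ∧ merge₂ a b d c ⟧ + ⟦ S b d ∧ merge₂ b a d c ⟧))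
    rest rewrite sameᵇ-sym β injβ b a | sameᵇ-sym β injβ c a | sameᵇ-sym β injβ c b | sameᵇ-sym β injβ d c = S-identity
      (λ ab ac ad bc bd cd → ⟦ pairs ab ac ad bc bd cd ≡ᵇ 6 ⟧)
      (λ ab ac ad bc bd cd → (⟦ ab ∧ not ac ∧ not ad ∧ not cd ⟧ + ⟦ cd ∧ not ac ∧ not bc ∧ not ab ⟧) +
        ((⟦ ac ∧ not ab ∧ not ad ∧ not bd ∧ not cd ⟧ + ⟦ bc ∧ not ab ∧ not bd ∧ not ad ∧ not cd ⟧) +
         (⟦ ad ∧ not ab ∧ not ac ∧ not bc ∧ not cd ⟧ + ⟦ bd ∧ not ab ∧ not bc ∧ not ac ∧ not cd ⟧))) tt a b c d

  -- The term beyond the four partitions of the theorem has all four points on different cycles and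
  -- falls under `merge₂`.
  pattern-all : ∀ a b c d → 1 ≡
    ((⟦ samePairs β injβ a b c d ≡ᵇ 16 ⟧ + ⟦ samePairs β injβ a b c d ≡ᵇ 10 ⟧) + (⟦ samePairs β injβ a b c d ≡ᵇ 8 ⟧ + ⟦
      samePairs β injβ a b c d ≡ᵇ 6 ⟧)) +
    ⟦ (not (S a c) ∧ not (S b c)) ∧ merge₂ a b c d ⟧
  pattern-all a b c d = trans (S-identity (λ _ _ _ _ _ _ → 1)
    (λ ab ac ad bc bd cd → ((⟦ pairs ab ac ad bc bd cd ≡ᵇ 16 ⟧ + ⟦ pairs ab ac ad bc bd cd ≡ᵇ 10 ⟧) + (⟦ pairs ab ac ad bc bd cd
      ≡ᵇ 8 ⟧ + ⟦ pairs ab ac ad bc bd cd ≡ᵇ 6 ⟧)) +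
      ⟦ (not ac ∧ not bc) ∧ not ab ∧ not ad ∧ not bd ∧ not cd ⟧) tt a b c d)
    (cong (_+ ⟦ (not (S a c) ∧ not (S b c)) ∧ merge₂ a b c d ⟧)
      (cong₂ _+_ (cong₂ _+_ (sym (value 16 a b c d)) (sym (value 10 a b c d))) (cong₂ _+_ (sym (value 8 a b c d))
      (sym (value 6 a b c d)))))

  -- In the two assumed cases both transpositions split or both merge, so the number of cycles
  -- changes by two and no conjugate of β arises.
  module Patterns (split₂-zero : ∀ a b c d → T (split₂ a b c d) → twists β injβ a b c d ≡ 0)
                  (merge₂-zero : ∀ a b c d → T (merge₂ a b c d) → twists β injβ a b c d ≡ 0) where

    private
      weigh : (Fin n → Fin n → Fin n → Fin n → Bool) → ℕ
      weigh p = ∑⁴ (λ a b c d → ⟦ p a b c d ⟧ * W a b c d)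

      weight : ℕ → ℕ
      weight e = weigh (λ a b c d → samePairs β injβ a b c d ≡ᵇ e)

      ⟦⟧-zero : ∀ x y {w} → (T y → w ≡ 0) → ⟦ x ∧ y ⟧ * w ≡ 0
      ⟦⟧-zero false y     h = refl
      ⟦⟧-zero true  false h = refl
      ⟦⟧-zero true  true  h = trans (+-identityʳ _) (h tt)

    weight-4 : 8 * cPart (4 ∷ []) β ≡ ∑⁴ (λ a b c d → ⟦ p₄ a b c d ⟧ * twists β injβ a b c d)
    weight-4 = trans (cPart-twists β injβ (4 ∷ []) 16 refl detects-4)
      (∑⁴-cong (λ a b c d → cong (_* W a b c d) (pattern-4 a b c d)))

    -- The relabellings in `pattern-31` do not change the permutation (a b)(c d), so all four terms
    -- have the same sum.
    weight-31 : 8 * cPart (3 ∷ 1 ∷ []) β ≡ 4 * ∑⁴ (λ a b c d → ⟦ p₃ a b c d ⟧ * twists β injβ a b c d)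
    weight-31 = begin
      8 * cPart (3 ∷ 1 ∷ []) β ≡⟨ cPart-twists β injβ (3 ∷ 1 ∷ []) 10 refl detects-31 ⟩
      weight 10 ≡⟨ ∑⁴-cong (λ a b c d → trans (cong (_* W a b c d) (pattern-31 a b c d)) (trans
          (solve 5 (λ p q r s w → ((p :+ q) :+ (r :+ s)) :* w := (p :* w :+ q :* w) :+ (r :* w :+ s :* w)) refl ⟦ p₃ a b c d ⟧ ⟦
            p₃ a b d c ⟧ ⟦ p₃ c d a b ⟧ ⟦ p₃ d c b a ⟧ (W a b c d))
          (cong₂ _+_ (cong (⟦ p₃ a b c d ⟧ * W a b c d +_) (cong (⟦ p₃ a b d c ⟧ *_) (sym (twists-abdc a b c d))))
            (cong₂ _+_ (cong (⟦ p₃ c d a b ⟧ *_) (sym (twists-cdab a b c d)))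
              (cong (⟦ p₃ d c b a ⟧ *_) (sym (trans (twists-bacd c d b a) (trans (twists-abdc c d a b)
                (twists-cdab a b c d))))))))) ⟩
      ∑⁴ (λ a b c d → (F a b c d + F a b d c) + (F c d a b + F d c b a)) ≡⟨ trans (∑⁴-+ (λ a b c d → F a b c d + F a b d c) _)
        (cong₂ _+_ (∑⁴-+ F (λ a b c d → F a b d c)) (∑⁴-+ (λ a b c d → F c d a b) _)) ⟩
      (∑⁴ F + ∑⁴ (λ a b c d → F a b d c)) + (∑⁴ (λ a b c d → F c d a b) + ∑⁴ (λ a b c d → F d c b a))
        ≡⟨ cong₂ _+_ (cong (∑⁴ F +_) (sym (∑⁴-abdc F))) (cong₂ _+_ (sym (∑⁴-cdab F))
             (trans (sym (trans (∑⁴-cdab (λ a b c d → F b a c d)) (∑⁴-bacd _))) (sym (∑⁴-bacd F)))) ⟩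
      (∑⁴ F + ∑⁴ F) + (∑⁴ F + ∑⁴ F) ≡⟨ solve 1 (λ f → (f :+ f) :+ (f :+ f) := con 4 :* f) refl (∑⁴ F) ⟩
      4 * ∑⁴ F ∎
      where
      F : Fun⁴
      F a b c d = ⟦ p₃ a b c d ⟧ * W a b c d

    weight-22 : 8 * cPart (2 ∷ 2 ∷ []) β ≡ 2 * ∑⁴ (λ a b c d → ⟦ p₂ a b c d ⟧ * twists β injβ a b c d)
    weight-22 = begin
      8 * cPart (2 ∷ 2 ∷ []) β ≡⟨ cPart-twists β injβ (2 ∷ 2 ∷ []) 8 refl detects-22 ⟩
      weight 8 ≡⟨ ∑⁴-cong (λ a b c d → trans (cong (_* W a b c d) (pattern-22 a b c d)) (trans
          (solve 4 (λ p q r w → (p :+ (q :+ r)) :* w := p :* w :+ (q :* w :+ r :* w)) refl ⟦ split₂ a b c d ⟧ ⟦ p₂ a b c d ⟧ ⟦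
            p₂ b a c d ⟧ (W a b c d))
          (cong₂ _+_ (⟦⟧-zero true (split₂ a b c d) (split₂-zero a b c d))
            (cong (F a b c d +_) (cong (⟦ p₂ b a c d ⟧ *_) (sym (twists-bacd a b c d))))))) ⟩
      ∑⁴ (λ a b c d → F a b c d + F b a c d) ≡⟨ ∑⁴-+ F _ ⟩
      ∑⁴ F + ∑⁴ (λ a b c d → F b a c d) ≡⟨ cong (∑⁴ F +_) (trans (sym (∑⁴-bacd F)) (sym (+-identityʳ _))) ⟩
      2 * ∑⁴ F ∎
      where
      F : Fun⁴
      F a b c d = ⟦ p₂ a b c d ⟧ * W a b c d

    weight-211 : 8 * cPart (2 ∷ 1 ∷ 1 ∷ []) β ≡ 2 * ∑⁴ (λ a b c d → ⟦ p₁ a b c d ⟧ * twists β injβ a b c d)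
    weight-211 = begin
      8 * cPart (2 ∷ 1 ∷ 1 ∷ []) β ≡⟨ cPart-twists β injβ (2 ∷ 1 ∷ 1 ∷ []) 6 refl detects-211 ⟩
      weight 6 ≡⟨ ∑⁴-cong (λ a b c d → trans (cong (_* W a b c d) (pattern-211 a b c d)) (trans
          (solve 7 (λ p q r s t u w → ((p :+ q) :+ ((r :+ s) :+ (t :+ u))) :* w := (p :* w :+ q :* w) :+
            ((r :* w :+ s :* w) :+ (t :* w :+ u :* w))) refl
            ⟦ p₁ a b c d ⟧ ⟦ p₁ c d a b ⟧ ⟦ S a c ∧ merge₂ a b c d ⟧ ⟦ S b c ∧ merge₂ b a c d ⟧ ⟦ S a d ∧ merge₂ a b d c ⟧ ⟦ S b
              d ∧ merge₂ b a d c ⟧ (W a b c d))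
          (trans (cong₂ _+_ (cong (F a b c d +_) (cong (⟦ p₁ c d a b ⟧ *_) (sym (twists-cdab a b c d))))
            (cong₂ _+_ (cong₂ _+_ (⟦⟧-zero (S a c) (merge₂ a b c d) (merge₂-zero a b c d))
            (⟦⟧-zero (S b c) (merge₂ b a c d) (λ t → trans (sym (twists-bacd a b c d)) (merge₂-zero b a c d t))))
            (cong₂ _+_ (⟦⟧-zero (S a d) (merge₂ a b d c) (λ t → trans (sym (twists-abdc a b c d)) (merge₂-zero a b d c t)))
            (⟦⟧-zero (S b d) (merge₂ b a d c) (λ t → trans (sym (trans (twists-bacd a b d c) (twists-abdc a b c d)))
              (merge₂-zero b a d c t))))))
            (+-identityʳ _)))) ⟩
      ∑⁴ (λ a b c d → F a b c d + F c d a b) ≡⟨ ∑⁴-+ F _ ⟩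
      ∑⁴ F + ∑⁴ (λ a b c d → F c d a b) ≡⟨ cong (∑⁴ F +_) (trans (sym (∑⁴-cdab F)) (sym (+-identityʳ _))) ⟩
      2 * ∑⁴ F ∎
      where
      F : Fun⁴
      F a b c d = ⟦ p₁ a b c d ⟧ * W a b c d

    cK-cParts : cK 4 β ≡ cPart (4 ∷ []) β + cPart (3 ∷ 1 ∷ []) β + cPart (2 ∷ 2 ∷ []) β + cPart (2 ∷ 1 ∷ 1 ∷ []) β
    cK-cParts = *-cancelˡ-≡ _ _ 8 (begin
      8 * cK 4 β ≡⟨ cK-twists β injβ ⟩
      ∑⁴ W ≡⟨ ∑⁴-cong (λ a b c d → trans (sym (*-identityˡ (W a b c d))) (trans (cong (_* W a b c d) (pattern-all a b c d))
        (trans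
          (solve 6 (λ p q r s t w → (((p :+ q) :+ (r :+ s)) :+ t) :* w := ((p :* w :+ q :* w) :+ (r :* w :+ s :* w)) :+ t :* w)
            refl
            ⟦ samePairs β injβ a b c d ≡ᵇ 16 ⟧ ⟦ samePairs β injβ a b c d ≡ᵇ 10 ⟧ ⟦ samePairs β injβ a b c d ≡ᵇ 8 ⟧ ⟦ samePairs
              β injβ a b c d ≡ᵇ 6 ⟧ ⟦ (not (S a c) ∧ not (S b c)) ∧ merge₂ a b c d ⟧ (W a b c d))
          (trans (cong (((G 16 a b c d + G 10 a b c d) + (G 8 a b c d + G 6 a b c d)) +_) (⟦⟧-zero (not (S a c) ∧ not (S b c))
            (merge₂ a b c d) (merge₂-zero a b c d))) (+-identityʳ _))))) ⟩
      ∑⁴ (λ a b c d → (G 16 a b c d + G 10 a b c d) + (G 8 a b c d + G 6 a b c d)) ≡⟨ trans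
        (∑⁴-+ (λ a b c d → G 16 a b c d + G 10 a b c d) _) (cong₂ _+_ (∑⁴-+ (G 16) (G 10)) (∑⁴-+ (G 8) (G 6))) ⟩
      (weight 16 + weight 10) + (weight 8 + weight 6) ≡⟨ cong₂ _+_
          (cong₂ _+_ (cPart-twists β injβ (4 ∷ []) 16 refl detects-4) (cPart-twists β injβ (3 ∷ 1 ∷ []) 10 refl detects-31))
          (cong₂ _+_ (cPart-twists β injβ (2 ∷ 2 ∷ []) 8 refl detects-22) (cPart-twists β injβ (2 ∷ 1 ∷ 1 ∷ []) 6 refl
            detects-211)) ⟨
      (8 * x + 8 * y) + (8 * z + 8 * w) ≡⟨ solve 4 (λ x y z w → (con 8 :* x :+ con 8 :* y) :+ (con 8 :* z :+ con 8 :* w) := con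
        8 :* (x :+ y :+ z :+ w)) refl x y z w ⟩
      8 * (x + y + z + w) ∎)
      where
      G : ℕ → Fun⁴
      G e a b c d = ⟦ samePairs β injβ a b c d ≡ᵇ e ⟧ * W a b c d
      x = cPart (4 ∷ []) β
      y = cPart (3 ∷ 1 ∷ []) β
      z = cPart (2 ∷ 2 ∷ []) β
      w = cPart (2 ∷ 1 ∷ 1 ∷ []) β

-- Cycle type after two transpositions

-- The conclusion says that {k, l} and {p, q} agree as multisets, expressed through their counting
-- functions; with equal sums, one matching entry forces the other.
pair-≡ : ∀ {p q k l} → k + l ≡ p + q → k ≡ p ⊎ k ≡ q → ∀ m → ⟨ k ℕ.≟ m ⟩ + ⟨ l ℕ.≟ m ⟩ ≡ ⟨ p ℕ.≟ m ⟩ + ⟨ q ℕ.≟ m ⟩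
pair-≡ {p} {q} {k} {l} e (inj₁ refl) m = cong (λ z → ⟨ p ℕ.≟ m ⟩ + ⟨ z ℕ.≟ m ⟩) (+-cancelˡ-≡ p l q e)
pair-≡ {p} {q} {k} {l} e (inj₂ refl) m = trans (cong (λ z → ⟨ q ℕ.≟ m ⟩ + ⟨ z ℕ.≟ m ⟩)
  (+-cancelˡ-≡ q l p (trans e (+-comm p q)))) (+-comm ⟨ q ℕ.≟ m ⟩ _)

-- At `m` = k the left side is positive, so the right side cannot vanish there.
pair-∈ : ∀ {p q k l} → (∀ m → ⟨ k ℕ.≟ m ⟩ + ⟨ l ℕ.≟ m ⟩ ≡ ⟨ p ℕ.≟ m ⟩ + ⟨ q ℕ.≟ m ⟩) → k ≡ p ⊎ k ≡ q
pair-∈ {p} {q} {k} {l} h = by-cases (k ℕ.≟ p) (k ℕ.≟ q)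
  where
  by-cases : Dec (k ≡ p) → Dec (k ≡ q) → k ≡ p ⊎ k ≡ q
  by-cases (yes e) _       = inj₁ e
  by-cases _       (yes e) = inj₂ e
  by-cases (no k≢p) (no k≢q) = contradiction (trans (cong (_+ ⟨ l ℕ.≟ k ⟩) (sym (⟨⟩-yes (k ℕ.≟ k) refl)))
    (trans (h k) (cong₂ _+_ (⟨⟩-no (p ℕ.≟ k) (k≢p ∘ sym)) (⟨⟩-no (q ℕ.≟ k) (k≢q ∘ sym))))) λ ()

-- The common frame of the four evaluations `p₄-twists` to `p₂-twists`: pattern, distinctness and
-- length condition are fused into one indicator and recast as successive choices of points.
collect : ∀ {P Q R X : Set} (p? : Dec P) (q? : Dec Q) (r? : Dec R) (x? : Dec X) {v z : ℕ} →
  (P → Q → v ≡ ⟨ r? ⟩ * z) → (P → Q → R → X) → (X → P × Q × R) → ⟨ p? ⟩ * (⟨ q? ⟩ * v) ≡ ⟨ x? ⟩ * z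
collect p? q? r? x? {v} {z} h f g = begin
  ⟨ p? ⟩ * (⟨ q? ⟩ * v) ≡⟨ ⟨⟩-guard p? (λ p → ⟨⟩-guard q? (h p)) ⟩
  ⟨ p? ⟩ * (⟨ q? ⟩ * (⟨ r? ⟩ * z)) ≡⟨ solve 4 (λ p q r z → p :* (q :* (r :* z)) := (p :* (q :* r)) :* z) refl ⟨ p? ⟩ ⟨ q? ⟩ ⟨
    r? ⟩ z ⟩
  ⟨ p? ⟩ * (⟨ q? ⟩ * ⟨ r? ⟩) * z ≡⟨ cong (_* z) (trans (⟨⟩-× p? (q? ×-dec r?)) (cong (⟨ p? ⟩ *_) (⟨⟩-× q? r?))) ⟨
  ⟨ p? ×-dec (q? ×-dec r?) ⟩ * z ≡⟨ cong (_* z) (⟨⟩-cong (λ (p , q , r) → f p q r) g (p? ×-dec (q? ×-dec r?)) x?) ⟩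
  ⟨ x? ⟩ * z ∎

module Twisted {n} (β : Fin n → Fin n) (injβ : Injective _≡_ _≡_ β) where
  module β = Cycles β injβ

  Z : ℕ
  Z = centralizerSize β

  half : Fin n → Fin n → Fin n → Fin n
  half a b = β ∘ transpose a b

  half-injective : ∀ a b → Injective _≡_ _≡_ (half a b)
  half-injective a b e = transpose-injective a b (injβ e)

  module Half (a b : Fin n) = Cycles (half a b) (half-injective a b)
  module Full (a b c d : Fin n) = Cycles (twisted β injβ a b c d) (twisted-injective β injβ a b c d)

  module At {a b c d : Fin n} (dist : Distinct a b c d) where
    private
      a≢b = proj₁ dist
      c≢d = proj₂ (proj₂ (proj₂ (proj₂ (proj₂ dist))))

    δ γ : Fin n → Fin n
    δ = half a b
    γ = twisted β injβ a b c d

    injδ : Injective _≡_ _≡_ δ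
    injδ = half-injective a b

    injγ : Injective _≡_ _≡_ γ
    injγ = twisted-injective β injβ a b c d

    module δ = Half a b
    module γ = Full a b c d
    module βδ = SwapCycles {β = β} {δ = δ} injβ injδ a≢b (transpose-IsSwap a b β)
    module δγ = SwapCycles {β = δ} {δ = γ} injδ injγ c≢d (transpose-IsSwap c d δ)

    private
      V : ℕ
      V = conjugators β γ

      decide : ∀ {C : Set} (c? : Dec C) → (C → ∀ m → γ.count m ≡ β.count m) → ((∀ m → γ.count m ≡ β.count m) → C) → V ≡ ⟨ c? ⟩ *
        Z
      decide c? f g = sym (⟨⟩-case c? (λ c → sym (conjugators-same-type {β = β} {γ = γ} injβ injγ (f c)))
        (λ ¬c → sym (conjugators-other-type {β = β} {γ = γ} injβ injγ (λ eq → ¬c (g eq)))))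

      same-numCycles : (∀ m → γ.count m ≡ β.count m) → γ.numCycles ≡ β.numCycles
      same-numCycles = ∑-cong (upTo (suc n))

      2+n≢n : ∀ {k} → suc (suc k) ≢ k
      2+n≢n {k} e = <-irrefl (sym e) (<-trans (n<1+n k) (n<1+n (suc k)))

    split-split : Same β a b → Same δ c d → V ≡ 0
    split-split s t = conjugators-other-type {β = β} {γ = γ} injβ injγ (λ eq → 2+n≢n (trans (cong suc (sym (βδ.numCycles-up s)))
      (trans (sym (δγ.numCycles-up t)) (same-numCycles eq))))

    merge-merge : ¬ Same β a b → ¬ Same δ c d → V ≡ 0
    merge-merge s t = conjugators-other-type {β = β} {γ = γ} injβ injγ
      (λ eq → 2+n≢n (trans (cong suc (sym (δγ.numCycles-down t))) (trans (sym (βδ.numCycles-down s))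
      (sym (same-numCycles eq)))))

    -- The split trades the length of the cycle of `a` for those of its two pieces; the merge trades
    -- the lengths of `c` and `d` for their sum. The cycle type is restored iff the sum is the old
    -- length and the consumed lengths are those of the pieces; once the totals agree, comparing one
    -- length is enough.
    splitMerge? : Dec (β.len a ≡ δ.len c + δ.len d × (δ.len c ≡ δ.len a ⊎ δ.len c ≡ δ.len b))
    splitMerge? = (β.len a ℕ.≟ δ.len c + δ.len d) ×-dec ((δ.len c ℕ.≟ δ.len a) ⊎-dec (δ.len c ℕ.≟ δ.len b))

    split-merge : Same β a b → ¬ Same δ c d → V ≡ ⟨ splitMerge? ⟩ * Z
    split-merge s t = decide splitMerge? to from
      where
      open δγ.Merge t using (merged-len)
      L = β.len a
      total : ∀ m → γ.count m + (⟨ L ℕ.≟ m ⟩ + (⟨ δ.len c ℕ.≟ m ⟩ + ⟨ δ.len d ℕ.≟ m ⟩)) ≡ β.count m +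
        (⟨ γ.len c ℕ.≟ m ⟩ + (⟨ δ.len a ℕ.≟ m ⟩ + ⟨ δ.len b ℕ.≟ m ⟩))
      total m = begin
        γ.count m + (l + cd) ≡⟨ solve 3 (λ x y z → x :+ (y :+ z) := x :+ z :+ y) refl (γ.count m) l cd ⟩
        γ.count m + cd + l ≡⟨ cong (_+ l) (δγ.count-down t m) ⟨
        δ.count m + e + l ≡⟨ solve 3 (λ x y z → x :+ y :+ z := x :+ z :+ y) refl (δ.count m) e l ⟩
        δ.count m + l + e ≡⟨ cong (_+ e) (βδ.count-up s m) ⟩
        β.count m + ab + e ≡⟨ solve 3 (λ x y z → x :+ y :+ z := x :+ (z :+ y)) refl (β.count m) ab e ⟩
        β.count m + (e + ab) ∎
        where
        l = ⟨ L ℕ.≟ m ⟩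
        cd = ⟨ δ.len c ℕ.≟ m ⟩ + ⟨ δ.len d ℕ.≟ m ⟩
        ab = ⟨ δ.len a ℕ.≟ m ⟩ + ⟨ δ.len b ℕ.≟ m ⟩
        e = ⟨ γ.len c ℕ.≟ m ⟩
      L≡ : L ≡ δ.len a + δ.len b
      L≡ = proj₂ (βδ.splits s)
      to : L ≡ δ.len c + δ.len d × (δ.len c ≡ δ.len a ⊎ δ.len c ≡ δ.len b) → ∀ m → γ.count m ≡ β.count m
      to (e , h) m = +-cancelʳ-≡ _ _ _
        (trans (total m) (cong (β.count m +_) (cong₂ _+_ (cong (λ l → ⟨ l ℕ.≟ m ⟩) (trans merged-len (sym e)))
        (sym (pair-≡ (trans (sym e) L≡) h m)))))
      from : (∀ m → γ.count m ≡ β.count m) → L ≡ δ.len c + δ.len d × (δ.len c ≡ δ.len a ⊎ δ.len c ≡ δ.len b)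
      from eq = trans L≡S merged-len , pair-∈ {δ.len a} {δ.len b} {δ.len c} {δ.len d} (λ m → +-cancelˡ-≡ ⟨ L ℕ.≟ m ⟩ _ _
        (trans (triples m) (cong (λ l → ⟨ l ℕ.≟ m ⟩ + (⟨ δ.len a ℕ.≟ m ⟩ + ⟨ δ.len b ℕ.≟ m ⟩)) (sym L≡S))))
        where
        triples : ∀ m → ⟨ L ℕ.≟ m ⟩ + (⟨ δ.len c ℕ.≟ m ⟩ + ⟨ δ.len d ℕ.≟ m ⟩) ≡ ⟨ γ.len c ℕ.≟ m ⟩ + (⟨ δ.len a ℕ.≟ m ⟩ + ⟨ δ.len
          b ℕ.≟ m ⟩)
        triples m = +-cancelˡ-≡ (β.count m) _ _ (trans (cong (_+ (⟨ L ℕ.≟ m ⟩ + (⟨ δ.len c ℕ.≟ m ⟩ + ⟨ δ.len d ℕ.≟ m ⟩)))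
          (sym (eq m))) (total m))
        -- The multiset equality is read at `L`: both pieces are shorter, so only the merged cycle
        -- can supply this length.
        L≡S : L ≡ γ.len c
        L≡S = by-cases (γ.len c ℕ.≟ L)
          where
          by-cases : Dec (γ.len c ≡ L) → L ≡ γ.len c
          by-cases (yes e) = sym e
          by-cases (no ne) = contradiction (trans (cong (_+ (⟨ δ.len c ℕ.≟ L ⟩ + ⟨ δ.len d ℕ.≟ L ⟩))
            (sym (⟨⟩-yes (L ℕ.≟ L) refl))) (trans (triples L)
            (cong₂ _+_ (⟨⟩-no (γ.len c ℕ.≟ L) ne) (cong₂ _+_
              (⟨⟩-no (δ.len a ℕ.≟ L) (λ e → <-irrefl (trans e L≡) (m<m+n (δ.len a) (δ.len>0 b))))
              (⟨⟩-no (δ.len b ℕ.≟ L) (λ e → <-irrefl (trans e L≡) (m<n+m (δ.len b) (δ.len>0 a)))))))) λ ()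

    -- The final pieces have the same total as the two original cycles, so one match decides. The
    -- piece of `d` is chosen because its length is the number of steps from `c` to `d` in the
    -- merged cycle.
    mergeSplit? : Dec (γ.len d ≡ β.len a ⊎ γ.len d ≡ β.len b)
    mergeSplit? = (γ.len d ℕ.≟ β.len a) ⊎-dec (γ.len d ℕ.≟ β.len b)

    merge-split : ¬ Same β a b → Same δ c d → Same δ a c → V ≡ ⟨ mergeSplit? ⟩ * Z
    merge-split s t a~c = decide mergeSplit? to from
      where
      open βδ.Merge s using (merged-len)
      total : ∀ m → γ.count m + (⟨ β.len a ℕ.≟ m ⟩ + ⟨ β.len b ℕ.≟ m ⟩) ≡ β.count m + (⟨ γ.len d ℕ.≟ m ⟩ + ⟨ γ.len c ℕ.≟ m ⟩)
      total m = +-cancelʳ-≡ e _ _ (begin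
        γ.count m + ab + e ≡⟨ solve 3 (λ x y z → x :+ y :+ z := x :+ z :+ y) refl (γ.count m) ab e ⟩
        γ.count m + e + ab ≡⟨ cong (λ l → γ.count m + ⟨ l ℕ.≟ m ⟩ + ab) (δ.len-Same a~c) ⟩
        γ.count m + ⟨ δ.len c ℕ.≟ m ⟩ + ab ≡⟨ cong (_+ ab) (δγ.count-up t m) ⟩
        δ.count m + (⟨ γ.len c ℕ.≟ m ⟩ + ⟨ γ.len d ℕ.≟ m ⟩) + ab ≡⟨ solve 4 (λ x u v z → x :+ (u :+ v) :+ z := x :+ z :+
          (v :+ u)) refl (δ.count m) ⟨ γ.len c ℕ.≟ m ⟩ ⟨ γ.len d ℕ.≟ m ⟩ ab ⟩
        δ.count m + ab + dc ≡⟨ cong (_+ dc) (βδ.count-down s m) ⟨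
        β.count m + e + dc ≡⟨ solve 3 (λ x y z → x :+ y :+ z := x :+ z :+ y) refl (β.count m) e dc ⟩
        β.count m + dc + e ∎)
        where
        ab = ⟨ β.len a ℕ.≟ m ⟩ + ⟨ β.len b ℕ.≟ m ⟩
        dc = ⟨ γ.len d ℕ.≟ m ⟩ + ⟨ γ.len c ℕ.≟ m ⟩
        e = ⟨ δ.len a ℕ.≟ m ⟩
      sizes : γ.len d + γ.len c ≡ β.len a + β.len b
      sizes = trans (+-comm (γ.len d) _) (trans (sym (proj₂ (δγ.splits t))) (trans (sym (δ.len-Same a~c)) merged-len))
      to : γ.len d ≡ β.len a ⊎ γ.len d ≡ β.len b → ∀ m → γ.count m ≡ β.count m
      to h m = +-cancelʳ-≡ _ _ _ (trans (total m) (cong (β.count m +_) (pair-≡ sizes h m)))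
      from : (∀ m → γ.count m ≡ β.count m) → γ.len d ≡ β.len a ⊎ γ.len d ≡ β.len b
      from eq = pair-∈ {β.len a} {β.len b} {γ.len d} {γ.len c}
        (λ m → sym (+-cancelˡ-≡ (β.count m) _ _ (trans (cong (_+ (⟨ β.len a ℕ.≟ m ⟩ + ⟨ β.len b ℕ.≟ m ⟩)) (sym (eq m)))
        (total m))))

-- Evaluation of each pattern

does⇒ : ∀ {P : Set} (p? : Dec P) → T (does p?) → P
does⇒ (yes p) _ = p

module Evaluate {n} (β : Fin n → Fin n) (injβ : Injective _≡_ _≡_ β) where
  open Twisted β injβ

  private
    W = twists β injβ

    sw : ∀ a b → IsSwap β (half a b) a b
    sw a b = transpose-IsSwap a b β

  split₂-zero : ∀ a b c d → T (split₂ β injβ a b c d) → twists β injβ a b c d ≡ 0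
  split₂-zero a b c d t with does⇒ (β.same? a b ×-dec β.same? c d ×-dec ¬? (β.same? a c)) t
  ... | a~b , c~d , a≁c = ⟨⟩-case (distinct? a b c d) (λ dist → At.split-split dist a~b
    (outside-Same′ (sw a b) (a≁c ∘ β.Same-sym) (λ s → a≁c (β.Same-trans a~b (β.Same-sym s))) c~d)) (λ _ → refl)

  merge₂-zero : ∀ a b c d → T (merge₂ β injβ a b c d) → twists β injβ a b c d ≡ 0
  merge₂-zero a b c d t with does⇒ (¬? (β.same? a b) ×-dec ¬? (β.same? a d) ×-dec ¬? (β.same? b d) ×-dec ¬? (β.same? c d)) t
  ... | a≁b , a≁d , b≁d , c≁d = ⟨⟩-case (distinct? a b c d) (λ dist → At.merge-merge dist a≁b
    (λ s → c≁d (β.Same-sym (outside-Same (sw a b) (a≁d ∘ β.Same-sym) (b≁d ∘ β.Same-sym) (Half.Same-sym a b s))))) (λ _ → refl)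

  split-lengths : ∀ a {k} → k < β.len a ∸ 1 → let b = iter β (suc k) a in Half.len a b a ≡ β.len a ∸ suc k × Half.len a b b ≡ suc k
  split-lengths a {k} k<L = len-a , len-b
    where
    b = iter β (suc k) a
    open Swap.Split {β = β} {δ = half a b} injβ (half-injective a b) {a} {b} (sw a b) (s≤s z≤n)
      (subst (suc k <_) (m+[n∸m]≡n (β.len>0 a)) (s≤s k<L)) refl

  -- The partners of `a` are the points `suc k` steps after it, and the transposition cuts off a
  -- piece of length `suc k` at `b`, leaving the rest to `a`.
  ∑-splits : ∀ (F : ℕ → ℕ → Fin n → ℕ) a →
    ∑ᶠ (λ b → ⟨ β.other? a b ⟩ * F (Half.len a b a) (Half.len a b b) a) ≡ ∑ᵘ (β.len a ∸ 1) (λ k → F (β.len a ∸ suc k) (suc k) a)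
  ∑-splits F a = trans (β.∑-other (β.period-pred a) _) (∑ᵘ-cong (β.len a ∸ 1) (λ k k<L → cong₂ (λ p q → F p q a)
    (proj₁ (split-lengths a k<L)) (proj₂ (split-lengths a k<L))))

  module _ {a b c d : Fin n} where
    private
      module δ = Half a b

      a≢b′ : β.Other a b → a ≢ b
      a≢b′ o e = proj₂ o (sym e)

      module Pieces (o : β.Other a b) where
        open SwapCycles {β = β} {δ = half a b} injβ (half-injective a b) {a} {b} (a≢b′ o) (sw a b) public
        separated : ¬ Same (half a b) a b
        separated = proj₁ (splits (proj₁ o))
        out : ∀ {x} → ¬ Same β a x → ¬ Same β x a × ¬ Same β x b
        out = outside (proj₁ o)
        in-a : ∀ {x} → δ.Other a x → Same β a x
        in-a (s , _) = from-pieces (proj₁ o) (inj₁ s)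
        in-b : ∀ {x} → δ.Other b x → Same β a x
        in-b (s , _) = from-pieces (proj₁ o) (inj₂ s)
        a-not-b : ∀ {x} → Same (half a b) a x → x ≢ b
        a-not-b s refl = separated s
        b-not-a : ∀ {x} → Same (half a b) b x → x ≢ a
        b-not-a s refl = separated (δ.Same-sym s)
        apart : ∀ {x y} → Same (half a b) a x → Same (half a b) b y → ¬ Same (half a b) x y
        apart s t u = separated (δ.Same-trans s (δ.Same-trans u (δ.Same-sym t)))
        out≢ : ∀ {x} → ¬ Same β a x → a ≢ x × b ≢ x
        out≢ ≁ = (λ { refl → ≁ β.Same-refl }) , (λ { refl → ≁ (proj₁ o) })
        out-len : ∀ {x} → ¬ Same β a x → δ.len x ≡ β.len x
        out-len ≁ = outside-len (proj₁ (out ≁)) (proj₂ (out ≁))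
        out-≁ : ∀ {x y} → ¬ Same β a x → Same (half a b) x y → Same β x y
        out-≁ ≁ = outside-Same (sw a b) (proj₁ (out ≁)) (proj₂ (out ≁))

      split-value : ∀ {X : Set} (x? : Dec X) {v} → (β.Other a b → ⟨ x? ⟩ ≡ v) → ⟨ β.other? a b ×-dec x? ⟩ * Z ≡ ⟨ β.other? a b ⟩
        * (v * Z)
      split-value x? h = trans (cong (_* Z) (⟨⟩-× (β.other? a b) x?)) (trans (*-assoc ⟨ β.other? a b ⟩ _ Z)
        (⟨⟩-guard (β.other? a b) (λ o → cong (_* Z) (h o))))

    -- Once (a b) has split the cycle, (c d) must merge, so `c` and `d` lie on different pieces;
    -- rejoining the two pieces always restores the length.
    p₄-twists : ⟦ p₄ β injβ a b c d ⟧ * twists β injβ a b c d ≡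
      ⟨ β.other? a b ⟩ * ((⟨ δ.other? a c ⟩ * ⟨ δ.other? b d ⟩ + ⟨ δ.other? b c ⟩ * ⟨ δ.other? a d ⟩) * Z)
    p₄-twists = trans (collect (β.same? a b ×-dec β.same? a c ×-dec β.same? a d) (distinct? a b c d) (¬? (δ.same? c d))
      (β.other? a b ×-dec x?) value to from)
      (split-value x? (λ o → let open Pieces o in trans (⟨⟩-⊎ (δ.other? a c ×-dec δ.other? b d) (δ.other? b c ×-dec δ.other? a d)
        (λ ((ac , _) , _) ((bc , _) , _) → separated (δ.Same-trans ac (δ.Same-sym bc))))
          (cong₂ _+_ (⟨⟩-× (δ.other? a c) (δ.other? b d)) (⟨⟩-× (δ.other? b c) (δ.other? a d)))))
      where
      x? = (δ.other? a c ×-dec δ.other? b d) ⊎-dec (δ.other? b c ×-dec δ.other? a d)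
      X = (δ.Other a c × δ.Other b d) ⊎ (δ.Other b c × δ.Other a d)
      value : Same β a b × Same β a c × Same β a d → Distinct a b c d → conjugators β (twisted β injβ a b c d) ≡ ⟨ ¬?
        (δ.same? c d) ⟩ * Z
      value (ab , ac , ad) dist@(a≢b , a≢c , a≢d , b≢c , b≢d , c≢d) = sym (⟨⟩-case (¬? (δ.same? c d))
        (λ c≁d → trans (sym (*-identityˡ Z))
          (trans (cong (_* Z) (sym (⟨⟩-yes splitMerge? (crossing (to-pieces ab ac) (to-pieces ab ad) c≁d))))
          (sym (split-merge ab c≁d))))
        (λ ¬c≁d → sym (split-split ab (decidable-stable (δ.same? c d) ¬c≁d))))
        where
        open At dist using (splitMerge?; split-merge; split-split)
        open Pieces (ab , a≢b ∘ sym)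
        L≡ : β.len a ≡ δ.len a + δ.len b
        L≡ = proj₂ (splits ab)
        crossing : Same (half a b) a c ⊎ Same (half a b) b c → Same (half a b) a d ⊎ Same (half a b) b d → ¬ Same (half a b) c d
          →
          β.len a ≡ δ.len c + δ.len d × (δ.len c ≡ δ.len a ⊎ δ.len c ≡ δ.len b)
        crossing (inj₁ s) (inj₁ t) n = contradiction (δ.Same-trans (δ.Same-sym s) t) n
        crossing (inj₂ s) (inj₂ t) n = contradiction (δ.Same-trans (δ.Same-sym s) t) n
        crossing (inj₁ s) (inj₂ t) n = trans L≡ (cong₂ _+_ (δ.len-Same s) (δ.len-Same t)) , inj₁ (sym (δ.len-Same s))
        crossing (inj₂ s) (inj₁ t) n = trans L≡ (trans (+-comm (δ.len a) _) (cong₂ _+_ (δ.len-Same s) (δ.len-Same t))) , inj₂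
          (sym (δ.len-Same s))
      to : Same β a b × Same β a c × Same β a d → Distinct a b c d → ¬ Same (half a b) c d → β.Other a b × X
      to (ab , ac , ad) (a≢b , a≢c , a≢d , b≢c , b≢d , c≢d) c≁d = (ab , a≢b ∘ sym) , place (to-pieces ab ac) (to-pieces ab ad)
        where
        open Pieces (ab , a≢b ∘ sym)
        place : Same (half a b) a c ⊎ Same (half a b) b c → Same (half a b) a d ⊎ Same (half a b) b d → X
        place (inj₁ s) (inj₁ t) = contradiction (δ.Same-trans (δ.Same-sym s) t) c≁d
        place (inj₂ s) (inj₂ t) = contradiction (δ.Same-trans (δ.Same-sym s) t) c≁d
        place (inj₁ s) (inj₂ t) = inj₁ ((s , a≢c ∘ sym) , (t , b≢d ∘ sym))
        place (inj₂ s) (inj₁ t) = inj₂ ((s , b≢c ∘ sym) , (t , a≢d ∘ sym))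
      from : β.Other a b × X → (Same β a b × Same β a c × Same β a d) × Distinct a b c d × ¬ Same (half a b) c d
      from (o , inj₁ (oc@(s , c≢a) , od@(t , d≢b))) = (proj₁ o , in-a oc , in-b od) ,
        (a≢b′ o , c≢a ∘ sym , b-not-a t ∘ sym , a-not-b s ∘ sym , d≢b ∘ sym , λ { refl → apart s t δ.Same-refl }) , apart s t
        where open Pieces o
      from (o , inj₂ (oc@(s , c≢b) , od@(t , d≢a))) = (proj₁ o , in-b oc , in-a od) ,
        (a≢b′ o , b-not-a s ∘ sym , d≢a ∘ sym , c≢b ∘ sym , a-not-b t ∘ sym , λ { refl → apart t s δ.Same-refl }) , apart t s ∘
          δ.Same-sym
        where open Pieces o

    -- The piece of `c` is merged with the cycle of `d`. The old lengths come back exactly when the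
    -- cycle of `d` is as long as the piece that does not contain `c`.
    p₃-twists : ⟦ p₃ β injβ a b c d ⟧ * twists β injβ a b c d ≡
      ⟨ β.other? a b ⟩ * (⟨ ¬? (β.same? a d) ⟩ * (⟨ δ.other? a c ⟩ * ⟨ β.len d ℕ.≟ δ.len b ⟩ + ⟨ δ.other? b c ⟩ * ⟨ β.len d ℕ.≟
        δ.len a ⟩) * Z)
    p₃-twists = trans (collect (β.same? a b ×-dec β.same? a c ×-dec ¬? (β.same? a d)) (distinct? a b c d) r?
      (β.other? a b ×-dec (¬? (β.same? a d) ×-dec x?)) value to from)
      (split-value (¬? (β.same? a d) ×-dec x?) (λ o → let open Pieces o in trans (⟨⟩-× (¬? (β.same? a d)) x?) (cong (⟨ ¬? (β.same? a d) ⟩ *_)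
        (trans (⟨⟩-⊎ (δ.other? a c ×-dec (β.len d ℕ.≟ δ.len b)) (δ.other? b c ×-dec (β.len d ℕ.≟ δ.len a))
          (λ ((ac , _) , _) ((bc , _) , _) → separated (δ.Same-trans ac (δ.Same-sym bc))))
          (cong₂ _+_ (⟨⟩-× (δ.other? a c) (β.len d ℕ.≟ δ.len b)) (⟨⟩-× (δ.other? b c) (β.len d ℕ.≟ δ.len a)))))))
      where
      R = β.len a ≡ δ.len c + δ.len d × (δ.len c ≡ δ.len a ⊎ δ.len c ≡ δ.len b)
      r? : Dec R
      r? = (β.len a ℕ.≟ δ.len c + δ.len d) ×-dec ((δ.len c ℕ.≟ δ.len a) ⊎-dec (δ.len c ℕ.≟ δ.len b))
      x? = (δ.other? a c ×-dec (β.len d ℕ.≟ δ.len b)) ⊎-dec (δ.other? b c ×-dec (β.len d ℕ.≟ δ.len a))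
      X = (δ.Other a c × β.len d ≡ δ.len b) ⊎ (δ.Other b c × β.len d ≡ δ.len a)
      value : Same β a b × Same β a c × ¬ Same β a d → Distinct a b c d → conjugators β (twisted β injβ a b c d) ≡ ⟨ r? ⟩ * Z
      value (ab , ac , a≁d) dist@(a≢b , _) = At.split-merge dist ab
        (λ s → a≁d (β.Same-trans ac (β.Same-sym (out-≁ a≁d (δ.Same-sym s)))))
        where open Pieces (ab , a≢b ∘ sym)
      to : Same β a b × Same β a c × ¬ Same β a d → Distinct a b c d → R → β.Other a b × ¬ Same β a d × X
      to (ab , ac , a≁d) (a≢b , a≢c , a≢d , b≢c , b≢d , c≢d) (e , _) = (ab , a≢b ∘ sym) , a≁d , place (to-pieces ab ac)
        where
        open Pieces (ab , a≢b ∘ sym)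
        L≡ : δ.len a + δ.len b ≡ δ.len c + β.len d
        L≡ = trans (sym (proj₂ (splits ab))) (trans e (cong (δ.len c +_) (out-len a≁d)))
        place : Same (half a b) a c ⊎ Same (half a b) b c → X
        place (inj₁ s) = inj₁ ((s , a≢c ∘ sym) , sym (+-cancelˡ-≡ (δ.len a) _ _
          (trans L≡ (cong (_+ β.len d) (sym (δ.len-Same s))))))
        place (inj₂ s) = inj₂ ((s , b≢c ∘ sym) , sym (+-cancelˡ-≡ (δ.len b) _ _ (trans (+-comm (δ.len b) _)
          (trans L≡ (cong (_+ β.len d) (sym (δ.len-Same s)))))))
      from : β.Other a b × ¬ Same β a d × X → (Same β a b × Same β a c × ¬ Same β a d) × Distinct a b c d × R
      from (o , a≁d , x) = place x
        where
        open Pieces o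
        L≡ : β.len a ≡ δ.len a + δ.len b
        L≡ = proj₂ (splits (proj₁ o))
        place : X → (Same β a b × Same β a c × ¬ Same β a d) × Distinct a b c d × R
        place (inj₁ (oc@(s , c≢a) , e)) = (proj₁ o , in-a oc , a≁d) ,
          (a≢b′ o , c≢a ∘ sym , proj₁ (out≢ a≁d) , a-not-b s ∘ sym , proj₂ (out≢ a≁d) , λ { refl → a≁d (in-a oc) }) ,
          trans L≡ (cong₂ _+_ (δ.len-Same s) (trans (sym e) (sym (out-len a≁d)))) , inj₁ (sym (δ.len-Same s))
        place (inj₂ (oc@(s , c≢b) , e)) = (proj₁ o , in-b oc , a≁d) ,
          (a≢b′ o , b-not-a s ∘ sym , proj₁ (out≢ a≁d) , c≢b ∘ sym , proj₂ (out≢ a≁d) , λ { refl → a≁d (in-b oc) }) ,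
          trans L≡ (trans (+-comm (δ.len a) _) (cong₂ _+_ (δ.len-Same s) (trans (sym e) (sym (out-len a≁d))))) , inj₂
            (sym (δ.len-Same s))

    -- The cycle of `a` has to split into the lengths of the cycles of `c` and `d`, which merge to
    -- replace it. That `c` and `d` lie off the cycle of `a` is recovered from the length equation,
    -- both summands being positive.
    p₁-twists : ⟦ p₁ β injβ a b c d ⟧ * twists β injβ a b c d ≡
      ⟨ β.other? a b ⟩ * (⟨ ¬? (β.same? c d) ⟩ * (⟨ β.len a ℕ.≟ β.len c + β.len d ⟩ * ⟨ (β.len c ℕ.≟ δ.len a) ⊎-dec
        (β.len c ℕ.≟ δ.len b) ⟩) * Z)
    p₁-twists = trans (collect (β.same? a b ×-dec ¬? (β.same? a c) ×-dec ¬? (β.same? a d) ×-dec ¬? (β.same? c d))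
      (distinct? a b c d) r? (β.other? a b ×-dec (¬? (β.same? c d) ×-dec x?)) value to from)
      (split-value (¬? (β.same? c d) ×-dec x?) (λ o → trans (⟨⟩-× (¬? (β.same? c d)) x?) (cong (⟨ ¬? (β.same? c d) ⟩ *_)
        (⟨⟩-× (β.len a ℕ.≟ β.len c + β.len d) ((β.len c ℕ.≟ δ.len a) ⊎-dec (β.len c ℕ.≟ δ.len b))))))
      where
      R = β.len a ≡ δ.len c + δ.len d × (δ.len c ≡ δ.len a ⊎ δ.len c ≡ δ.len b)
      r? : Dec R
      r? = (β.len a ℕ.≟ δ.len c + δ.len d) ×-dec ((δ.len c ℕ.≟ δ.len a) ⊎-dec (δ.len c ℕ.≟ δ.len b))
      X = β.len a ≡ β.len c + β.len d × (β.len c ≡ δ.len a ⊎ β.len c ≡ δ.len b)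
      x? : Dec X
      x? = (β.len a ℕ.≟ β.len c + β.len d) ×-dec ((β.len c ℕ.≟ δ.len a) ⊎-dec (β.len c ℕ.≟ δ.len b))
      P = Same β a b × ¬ Same β a c × ¬ Same β a d × ¬ Same β c d
      value : P → Distinct a b c d → conjugators β (twisted β injβ a b c d) ≡ ⟨ r? ⟩ * Z
      value (ab , a≁c , a≁d , c≁d) dist@(a≢b , _) = At.split-merge dist ab (λ s → c≁d (out-≁ a≁c s))
        where open Pieces (ab , a≢b ∘ sym)
      to : P → Distinct a b c d → R → β.Other a b × ¬ Same β c d × X
      to (ab , a≁c , a≁d , c≁d) (a≢b , _) r = (ab , a≢b ∘ sym) , c≁d ,
        subst₂ (λ i j → β.len a ≡ i + j × (i ≡ δ.len a ⊎ i ≡ δ.len b)) (out-len a≁c) (out-len a≁d) r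
        where open Pieces (ab , a≢b ∘ sym)
      from : β.Other a b × ¬ Same β c d × X → P × Distinct a b c d × R
      from (o , c≁d , x@(e , _)) = (proj₁ o , a≁c , a≁d , c≁d) ,
        (a≢b′ o , proj₁ (out≢ a≁c) , proj₁ (out≢ a≁d) , proj₂ (out≢ a≁c) , proj₂ (out≢ a≁d) , λ { refl → c≁d β.Same-refl }) ,
        subst₂ (λ i j → β.len a ≡ i + j × (i ≡ δ.len a ⊎ i ≡ δ.len b)) (sym (out-len a≁c)) (sym (out-len a≁d)) x
        where
        open Pieces o
        a≁c : ¬ Same β a c
        a≁c s = <-irrefl (trans (sym (β.len-Same s)) e) (m<m+n (β.len c) (β.len>0 d))
        a≁d : ¬ Same β a d
        a≁d s = <-irrefl (trans (sym (β.len-Same s)) e) (m<n+m (β.len d) (β.len>0 c))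

    -- Here (a b) merges and (c d) always cuts the merged cycle again; what remains is a condition
    -- on one piece, whose length `merge-split-length` computes.
    p₂-twists : ⟦ p₂ β injβ a b c d ⟧ * twists β injβ a b c d ≡
      ⟨ ¬? (β.same? a b) ⟩ * (⟨ β.other? a c ⟩ * (⟨ β.other? b d ⟩ * ⟨ (Full.len a b c d d ℕ.≟ β.len a) ⊎-dec
        (Full.len a b c d d ℕ.≟ β.len b) ⟩)) * Z
    p₂-twists = trans (collect (β.same? a c ×-dec β.same? b d ×-dec ¬? (β.same? a b)) (distinct? a b c d) r?
      (¬? (β.same? a b) ×-dec (β.other? a c ×-dec (β.other? b d ×-dec r?))) value to from)
      (cong (_* Z) (trans (⟨⟩-× (¬? (β.same? a b)) (β.other? a c ×-dec (β.other? b d ×-dec r?))) (cong (⟨ ¬? (β.same? a b) ⟩ *_)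
        (trans (⟨⟩-× (β.other? a c) (β.other? b d ×-dec r?)) (cong (⟨ β.other? a c ⟩ *_) (⟨⟩-× (β.other? b d) r?))))))
      where
      R = Full.len a b c d d ≡ β.len a ⊎ Full.len a b c d d ≡ β.len b
      r? : Dec R
      r? = (Full.len a b c d d ℕ.≟ β.len a) ⊎-dec (Full.len a b c d d ℕ.≟ β.len b)
      P = Same β a c × Same β b d × ¬ Same β a b
      value : P → Distinct a b c d → conjugators β (twisted β injβ a b c d) ≡ ⟨ r? ⟩ * Z
      value (ac , bd , a≁b) dist@(a≢b , _) = At.merge-split dist a≁b (δ.Same-trans (δ.Same-sym a~c) (δ.Same-trans merged b~d))
        a~c
        where
        module Back = Swap {β = half a b} {δ = β} (half-injective a b) injβ {a} {b} (swap-sym (sw a b))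
        open Swap.Merge {β = β} {δ = half a b} injβ (half-injective a b) {a} {b} (sw a b) a≁b using (merged)
        a~c : Same (half a b) a c
        a~c = Back.from-pieces merged (inj₁ ac)
        b~d : Same (half a b) b d
        b~d = δ.Same-trans (δ.Same-sym merged) (Back.from-pieces merged (inj₂ bd))
      to : P → Distinct a b c d → R → ¬ Same β a b × β.Other a c × β.Other b d × R
      to (ac , bd , a≁b) (_ , a≢c , _ , _ , b≢d , _) r = a≁b , (ac , a≢c ∘ sym) , (bd , b≢d ∘ sym) , r
      from : ¬ Same β a b × β.Other a c × β.Other b d × R → P × Distinct a b c d × R
      from (a≁b , (ac , c≢a) , (bd , d≢b) , r) = (ac , bd , a≁b) ,
        ((λ { refl → a≁b β.Same-refl }) , c≢a ∘ sym , (λ { refl → a≁b (β.Same-sym bd) }) , (λ { refl → a≁b ac }) , d≢b ∘ sym ,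
          (λ { refl → a≁b (β.Same-trans ac (β.Same-sym bd)) })) , r

  -- In the merged cycle `c` reaches `a` after the `β.len a ∸ suc s` steps left in its old cycle;
  -- the walk then enters the cycle of `b` and meets `d` after `suc t` more.
  merge-split-length : ∀ {a b s t} → ¬ Same β a b → suc s < β.len a → suc t < β.len b →
    let c = iter β (suc s) a ; d = iter β (suc t) b in Full.len a b c d d ≡ (β.len a ∸ suc s) + suc t
  merge-split-length {a} {b} {s} {t} a≁b s<A t<B = len-b
    where
    A = β.len a
    c = iter β (suc s) a
    d = iter β (suc t) b
    δ = half a b
    open Swap.Merge {β = β} {δ = δ} injβ (half-injective a b) {a} {b} (sw a b) a≁b
    -- From `a` the merged cycle runs through the cycle of `b` first, so `c` comes `β.len b` steps
    -- later than under β.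
    c-at : iter δ (suc s + β.len b) a ≡ c
    c-at = walk-ab (suc s) (s≤s z≤n) (<⇒≤ s<A)
    p = (A ∸ suc s) + suc t
    at-p : iter δ p c ≡ d
    at-p = begin
      iter δ p c ≡⟨ cong (λ k → iter δ k c) (+-comm (A ∸ suc s) (suc t)) ⟩
      iter δ (suc t + (A ∸ suc s)) c ≡⟨ iter-+ δ (suc t) (A ∸ suc s) c ⟩
      iter δ (suc t) (iter δ (A ∸ suc s) c) ≡⟨ cong (iter δ (suc t) ∘ iter δ (A ∸ suc s)) (sym c-at) ⟩
      iter δ (suc t) (iter δ (A ∸ suc s) (iter δ (suc s + β.len b) a)) ≡⟨ cong (iter δ (suc t))
        (trans (sym (iter-+ δ (A ∸ suc s) (suc s + β.len b) a)) (cong (λ k → iter δ k a)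
            (trans (sym (+-assoc (A ∸ suc s) (suc s) (β.len b))) (cong (_+ β.len b) (m∸n+n≡m (<⇒≤ s<A)))))) ⟩
      iter δ (suc t) (iter δ (A + β.len b) a) ≡⟨ cong (iter δ (suc t)) (return merged-period) ⟩
      iter δ (suc t) a ≡⟨ walk-a (suc t) (s≤s z≤n) (<⇒≤ t<B) ⟩
      d ∎
    c-len : Half.len a b c ≡ A + β.len b
    c-len = trans (sym (Half.len-Same a b (suc s + β.len b , c-at))) merged-len
    p<S : p < Half.len a b c
    p<S = subst (p <_) (sym c-len) (+-mono-≤-< (m∸n≤m A (suc s)) t<B)
    0<p : 0 < p
    0<p = ≤-trans (s≤s z≤n) (m≤n+m (suc t) (A ∸ suc s))
    open Swap.Split {β = δ} {δ = twisted β injβ a b c d} (half-injective a b) (twisted-injective β injβ a b c d) {c} {d}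
      (transpose-IsSwap c d δ) 0<p p<S at-p using (len-b)

-- Summing over the four points

∑-product : ∀ {A B : Set} (xs : List A) (ys : List B) f g → ∑ xs (λ x → ∑ ys (λ y → f x * g y)) ≡ ∑ xs f * ∑ ys g
∑-product xs ys f g = trans (∑-cong xs (λ x → ∑-*ˡ ys (f x) g)) (∑-*ʳ xs (∑ ys g) f)

∑ᵘ-hit : ∀ {n k} (f : ℕ → ℕ) → k < n → ∀ {P : ℕ → Set} (p? : ∀ j → Dec (P j)) → P k → (∀ j → j < n → P j → j ≡ k) → ∑ᵘ n
  (λ j → f j * ⟨ p? j ⟩) ≡ f k
∑ᵘ-hit {n} {k} f k<n p? pk uniq = trans
  (∑ᵘ-cong n (λ j j<n → trans (*-comm (f j) _) (cong (_* f j) (⟨⟩-cong (uniq j j<n) (λ { refl → pk }) (p? j) (j ℕ.≟ k)))))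
  (∑ᵘ-δ f k<n)

∑ᵘ-miss : ∀ {n} (f : ℕ → ℕ) {P : ℕ → Set} (p? : ∀ j → Dec (P j)) → (∀ j → j < n → ¬ P j) → ∑ᵘ n (λ j → f j * ⟨ p? j ⟩) ≡ 0
∑ᵘ-miss {n} f p? none = trans (∑ᵘ-cong n {g = λ _ → 0} (λ j j<n → trans (cong (f j *_) (⟨⟩-no (p? j) (none j j<n)))
  (*-zeroʳ (f j)))) (∑-zero (upTo n) (λ _ → refl))

-- A piece of length i arises from the cut k + 1 = i and from its mirror image; in each case `c` has
-- L - i - 1 places on the other piece. For L = 2i the two cuts coincide and both summands count;
-- for i ≥ L there is none, and truncated subtraction makes the right side 0.
∑-split-31 : ∀ L i → 0 < i → ∑ᵘ (L ∸ 1) (λ k → (L ∸ suc k ∸ 1) * ⟨ i ℕ.≟ suc k ⟩ + k * ⟨ i ℕ.≟ L ∸ suc k ⟩) ≡ 2 * (L ∸ i ∸ 1)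
∑-split-31 zero    i 0<i = trans (∑ᵘ-cong 0 {g = λ _ → 0} (λ _ ())) (trans (∑-zero (upTo 0) (λ _ → refl))
  (sym (cong (λ k → 2 * (k ∸ 1)) (0∸n≡0 i))))
∑-split-31 (suc L) (suc i) _ = trans (∑-+ (upTo L) _ _) (trans (by-cases (i <? L)) (cong (L ∸ i ∸ 1 +_) (sym (+-identityʳ _))))
  where
  by-cases : Dec (i < L) → ∑ᵘ L (λ k → (L ∸ k ∸ 1) * ⟨ suc i ℕ.≟ suc k ⟩) + ∑ᵘ L (λ k → k * ⟨ suc i ℕ.≟ L ∸ k ⟩) ≡ (L ∸ i ∸ 1) +
    (L ∸ i ∸ 1)
  by-cases (yes i<L) = cong₂ _+_
    (∑ᵘ-hit (λ k → L ∸ k ∸ 1) i<L (λ k → suc i ℕ.≟ suc k) refl (λ j _ e → sym (suc-injective e)))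
    (trans (∑ᵘ-hit id (mirror< i<L) (λ k → suc i ℕ.≟ L ∸ k) (sym (m∸[m∸n]≡n i<L))
       (λ j j<L e → trans (sym (m∸[m∸n]≡n (<⇒≤ j<L))) (cong (L ∸_) (sym e)))) (trans (cong (L ∸_) (+-comm 1 i))
         (sym (∸-+-assoc L i 1))))
    where
    mirror< : ∀ {i L} → i < L → L ∸ suc i < L
    mirror< {i} {suc L} _ = s≤s (m∸n≤m L i)
  by-cases (no i≮L) = trans (cong₂ _+_
    (∑ᵘ-miss (λ k → L ∸ k ∸ 1) (λ k → suc i ℕ.≟ suc k) (λ j j<L e → i≮L (subst (_< L) (sym (suc-injective e)) j<L)))
    (∑ᵘ-miss id (λ k → suc i ℕ.≟ L ∸ k) (λ j j<L e → i≮L (subst (_≤ L) (sym e) (m∸n≤m L j)))))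
    (sym (cong (λ k → (k ∸ 1) + (k ∸ 1)) (m≤n⇒m∸n≡0 (≮⇒≥ i≮L))))

-- There are two cuts of the cycle into lengths i and j, mirror images of each other, and they
-- coincide when i = j.
∑-split-211 : ∀ i j → 0 < i → 0 < j → ∑ᵘ (i + j ∸ 1) (λ k → ⟨ (i ℕ.≟ i + j ∸ suc k) ⊎-dec (i ℕ.≟ suc k) ⟩) ≡ 1 + ⟨ ¬?
  (i ℕ.≟ j) ⟩
∑-split-211 (suc i) (suc j) _ _ = by-cases (i ℕ.≟ j)
  where
  L = i + suc j
  i<L : i < L
  i<L = m<m+n i (s≤s z≤n)
  j<L : j < L
  j<L = m≤n+m (suc j) i
  first : ∀ k → k < L → suc i ≡ L ∸ k → k ≡ j
  first k k<L e = trans (sym (m∸[m∸n]≡n (<⇒≤ k<L))) (trans (cong (L ∸_) (sym e)) (trans (cong (_∸ suc i) (+-suc i j))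
    (m+n∸m≡n (suc i) j)))
  first′ : suc i ≡ L ∸ j
  first′ = sym (trans (cong (_∸ j) (+-suc i j)) (m+n∸n≡m (suc i) j))
  p? : ∀ k → Dec (suc i ≡ L ∸ k ⊎ suc i ≡ suc k)
  p? k = (suc i ℕ.≟ L ∸ k) ⊎-dec (suc i ℕ.≟ suc k)
  by-cases : Dec (i ≡ j) → ∑ᵘ L (λ k → ⟨ p? k ⟩) ≡ 1 + ⟨ ¬? (suc i ℕ.≟ suc j) ⟩
  by-cases (yes refl) = trans (∑-cong (upTo L) (λ k → sym (*-identityˡ _))) (trans
    (∑ᵘ-hit (λ _ → 1) i<L p? (inj₂ refl) (λ k k<L → [ first k k<L , (λ e → sym (suc-injective e)) ]′))
    (cong suc (sym (⟨⟩-no (¬? (suc i ℕ.≟ suc i)) (λ ne → ne refl)))))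
  by-cases (no i≢j) = begin
    ∑ᵘ L (λ k → ⟨ p? k ⟩) ≡⟨ ∑ᵘ-cong L (λ k k<L → trans (⟨⟩-⊎ (suc i ℕ.≟ L ∸ k) (suc i ℕ.≟ suc k)
      (λ e f → i≢j (trans (suc-injective f) (first k k<L e))))
            (sym (cong₂ _+_ (*-identityˡ ⟨ suc i ℕ.≟ L ∸ k ⟩) (*-identityˡ ⟨ suc i ℕ.≟ suc k ⟩)))) ⟩
    ∑ᵘ L (λ k → 1 * ⟨ suc i ℕ.≟ L ∸ k ⟩ + 1 * ⟨ suc i ℕ.≟ suc k ⟩) ≡⟨ ∑-+ (upTo L) _ _ ⟩
    ∑ᵘ L (λ k → 1 * ⟨ suc i ℕ.≟ L ∸ k ⟩) + ∑ᵘ L (λ k → 1 * ⟨ suc i ℕ.≟ suc k ⟩) ≡⟨ cong₂ _+_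
        (∑ᵘ-hit (λ _ → 1) j<L (λ k → suc i ℕ.≟ L ∸ k) first′ first)
        (∑ᵘ-hit (λ _ → 1) i<L (λ k → suc i ℕ.≟ suc k) refl (λ k _ e → sym (suc-injective e))) ⟩
    2 ≡⟨ cong suc (⟨⟩-yes (¬? (suc i ℕ.≟ suc j)) (i≢j ∘ suc-injective)) ⟨
    1 + ⟨ ¬? (suc i ℕ.≟ suc j) ⟩ ∎

-- For a cycle of length i merged with one of length j, the positions s and t of the second transposition that split
-- off a cycle of length i or j.
crossings : ℕ → ℕ → ℕ
crossings i j = ∑ᵘ (i ∸ 1) (λ s → ∑ᵘ (j ∸ 1) (λ t → ⟨ ((i ∸ suc s) + suc t ℕ.≟ i) ⊎-dec ((i ∸ suc s) + suc t ℕ.≟ j) ⟩))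

module _ where
  private
    hits-i : ∀ {i s t} → suc s < suc i → (i ∸ s) + suc t ≡ suc i → t ≡ s
    hits-i {i} {s} {t} (s≤s s<i) e = +-cancelˡ-≡ (i ∸ s) t s (trans (suc-injective (trans (sym (+-suc (i ∸ s) t)) e))
      (sym (m∸n+n≡m (<⇒≤ s<i))))

    hits-i′ : ∀ {i s} → suc s < suc i → (i ∸ s) + suc s ≡ suc i
    hits-i′ {i} {s} (s≤s s<i) = trans (+-suc (i ∸ s) s) (cong suc (m∸n+n≡m (<⇒≤ s<i)))

  -- For every `s` only `t` = s qualifies.
  crossings-diagonal : ∀ i → crossings i i ≡ i ∸ 1
  crossings-diagonal zero = ∑-zero (upTo 0) (λ s → ∑-zero (upTo 0) (λ _ → refl))
  crossings-diagonal (suc i) = trans (∑ᵘ-cong i (λ s s<i → trans (∑-cong (upTo i) (λ t → sym (*-identityˡ _)))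
    (∑ᵘ-hit (λ _ → 1) s<i (λ t → ((i ∸ s) + suc t ℕ.≟ suc i) ⊎-dec ((i ∸ s) + suc t ℕ.≟ suc i)) (inj₁ (hits-i′ (s≤s s<i)))
      (λ t _ → [ hits-i (s≤s s<i) , hits-i (s≤s s<i) ]′))))
    (∑ᵘ-1 i)

  -- For every `s`, `t` = s yields a piece of length i, and one further `t` yields length j; the
  -- inequality keeps the latter in range and the two distinct.
  crossings-< : ∀ {i j} → 0 < i → i < j → crossings i j ≡ 2 * (i ∸ 1)
  crossings-< {suc i} {suc j} _ (s≤s i<j) = trans (∑ᵘ-cong i two) (trans (∑-*ʳ (upTo i) 2 (λ _ → 1))
    (trans (cong (_* 2) (∑ᵘ-1 i)) (*-comm i 2)))
    where
    two : ∀ s → s < i → ∑ᵘ j (λ t → ⟨ ((i ∸ s) + suc t ℕ.≟ suc i) ⊎-dec ((i ∸ s) + suc t ℕ.≟ suc j) ⟩) ≡ 1 * 2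
    two s s<i = begin
      ∑ᵘ j (λ t → ⟨ (x t ℕ.≟ suc i) ⊎-dec (x t ℕ.≟ suc j) ⟩) ≡⟨ ∑-cong (upTo j)
        (λ t → trans (⟨⟩-⊎ (x t ℕ.≟ suc i) (x t ℕ.≟ suc j) (λ e f → <-irrefl (suc-injective (trans (sym e) f)) i<j))
            (sym (cong₂ _+_ (*-identityˡ ⟨ x t ℕ.≟ suc i ⟩) (*-identityˡ ⟨ x t ℕ.≟ suc j ⟩)))) ⟩
      ∑ᵘ j (λ t → 1 * ⟨ x t ℕ.≟ suc i ⟩ + 1 * ⟨ x t ℕ.≟ suc j ⟩) ≡⟨ ∑-+ (upTo j) _ _ ⟩
      ∑ᵘ j (λ t → 1 * ⟨ x t ℕ.≟ suc i ⟩) + ∑ᵘ j (λ t → 1 * ⟨ x t ℕ.≟ suc j ⟩) ≡⟨ cong₂ _+_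
          (∑ᵘ-hit (λ _ → 1) (<-trans s<i i<j) (λ t → x t ℕ.≟ suc i) (hits-i′ (s≤s s<i)) (λ t _ → hits-i (s≤s s<i)))
          (∑ᵘ-hit (λ _ → 1) t₀<j (λ t → x t ℕ.≟ suc j) at-t₀ (λ t _ e → +-cancelˡ-≡ (i ∸ s) t t₀
            (suc-injective (trans (sym (+-suc (i ∸ s) t)) (trans e (sym (trans (sym (+-suc (i ∸ s) t₀)) at-t₀)))))) ) ⟩
      2 ∎
      where
      x : ℕ → ℕ
      x t = (i ∸ s) + suc t
      t₀ = j ∸ (i ∸ s)
      t₀<j : t₀ < j
      t₀<j = ∸-monoʳ-< {o = 0} (m<n⇒0<n∸m s<i) (≤-trans (m∸n≤m i s) (<⇒≤ i<j))
      at-t₀ : x t₀ ≡ suc j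
      at-t₀ = trans (+-suc (i ∸ s) t₀) (cong suc (m+[n∸m]≡n (≤-trans (m∸n≤m i s) (<⇒≤ i<j))))

  -- Exchanging the two cycles passes to the complementary piece: the two lengths add up to i + j,
  -- so one is i exactly when the other is j.
  crossings-sym : ∀ i j → crossings i j ≡ crossings j i
  crossings-sym i j = trans (∑-swap (upTo (i ∸ 1)) (upTo (j ∸ 1)) _) (∑ᵘ-cong (j ∸ 1) (λ t t<j → ∑ᵘ-cong (i ∸ 1) (λ s s<i →
    ⟨⟩-cong (to (below s<i) (below t<j)) (to (below t<j) (below s<i))
      (((i ∸ suc s) + suc t ℕ.≟ i) ⊎-dec ((i ∸ suc s) + suc t ℕ.≟ j)) (((j ∸ suc t) + suc s ℕ.≟ j) ⊎-dec
        ((j ∸ suc t) + suc s ℕ.≟ i)))))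
    where
    below : ∀ {s i} → s < i ∸ 1 → suc s ≤ i
    below {i = suc i} s<i = <⇒≤ (s≤s s<i)
    shift : ∀ {i s t j} → suc s ≤ i → suc t ≤ j → (i ∸ suc s) + suc t ≡ j → (j ∸ suc t) + suc s ≡ i
    shift {i} {s} {t} s≤i t≤j e = trans (cong (λ z → (z ∸ suc t) + suc s) (sym e))
      (trans (cong (_+ suc s) (m+n∸n≡m (i ∸ suc s) (suc t))) (m∸n+n≡m s≤i))
    level : ∀ {i s t j} → suc s ≤ i → suc t ≤ j → (i ∸ suc s) + suc t ≡ i → (j ∸ suc t) + suc s ≡ j
    level {i} {s} {t} {j} s≤i t≤j e = trans
      (cong ((j ∸ suc t) +_) (sym (+-cancelˡ-≡ (i ∸ suc s) (suc t) (suc s) (trans e (sym (m∸n+n≡m s≤i)))))) (m∸n+n≡m t≤j)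
    to : ∀ {i j s t} → suc s ≤ i → suc t ≤ j → (i ∸ suc s) + suc t ≡ i ⊎ (i ∸ suc s) + suc t ≡ j → (j ∸ suc t) + suc s ≡ j ⊎
      (j ∸ suc t) + suc s ≡ i
    to s≤i t≤j (inj₁ e) = inj₁ (level s≤i t≤j e)
    to s≤i t≤j (inj₂ e) = inj₂ (shift s≤i t≤j e)

module Sums {n} (β : Fin n → Fin n) (injβ : Injective _≡_ _≡_ β) where
  open Twisted β injβ
  open Evaluate β injβ

  private
    pull : ∀ (g : Fin n → Fin n → Fin n → Fin n → ℕ) →
      ∑⁴ (λ a b c d → ⟨ β.other? a b ⟩ * (g a b c d * Z)) ≡ ∑ᶠ
        (λ a → ∑ᶠ (λ b → ⟨ β.other? a b ⟩ * ∑ᶠ (λ c → ∑ᶠ (λ d → g a b c d)))) * Z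
    pull g = trans (∑ᶠ-cong (λ a → trans (∑ᶠ-cong (λ b → trans (∑ᶠ-cong (λ c →
        trans (∑ᶠ-cong (λ d → sym (*-assoc ⟨ β.other? a b ⟩ (g a b c d) Z)))
          (trans (∑ᶠ-*ʳ Z _) (cong (_* Z) (∑ᶠ-*ˡ ⟨ β.other? a b ⟩ (g a b c))))))
        (trans (∑ᶠ-*ʳ Z _) (cong (_* Z) (∑ᶠ-*ˡ ⟨ β.other? a b ⟩ _)))))
        (∑ᶠ-*ʳ Z _)))
      (∑ᶠ-*ʳ Z _)

  -- The 2 is the choice which of `c` and `d` lies on the piece of `a`.
  ∑-p₄ : ∑⁴ (λ a b c d → ⟦ p₄ β injβ a b c d ⟧ * twists β injβ a b c d) ≡
    ∑ᶠ (λ a → ∑ᵘ (β.len a ∸ 1) (λ k → 2 * ((β.len a ∸ suc k ∸ 1) * k))) * Z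
  ∑-p₄ = begin
    ∑⁴ (λ a b c d → ⟦ p₄ β injβ a b c d ⟧ * twists β injβ a b c d) ≡⟨ ∑⁴-cong (λ a b c d → p₄-twists) ⟩
    ∑⁴ (λ a b c d → ⟨ β.other? a b ⟩ * (g a b c d * Z)) ≡⟨ pull g ⟩
    ∑ᶠ (λ a → ∑ᶠ (λ b → ⟨ β.other? a b ⟩ * ∑ᶠ (λ c → ∑ᶠ (λ d → g a b c d)))) * Z ≡⟨ cong (_* Z) (∑ᶠ-cong (λ a → trans
        (∑ᶠ-cong (λ b → cong (⟨ β.other? a b ⟩ *_) (inner a b))) (∑-splits (λ p q _ → 2 * ((p ∸ 1) * (q ∸ 1))) a))) ⟩
    ∑ᶠ (λ a → ∑ᵘ (β.len a ∸ 1) (λ k → 2 * ((β.len a ∸ suc k ∸ 1) * k))) * Z ∎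
    where
    g : Fin n → Fin n → Fin n → Fin n → ℕ
    g a b c d = ⟨ Half.other? a b a c ⟩ * ⟨ Half.other? a b b d ⟩ + ⟨ Half.other? a b b c ⟩ * ⟨ Half.other? a b a d ⟩
    inner : ∀ a b → ∑ᶠ (λ c → ∑ᶠ (λ d → g a b c d)) ≡ 2 * ((Half.len a b a ∸ 1) * (Half.len a b b ∸ 1))
    inner a b = begin
      ∑ᶠ (λ c → ∑ᶠ (λ d → g a b c d)) ≡⟨ trans (∑ᶠ-cong (λ c → ∑ᶠ-+ _ _)) (∑ᶠ-+ _ _) ⟩
      ∑ᶠ (λ c → ∑ᶠ (λ d → A c * B d)) + ∑ᶠ (λ c → ∑ᶠ (λ d → B c * A d)) ≡⟨ cong₂ _+_ (∑-product (allFin n) (allFin n) A B)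
        (∑-product (allFin n) (allFin n) B A) ⟩
      ∑ᶠ A * ∑ᶠ B + ∑ᶠ B * ∑ᶠ A ≡⟨ solve 2 (λ x y → x :* y :+ y :* x := con 2 :* (x :* y)) refl (∑ᶠ A) (∑ᶠ B) ⟩
      2 * (∑ᶠ A * ∑ᶠ B) ≡⟨ cong (2 *_) (cong₂ _*_ (Half.count-other a b a) (Half.count-other a b b)) ⟩
      2 * ((Half.len a b a ∸ 1) * (Half.len a b b ∸ 1)) ∎
      where
      A B : Fin n → ℕ
      A x = ⟨ Half.other? a b a x ⟩
      B x = ⟨ Half.other? a b b x ⟩

  -- The condition that `d` lies off the cycle of `a` is absorbed by truncated subtraction: on a
  -- common cycle the lengths agree and the term is 0.
  ∑-p₃ : ∑⁴ (λ a b c d → ⟦ p₃ β injβ a b c d ⟧ * twists β injβ a b c d) ≡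
    ∑ᶠ (λ d → ∑ᶠ (λ a → 2 * (β.len a ∸ β.len d ∸ 1))) * Z
  ∑-p₃ = begin
    ∑⁴ (λ a b c d → ⟦ p₃ β injβ a b c d ⟧ * twists β injβ a b c d) ≡⟨ ∑⁴-cong (λ a b c d → p₃-twists) ⟩
    ∑⁴ (λ a b c d → ⟨ β.other? a b ⟩ * (g a b c d * Z)) ≡⟨ pull g ⟩
    ∑ᶠ (λ a → ∑ᶠ (λ b → ⟨ β.other? a b ⟩ * ∑ᶠ (λ c → ∑ᶠ (λ d → g a b c d)))) * Z ≡⟨ cong (_* Z) (∑ᶠ-cong (λ a → trans
        (∑ᶠ-cong (λ b → cong (⟨ β.other? a b ⟩ *_) (inner a b))) (trans (∑-splits F a) (outer a)))) ⟩
    ∑ᶠ (λ a → ∑ᶠ (λ d → 2 * (β.len a ∸ β.len d ∸ 1))) * Z ≡⟨ cong (_* Z) (∑ᶠ-swap _) ⟩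
    ∑ᶠ (λ d → ∑ᶠ (λ a → 2 * (β.len a ∸ β.len d ∸ 1))) * Z ∎
    where
    g : Fin n → Fin n → Fin n → Fin n → ℕ
    g a b c d = ⟨ ¬? (β.same? a d) ⟩ * (⟨ Half.other? a b a c ⟩ * ⟨ β.len d ℕ.≟ Half.len a b b ⟩ + ⟨ Half.other? a b b c ⟩ * ⟨
      β.len d ℕ.≟ Half.len a b a ⟩)
    F : ℕ → ℕ → Fin n → ℕ
    F p q a = ∑ᶠ (λ d → ⟨ ¬? (β.same? a d) ⟩ * ((p ∸ 1) * ⟨ β.len d ℕ.≟ q ⟩ + (q ∸ 1) * ⟨ β.len d ℕ.≟ p ⟩))
    inner : ∀ a b → ∑ᶠ (λ c → ∑ᶠ (λ d → g a b c d)) ≡ F (Half.len a b a) (Half.len a b b) a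
    inner a b = trans (∑ᶠ-swap _) (∑ᶠ-cong (λ d → trans (∑ᶠ-*ˡ ⟨ ¬? (β.same? a d) ⟩ _) (cong (⟨ ¬? (β.same? a d) ⟩ *_)
      (trans (∑ᶠ-+ _ _) (cong₂ _+_
        (trans (∑ᶠ-*ʳ ⟨ β.len d ℕ.≟ Half.len a b b ⟩ _) (cong (_* ⟨ β.len d ℕ.≟ Half.len a b b ⟩) (Half.count-other a b a)))
        (trans (∑ᶠ-*ʳ ⟨ β.len d ℕ.≟ Half.len a b a ⟩ _) (cong (_* ⟨ β.len d ℕ.≟ Half.len a b a ⟩)
          (Half.count-other a b b))))))))
    outer : ∀ a → ∑ᵘ (β.len a ∸ 1) (λ k → F (β.len a ∸ suc k) (suc k) a) ≡ ∑ᶠ (λ d → 2 * (β.len a ∸ β.len d ∸ 1))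
    outer a = trans (∑-swap (upTo (β.len a ∸ 1)) (allFin n) _)
      (∑ᶠ-cong (λ d → trans (∑-*ˡ (upTo (β.len a ∸ 1)) ⟨ ¬? (β.same? a d) ⟩ _)
      (trans (cong (⟨ ¬? (β.same? a d) ⟩ *_) (∑-split-31 (β.len a) (β.len d) (β.len>0 d)))
        (⟨⟩-case (¬? (β.same? a d)) (λ _ → refl)
          (λ ¬¬s → sym (cong (2 *_) (cong (_∸ 1) (trans (cong (_∸ β.len d) (β.len-Same (decidable-stable (β.same? a d) ¬¬s)))
          (n∸n≡0 (β.len d))))))))))

  ∑-p₂ : ∑⁴ (λ a b c d → ⟦ p₂ β injβ a b c d ⟧ * twists β injβ a b c d) ≡
    ∑ᶠ (λ a → ∑ᶠ (λ b → ⟨ ¬? (β.same? a b) ⟩ * crossings (β.len a) (β.len b))) * Z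
  ∑-p₂ = begin
    ∑⁴ (λ a b c d → ⟦ p₂ β injβ a b c d ⟧ * twists β injβ a b c d) ≡⟨ ∑⁴-cong (λ a b c d → p₂-twists) ⟩
    ∑⁴ (λ a b c d → ⟨ ¬? (β.same? a b) ⟩ * (⟨ β.other? a c ⟩ * (⟨ β.other? b d ⟩ * r a b c d)) * Z)
      ≡⟨ trans (∑ᶠ-cong (λ a → trans (∑ᶠ-cong (λ b → trans (∑ᶠ-cong (λ c → ∑ᶠ-*ʳ Z _)) (∑ᶠ-*ʳ Z _))) (∑ᶠ-*ʳ Z _))) (∑ᶠ-*ʳ Z _) ⟩
    ∑⁴ (λ a b c d → ⟨ ¬? (β.same? a b) ⟩ * (⟨ β.other? a c ⟩ * (⟨ β.other? b d ⟩ * r a b c d))) * Z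
      ≡⟨ cong (_* Z) (∑ᶠ-cong (λ a → ∑ᶠ-cong
        (λ b → trans (∑ᶠ-cong (λ c → trans (∑ᶠ-*ˡ ⟨ ¬? (β.same? a b) ⟩ _) (cong (⟨ ¬? (β.same? a b) ⟩ *_)
        (∑ᶠ-*ˡ ⟨ β.other? a c ⟩ _))))
           (trans (∑ᶠ-*ˡ ⟨ ¬? (β.same? a b) ⟩ _) (⟨⟩-guard (¬? (β.same? a b)) (inner a b)))))) ⟩
    ∑ᶠ (λ a → ∑ᶠ (λ b → ⟨ ¬? (β.same? a b) ⟩ * crossings (β.len a) (β.len b))) * Z ∎
    where
    r : Fin n → Fin n → Fin n → Fin n → ℕ
    r a b c d = ⟨ (Full.len a b c d d ℕ.≟ β.len a) ⊎-dec (Full.len a b c d d ℕ.≟ β.len b) ⟩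
    below : ∀ a {k} → k < β.len a ∸ 1 → suc k < β.len a
    below a {k} k<L = subst (suc k <_) (m+[n∸m]≡n (β.len>0 a)) (s≤s k<L)
    inner : ∀ a b → ¬ Same β a b → ∑ᶠ (λ c → ⟨ β.other? a c ⟩ * ∑ᶠ (λ d → ⟨ β.other? b d ⟩ * r a b c d)) ≡ crossings (β.len a)
      (β.len b)
    inner a b a≁b = trans (β.∑-other (β.period-pred a) (λ c → ∑ᶠ (λ d → ⟨ β.other? b d ⟩ * r a b c d)))
      (∑ᵘ-cong (β.len a ∸ 1) (λ s s<A →
      trans (β.∑-other (β.period-pred b) (r a b (iter β (suc s) a))) (∑ᵘ-cong (β.len b ∸ 1) (λ t t<B →
        cong (λ l → ⟨ (l ℕ.≟ β.len a) ⊎-dec (l ℕ.≟ β.len b) ⟩) (merge-split-length a≁b (below a s<A) (below b t<B))))))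

  -- For fixed `c` and `d`, the point `a` runs over all points on cycles of length
  -- `β.len c + β.len d`, and `b` over the cuts counted by `∑-split-211`.
  ∑-p₁ : ∑⁴ (λ a b c d → ⟦ p₁ β injβ a b c d ⟧ * twists β injβ a b c d) ≡
    ∑ᶠ (λ c → ∑ᶠ (λ d → ⟨ ¬? (β.same? c d) ⟩ * ((β.len c + β.len d) * β.count (β.len c + β.len d) *
      (1 + ⟨ ¬? (β.len c ℕ.≟ β.len d) ⟩)))) * Z
  ∑-p₁ = begin
    ∑⁴ (λ a b c d → ⟦ p₁ β injβ a b c d ⟧ * twists β injβ a b c d) ≡⟨ ∑⁴-cong (λ a b c d → p₁-twists) ⟩
    ∑⁴ (λ a b c d → ⟨ β.other? a b ⟩ * (g a b c d * Z)) ≡⟨ pull g ⟩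
    ∑ᶠ (λ a → ∑ᶠ (λ b → ⟨ β.other? a b ⟩ * F (Half.len a b a) (Half.len a b b) a)) * Z ≡⟨ cong (_* Z)
      (∑ᶠ-cong (λ a → trans (∑-splits F a) (outer a))) ⟩
    ∑ᶠ (λ a → ∑ᶠ (λ c → ∑ᶠ (λ d → ⟨ β.len a ℕ.≟ β.len c + β.len d ⟩ * h c d))) * Z ≡⟨ cong (_* Z)
      (trans (∑ᶠ-swap _) (∑ᶠ-cong (λ c → ∑ᶠ-swap _))) ⟩
    ∑ᶠ (λ c → ∑ᶠ (λ d → ∑ᶠ (λ a → ⟨ β.len a ℕ.≟ β.len c + β.len d ⟩ * h c d))) * Z ≡⟨ cong (_* Z)
      (∑ᶠ-cong (λ c → ∑ᶠ-cong (λ d → trans (∑ᶠ-*ʳ (h c d) _)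
        (trans (cong (_* h c d) (β.points-count (β.len c + β.len d))) (solve 3 (λ m x y → m :* (x :* y) := x :* (m :* y)) refl
          (m c d) ⟨ ¬? (β.same? c d) ⟩ (1 + ⟨ ¬? (β.len c ℕ.≟ β.len d) ⟩)))))) ⟩
    ∑ᶠ (λ c → ∑ᶠ (λ d → ⟨ ¬? (β.same? c d) ⟩ * (m c d * (1 + ⟨ ¬? (β.len c ℕ.≟ β.len d) ⟩)))) * Z ∎
    where
    m : Fin n → Fin n → ℕ
    m c d = (β.len c + β.len d) * β.count (β.len c + β.len d)
    h : Fin n → Fin n → ℕ
    h c d = ⟨ ¬? (β.same? c d) ⟩ * (1 + ⟨ ¬? (β.len c ℕ.≟ β.len d) ⟩)
    g : Fin n → Fin n → Fin n → Fin n → ℕ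
    g a b c d = ⟨ ¬? (β.same? c d) ⟩ * (⟨ β.len a ℕ.≟ β.len c + β.len d ⟩ * ⟨ (β.len c ℕ.≟ Half.len a b a) ⊎-dec
      (β.len c ℕ.≟ Half.len a b b) ⟩)
    F : ℕ → ℕ → Fin n → ℕ
    F p q a = ∑ᶠ (λ c → ∑ᶠ (λ d → ⟨ ¬? (β.same? c d) ⟩ * (⟨ β.len a ℕ.≟ β.len c + β.len d ⟩ * ⟨ (β.len c ℕ.≟ p) ⊎-dec
      (β.len c ℕ.≟ q) ⟩)))
    position : ∀ a c d → β.len a ≡ β.len c + β.len d → ∑ᵘ (β.len a ∸ 1) (λ k → ⟨ (β.len c ℕ.≟ β.len a ∸ suc k) ⊎-dec
      (β.len c ℕ.≟ suc k) ⟩) ≡ 1 + ⟨ ¬? (β.len c ℕ.≟ β.len d) ⟩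
    position a c d e = trans (cong (λ L → ∑ᵘ (L ∸ 1) (λ k → ⟨ (β.len c ℕ.≟ L ∸ suc k) ⊎-dec (β.len c ℕ.≟ suc k) ⟩)) e)
      (∑-split-211 (β.len c) (β.len d) (β.len>0 c) (β.len>0 d))
    outer : ∀ a → ∑ᵘ (β.len a ∸ 1) (λ k → F (β.len a ∸ suc k) (suc k) a) ≡ ∑ᶠ (λ c → ∑ᶠ (λ d → ⟨ β.len a ℕ.≟ β.len c + β.len d ⟩
      * h c d))
    outer a = trans (∑-swap (upTo (β.len a ∸ 1)) (allFin n) _) (∑ᶠ-cong (λ c → trans (∑-swap (upTo (β.len a ∸ 1)) (allFin n) _)
      (∑ᶠ-cong (λ d →
      trans (∑-*ˡ (upTo (β.len a ∸ 1)) ⟨ ¬? (β.same? c d) ⟩ _)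
        (trans (cong (⟨ ¬? (β.same? c d) ⟩ *_) (trans (∑-*ˡ (upTo (β.len a ∸ 1)) ⟨ β.len a ℕ.≟ β.len c + β.len d ⟩ _)
        (⟨⟩-guard (β.len a ℕ.≟ β.len c + β.len d) (position a c d))))
        (solve 3 (λ x y z → x :* (y :* z) := y :* (x :* z)) refl ⟨ ¬? (β.same? c d) ⟩ ⟨ β.len a ℕ.≟ β.len c + β.len d ⟩
          (1 + ⟨ ¬? (β.len c ℕ.≟ β.len d) ⟩)))))))

-- Binomial identities

-- The absorption identity, by induction along Pascal's rule.
C-absorb : ∀ n k → suc k * (suc n C suc k) ≡ suc n * (n C k)
C-absorb zero zero = refl
C-absorb zero (suc k) = trans (cong (suc (suc k) *_) (k>n⇒nCk≡0 {1} {suc (suc k)} (s≤s (s≤s z≤n))))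
  (trans (*-zeroʳ (suc (suc k))) (cong (1 *_) (sym (k>n⇒nCk≡0 {0} {suc k} (s≤s z≤n)))))
C-absorb (suc n) zero = trans (*-identityˡ _) (trans (nC1≡n (suc (suc n))) (sym (*-identityʳ (suc (suc n)))))
C-absorb (suc n) (suc k) = begin
  suc (suc k) * (suc (suc n) C suc (suc k)) ≡⟨ cong (suc (suc k) *_) (nCk+nC[k+1]≡[n+1]C[k+1] (suc n) (suc k)) ⟨
  suc (suc k) * (x + suc n C suc (suc k)) ≡⟨ *-distribˡ-+ (suc (suc k)) x _ ⟩
  suc (suc k) * x + suc (suc k) * (suc n C suc (suc k)) ≡⟨ cong₂ (λ u v → x + u + v) (C-absorb n k) (C-absorb n (suc k)) ⟩
  x + suc n * (n C k) + suc n * (n C suc k) ≡⟨ trans (+-assoc x _ _)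
    (cong (x +_) (sym (*-distribˡ-+ (suc n) (n C k) (n C suc k)))) ⟩
  x + suc n * (n C k + n C suc k) ≡⟨ cong (λ y → x + suc n * y) (nCk+nC[k+1]≡[n+1]C[k+1] n k) ⟩
  suc (suc n) * x ∎
  where x = suc n C suc k

C2-twice : ∀ n → 2 * (n C 2) ≡ n * (n ∸ 1)
C2-twice zero    = refl
C2-twice (suc n) = trans (C-absorb n 1) (cong (suc n *_) (nC1≡n n))

square-C2 : ∀ n → n * n ≡ n + 2 * (n C 2)
square-C2 zero    = refl
square-C2 (suc n) = trans (*-suc (suc n) n) (cong (suc n +_) (sym (C2-twice (suc n))))

∑ᵘ-snoc : ∀ n f → ∑ᵘ (suc n) f ≡ ∑ᵘ n f + f n
∑ᵘ-snoc zero f = trans (∑ᵘ-suc 0 f) (trans (cong (f 0 +_) (∑-def [] _)) (trans (+-identityʳ (f 0))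
  (cong (_+ f 0) (sym (∑-def [] f)))))
∑ᵘ-snoc (suc n) f = trans (∑ᵘ-suc (suc n) f) (trans (cong (f 0 +_) (∑ᵘ-snoc n (f ∘ suc))) (trans (sym (+-assoc (f 0) _ _))
  (cong (_+ f (suc n)) (sym (∑ᵘ-suc n f)))))

∑-id-C2 : ∀ n → ∑ᵘ n id ≡ n C 2
∑-id-C2 zero    = ∑-def [] id
∑-id-C2 (suc n) = trans (∑ᵘ-snoc n id) (trans (cong₂ _+_ (∑-id-C2 n) (sym (nC1≡n n))) (trans (+-comm (n C 2) _)
  (nCk+nC[k+1]≡[n+1]C[k+1] n 1)))

-- Three-element subsets sorted by their middle element, with k elements below it and n - k - 1
-- above.
∑-C3 : ∀ n → ∑ᵘ n (λ k → (n ∸ k ∸ 1) * k) ≡ n C 3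
∑-C3 zero    = ∑-def [] _
∑-C3 (suc n) = begin
  ∑ᵘ (suc n) (λ k → (suc n ∸ k ∸ 1) * k) ≡⟨ ∑ᵘ-snoc n _ ⟩
  ∑ᵘ n (λ k → (suc n ∸ k ∸ 1) * k) + (suc n ∸ n ∸ 1) * n ≡⟨ cong₂ _+_ (∑ᵘ-cong n step) (cong (λ z → (z ∸ 1) * n)
    (m+n∸n≡m 1 n)) ⟩
  ∑ᵘ n (λ k → k + (n ∸ k ∸ 1) * k) + 0 ≡⟨ trans (+-identityʳ _) (∑-+ (upTo n) _ _) ⟩
  ∑ᵘ n id + ∑ᵘ n (λ k → (n ∸ k ∸ 1) * k) ≡⟨ cong₂ _+_ (∑-id-C2 n) (∑-C3 n) ⟩
  n C 2 + n C 3 ≡⟨ nCk+nC[k+1]≡[n+1]C[k+1] n 2 ⟩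
  suc n C 3 ∎
  where
  step : ∀ k → k < n → (suc n ∸ k ∸ 1) * k ≡ k + (n ∸ k ∸ 1) * k
  step k k<n = cong (_* k) (trans (cong (_∸ 1) (+-∸-assoc 1 (<⇒≤ k<n))) (sym (m+[n∸m]≡n (m<n⇒0<n∸m k<n))))

-- Absorption turns i times the binomial of i - 1 over 3 into 4 times that of i over 4; with the 2
-- this makes the 8 that cancels in `cPart-4`.
∑-C4 : ∀ i → i * ∑ᵘ (i ∸ 1) (λ k → 2 * ((i ∸ suc k ∸ 1) * k)) ≡ 8 * (i C 4)
∑-C4 zero    = refl
∑-C4 (suc n) = begin
  suc n * ∑ᵘ n (λ k → 2 * ((n ∸ k ∸ 1) * k)) ≡⟨ cong (suc n *_) (trans (∑-*ˡ (upTo n) 2 _) (cong (2 *_) (∑-C3 n))) ⟩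
  suc n * (2 * (n C 3)) ≡⟨ solve 2 (λ m c → m :* (con 2 :* c) := con 2 :* (m :* c)) refl (suc n) (n C 3) ⟩
  2 * (suc n * (n C 3)) ≡⟨ cong (2 *_) (C-absorb n 3) ⟨
  2 * (4 * (suc n C 4)) ≡⟨ *-assoc 2 4 (suc n C 4) ⟨
  8 * (suc n C 4) ∎

-- Sums over cycle lengths

-- With the lower bound turned into an indicator, all sums share one index range; the guard can then
-- be dropped wherever the terms below it vanish.
sumFromTo-∑ : ∀ lo hi f → sumFromTo lo hi f ≡ ∑ᵘ (suc hi) (λ i → ⟨ lo ≤? i ⟩ * f i)
sumFromTo-∑ lo hi f = trans (sym (∑-def (upTo (suc hi ∸ lo)) _)) (restrict (suc hi) lo f)
  where
  restrict : ∀ N lo (f : ℕ → ℕ) → ∑ᵘ (N ∸ lo) (λ t → f (lo + t)) ≡ ∑ᵘ N (λ i → ⟨ lo ≤? i ⟩ * f i)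
  restrict N       zero     f = ∑-cong (upTo N) (λ i → sym (trans (cong (_* f i) (⟨⟩-yes (0 ≤? i) z≤n)) (*-identityˡ (f i))))
  restrict zero    (suc lo) f = trans (∑-def [] _) (sym (∑-def [] _))
  restrict (suc N) (suc lo) f = trans (restrict N lo (f ∘ suc))
    (sym (trans (∑ᵘ-suc N _) (∑-cong (upTo N) (λ i → cong (_* f (suc i)) (⟨⟩-cong ≤-pred s≤s (suc lo ≤? suc i) (lo ≤? i))))))

drop-guard : ∀ {P : Set} (p? : Dec P) {x} → (¬ P → x ≡ 0) → ⟨ p? ⟩ * x ≡ x
drop-guard p? h = ⟨⟩-case p? (λ _ → refl) (λ ¬p → sym (h ¬p))

module ByLength {n} (β : Fin n → Fin n) (injβ : Injective _≡_ _≡_ β) where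
  private module β = Cycles β injβ

  c : ℕ → ℕ
  c = cycleCount β

  Σ : (ℕ → ℕ) → ℕ
  Σ = ∑ᵘ (suc n)

  Σ-cong : ∀ {f g} → f ≗ g → Σ f ≡ Σ g
  Σ-cong = ∑-cong (upTo (suc n))

  ∑-length : ∀ F → ∑ᶠ (λ x → F (β.len x)) ≡ Σ (λ i → i * c i * F i)
  ∑-length F = begin
    ∑ᶠ (λ x → F (β.len x)) ≡⟨ ∑ᶠ-cong (λ x → ∑ᵘ-δ F (s≤s (β.len≤n x))) ⟨
    ∑ᶠ (λ x → Σ (λ i → ⟨ i ℕ.≟ β.len x ⟩ * F i)) ≡⟨ ∑-swap (allFin n) (upTo (suc n)) _ ⟩
    Σ (λ i → ∑ᶠ (λ x → ⟨ i ℕ.≟ β.len x ⟩ * F i)) ≡⟨ Σ-cong (λ i → trans (∑ᶠ-*ʳ (F i) _) (cong (_* F i) (trans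
            (∑ᶠ-cong (λ x → ⟨⟩-cong sym sym (i ℕ.≟ β.len x) (β.len x ℕ.≟ i))) (trans (β.points-count i)
              (cong (i *_) (β.count-def i)))))) ⟩
    Σ (λ i → i * c i * F i) ∎

  Σ-symmetric : ∀ (M : ℕ → ℕ → ℕ) → (∀ i j → M i j ≡ M j i) → Σ (λ i → Σ (M i)) ≡ Σ (λ i → M i i) + 2 * Σ
    (λ i → Σ (λ j → ⟨ i <? j ⟩ * M i j))
  Σ-symmetric M M-sym = begin
    Σ (λ i → Σ (M i))
      ≡⟨ Σ-cong (λ i → trans (∑ᵘ-cong (suc n) (λ j _ → trichotomy i j)) (trans (∑-+ (upTo (suc n)) _ _)
        (cong (Σ (λ j → ⟨ j ℕ.≟ i ⟩ * M i j) +_) (∑-+ (upTo (suc n)) _ _)))) ⟩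
    Σ (λ i → Σ (λ j → ⟨ j ℕ.≟ i ⟩ * M i j) + (Σ (λ j → ⟨ i <? j ⟩ * M i j) + Σ (λ j → ⟨ j <? i ⟩ * M i j)))
      ≡⟨ trans (∑-+ (upTo (suc n)) _ _) (cong₂ _+_ (∑ᵘ-cong (suc n) (λ i i<N → ∑ᵘ-δ (M i) i<N)) (∑-+ (upTo (suc n)) _ _)) ⟩
    Σ (λ i → M i i) + (upper + Σ (λ i → Σ (λ j → ⟨ j <? i ⟩ * M i j)))
      ≡⟨ cong (λ z → Σ (λ i → M i i) + (upper + z)) (trans (∑-swap (upTo (suc n)) (upTo (suc n)) _)
        (trans (Σ-cong (λ j → Σ-cong (λ i → cong (⟨ j <? i ⟩ *_) (M-sym i j)))) (sym (+-identityʳ upper)))) ⟩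
    Σ (λ i → M i i) + 2 * upper ∎
    where
    upper = Σ (λ i → Σ (λ j → ⟨ i <? j ⟩ * M i j))
    trichotomy : ∀ i j → M i j ≡ ⟨ j ℕ.≟ i ⟩ * M i j + (⟨ i <? j ⟩ * M i j + ⟨ j <? i ⟩ * M i j)
    trichotomy i j = trans (sym (*-identityˡ (M i j))) (trans (cong (_* M i j) one)
      (solve 4 (λ x y z m → (x :+ (y :+ z)) :* m := x :* m :+ (y :* m :+ z :* m)) refl ⟨ j ℕ.≟ i ⟩ ⟨ i <? j ⟩ ⟨ j <? i ⟩
      (M i j)))
      where
      one : 1 ≡ ⟨ j ℕ.≟ i ⟩ + (⟨ i <? j ⟩ + ⟨ j <? i ⟩)
      one = helper (<-cmp i j)
        where
        helper : Tri (i < j) (i ≡ j) (j < i) → 1 ≡ ⟨ j ℕ.≟ i ⟩ + (⟨ i <? j ⟩ + ⟨ j <? i ⟩)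
        helper (tri< p ¬q ¬r) = sym (cong₂ _+_ (⟨⟩-no (j ℕ.≟ i) (¬q ∘ sym)) (cong₂ _+_ (⟨⟩-yes (i <? j) p) (⟨⟩-no (j <? i) ¬r)))
        helper (tri≈ ¬p q ¬r) = sym (cong₂ _+_ (⟨⟩-yes (j ℕ.≟ i) (sym q)) (cong₂ _+_ (⟨⟩-no (i <? j) ¬p) (⟨⟩-no (j <? i) ¬r)))
        helper (tri> ¬p ¬q r) = sym (cong₂ _+_ (⟨⟩-no (j ℕ.≟ i) (¬q ∘ sym)) (cong₂ _+_ (⟨⟩-no (i <? j) ¬p) (⟨⟩-yes (j <? i) r)))

  -- Ordered pairs of points in distinct cycles: i²·c(c − 1) of them have both lengths equal to i.
  ∑-separate : ∀ (K : ℕ → ℕ → ℕ) → (∀ i j → K i j ≡ K j i) →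
    ∑ᶠ (λ x → ∑ᶠ (λ y → ⟨ ¬? (β.same? x y) ⟩ * K (β.len x) (β.len y))) ≡
    2 * (Σ (λ i → i * i * (c i C 2) * K i i) + Σ (λ i → Σ (λ j → ⟨ i <? j ⟩ * (i * c i * (j * c j * K i j)))))
  ∑-separate K K-sym = +-cancelʳ-≡ together _ _ (begin
    apart + together
      ≡⟨ trans (sym (∑ᶠ-+ _ _)) (∑ᶠ-cong (λ x → trans (sym (∑ᶠ-+ _ _)) (∑ᶠ-cong (λ y → combine x y)))) ⟩
    ∑ᶠ (λ x → ∑ᶠ (λ y → K (β.len x) (β.len y)))
      ≡⟨ trans (∑ᶠ-cong (λ x → ∑-length (K (β.len x)))) (∑-length (λ i → Σ (λ j → j * c j * K i j))) ⟩
    Σ (λ i → i * c i * Σ (λ j → j * c j * K i j))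
      ≡⟨ Σ-cong (λ i → sym (∑-*ˡ (upTo (suc n)) (i * c i) _)) ⟩
    Σ (λ i → Σ (M i))
      ≡⟨ Σ-symmetric M M-sym ⟩
    Σ (λ i → M i i) + 2 * upper
      ≡⟨ cong (_+ 2 * upper) (trans (Σ-cong diagonal) (trans (∑-+ (upTo (suc n)) _ _) (cong₂ _+_ (∑-*ˡ (upTo (suc n)) 2 _)
        (sym together≡)))) ⟩
    2 * diag + together + 2 * upper
      ≡⟨ solve 3 (λ d t u → con 2 :* d :+ t :+ con 2 :* u := con 2 :* (d :+ u) :+ t) refl diag together upper ⟩
    2 * (diag + upper) + together ∎)
    where
    M : ℕ → ℕ → ℕ
    M i j = i * c i * (j * c j * K i j)
    M-sym : ∀ i j → M i j ≡ M j i
    M-sym i j = trans (cong (λ k → i * c i * (j * c j * k)) (K-sym i j)) (solve 3 (λ x y k → x :* (y :* k) := y :* (x :* k))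
      refl (i * c i) (j * c j) (K j i))
    diag = Σ (λ i → i * i * (c i C 2) * K i i)
    upper = Σ (λ i → Σ (λ j → ⟨ i <? j ⟩ * M i j))
    apart = ∑ᶠ (λ x → ∑ᶠ (λ y → ⟨ ¬? (β.same? x y) ⟩ * K (β.len x) (β.len y)))
    together = ∑ᶠ (λ x → ∑ᶠ (λ y → ⟨ β.same? x y ⟩ * K (β.len x) (β.len y)))
    together≡ : together ≡ Σ (λ i → i * c i * (i * K i i))
    together≡ = trans (∑ᶠ-cong (λ x → trans
      (∑ᶠ-cong (λ y → ⟨⟩-guard (β.same? x y) (λ s → cong (K (β.len x)) (sym (β.len-Same s)))))
      (trans (∑ᶠ-*ʳ (K (β.len x) (β.len x)) _) (cong (_* K (β.len x) (β.len x)) (sym (β.len-∑ x))))))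
        (∑-length (λ i → i * K i i))
    combine : ∀ x y → ⟨ ¬? (β.same? x y) ⟩ * K (β.len x) (β.len y) + ⟨ β.same? x y ⟩ * K (β.len x) (β.len y) ≡ K (β.len x)
      (β.len y)
    combine x y = trans (sym (*-distribʳ-+ (K (β.len x) (β.len y)) ⟨ ¬? (β.same? x y) ⟩ _))
      (trans (cong (_* K (β.len x) (β.len y)) (⟨⟩-¬ (β.same? x y))) (*-identityˡ _))
    -- The square of `c i` is `c i`, which gives back the pairs on a common cycle, plus twice the
    -- binomial, which counts ordered pairs of different cycles.
    diagonal : ∀ i → M i i ≡ 2 * (i * i * (c i C 2) * K i i) + i * c i * (i * K i i)
    diagonal i = begin
      i * c i * (i * c i * K i i) ≡⟨ solve 3 (λ i c k → i :* c :* (i :* c :* k) := i :* i :* k :* (c :* c)) refl i (c i)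
        (K i i) ⟩
      i * i * K i i * (c i * c i) ≡⟨ cong (i * i * K i i *_) (square-C2 (c i)) ⟩
      i * i * K i i * (c i + 2 * (c i C 2)) ≡⟨ solve 4 (λ i c k d → i :* i :* k :* (c :+ con 2 :* d) := con 2 :*
        (i :* i :* d :* k) :+ i :* c :* (i :* k)) refl i (c i) (K i i) (c i C 2) ⟩
      2 * (i * i * (c i C 2) * K i i) + i * c i * (i * K i i) ∎

  open Twisted β injβ using (Z)
  open Evaluate β injβ using (split₂-zero; merge₂-zero)
  open Patterns β injβ split₂-zero merge₂-zero public
  open Sums β injβ

  cPart-4 : cPart (4 ∷ []) β ≡ Z * sumFromTo 4 n (λ i → c i * (i C 4))
  cPart-4 = *-cancelˡ-≡ _ _ 8 (begin
    8 * cPart (4 ∷ []) β ≡⟨ trans weight-4 ∑-p₄ ⟩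
    ∑ᶠ (λ a → T₄ (β.len a)) * Z ≡⟨ cong (_* Z) (∑-length T₄) ⟩
    Σ (λ i → i * c i * T₄ i) * Z ≡⟨ cong (_* Z) (trans (Σ-cong term) (∑-*ˡ (upTo (suc n)) 8 _)) ⟩
    8 * Σ (λ i → ⟨ 4 ≤? i ⟩ * (c i * (i C 4))) * Z ≡⟨ solve 2 (λ s z → con 8 :* s :* z := con 8 :* (z :* s)) refl
      (Σ (λ i → ⟨ 4 ≤? i ⟩ * (c i * (i C 4)))) Z ⟩
    8 * (Z * Σ (λ i → ⟨ 4 ≤? i ⟩ * (c i * (i C 4)))) ≡⟨ cong (λ x → 8 * (Z * x)) (sumFromTo-∑ 4 n _) ⟨
    8 * (Z * sumFromTo 4 n (λ i → c i * (i C 4))) ∎)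
    where
    T₄ : ℕ → ℕ
    T₄ i = ∑ᵘ (i ∸ 1) (λ k → 2 * ((i ∸ suc k ∸ 1) * k))
    term : ∀ i → i * c i * T₄ i ≡ 8 * (⟨ 4 ≤? i ⟩ * (c i * (i C 4)))
    term i = begin
      i * c i * T₄ i ≡⟨ solve 3 (λ i c t → i :* c :* t := c :* (i :* t)) refl i (c i) (T₄ i) ⟩
      c i * (i * T₄ i) ≡⟨ cong (c i *_) (∑-C4 i) ⟩
      c i * (8 * (i C 4)) ≡⟨ solve 2 (λ c b → c :* (con 8 :* b) := con 8 :* (c :* b)) refl (c i) (i C 4) ⟩
      8 * (c i * (i C 4)) ≡⟨ cong (8 *_) (drop-guard (4 ≤? i) (λ 4≰i → trans (cong (c i *_) (k>n⇒nCk≡0 (≰⇒> 4≰i)))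
        (*-zeroʳ (c i)))) ⟨
      8 * (⟨ 4 ≤? i ⟩ * (c i * (i C 4))) ∎

  -- Here 8 is 4 relabellings times the 2 cuts of `∑-split-31`.
  cPart-31 : cPart (3 ∷ 1 ∷ []) β ≡ Z * sumFromTo 1 n (λ i → sumFromTo (i + 2) n (λ j → i * j * (j ∸ i ∸ 1) * c i * c j))
  cPart-31 = *-cancelˡ-≡ _ _ 8 (begin
    8 * cPart (3 ∷ 1 ∷ []) β ≡⟨ trans weight-31 (cong (4 *_) ∑-p₃) ⟩
    4 * (∑ᶠ (λ d → ∑ᶠ (λ a → 2 * (β.len a ∸ β.len d ∸ 1))) * Z) ≡⟨ cong (λ x → 4 * (x * Z))
      (trans (∑ᶠ-cong (λ d → ∑-length (λ j → 2 * (j ∸ β.len d ∸ 1))))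
            (∑-length (λ i → Σ (λ j → j * c j * (2 * (j ∸ i ∸ 1)))))) ⟩
    4 * (Σ (λ i → i * c i * Σ (λ j → j * c j * (2 * (j ∸ i ∸ 1)))) * Z) ≡⟨ cong (λ x → 4 * (x * Z))
      (trans (Σ-cong row) (∑-*ˡ (upTo (suc n)) 2 _)) ⟩
    4 * (2 * Σ (λ i → ⟨ 1 ≤? i ⟩ * inner i) * Z) ≡⟨ solve 2 (λ s z → con 4 :* (con 2 :* s :* z) := con 8 :* (z :* s)) refl
      (Σ (λ i → ⟨ 1 ≤? i ⟩ * inner i)) Z ⟩
    8 * (Z * Σ (λ i → ⟨ 1 ≤? i ⟩ * inner i)) ≡⟨ cong (λ x → 8 * (Z * x)) (sumFromTo-∑ 1 n inner) ⟨
    8 * (Z * sumFromTo 1 n inner) ∎)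
    where
    f : ℕ → ℕ → ℕ
    f i j = i * j * (j ∸ i ∸ 1) * c i * c j
    inner : ℕ → ℕ
    inner i = sumFromTo (i + 2) n (f i)
    f-zero : ∀ i j → ¬ (i + 2 ≤ j) → f i j ≡ 0
    f-zero i j h = cong (λ x → x * c i * c j)
      (trans (cong (i * j *_) (trans (∸-+-assoc j i 1) (m≤n⇒m∸n≡0 (≤-pred (subst (suc j ≤_) (+-suc i 1) (≰⇒> h))))))
      (*-zeroʳ (i * j)))
    row : ∀ i → i * c i * Σ (λ j → j * c j * (2 * (j ∸ i ∸ 1))) ≡ 2 * (⟨ 1 ≤? i ⟩ * inner i)
    row i = begin
      i * c i * Σ (λ j → j * c j * (2 * (j ∸ i ∸ 1))) ≡⟨ ∑-*ˡ (upTo (suc n)) (i * c i) _ ⟨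
      Σ (λ j → i * c i * (j * c j * (2 * (j ∸ i ∸ 1)))) ≡⟨ Σ-cong
        (λ j → trans (solve 5 (λ i x j y d → i :* x :* (j :* y :* (con 2 :* d)) := con 2 :* (i :* j :* d :* x :* y)) refl i
        (c i) j (c j) (j ∸ i ∸ 1))
            (cong (2 *_) (sym (drop-guard (i + 2 ≤? j) (f-zero i j))))) ⟩
      Σ (λ j → 2 * (⟨ i + 2 ≤? j ⟩ * f i j)) ≡⟨ trans (∑-*ˡ (upTo (suc n)) 2 _)
        (cong (2 *_) (sym (sumFromTo-∑ (i + 2) n (f i)))) ⟩
      2 * inner i ≡⟨ cong (2 *_) (drop-guard (1 ≤? i) (inner-zero i)) ⟨
      2 * (⟨ 1 ≤? i ⟩ * inner i) ∎
      where
      inner-zero : ∀ i → ¬ (1 ≤ i) → inner i ≡ 0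
      inner-zero zero    _ = trans (sumFromTo-∑ 2 n (f 0)) (∑-zero (upTo (suc n)) (λ j → *-zeroʳ ⟨ 2 ≤? j ⟩))
      inner-zero (suc i) h = contradiction (s≤s z≤n) h

  -- The common end of [2,2] and [2,1,1]. One factor 2 comes from ordering the two cycles and one is
  -- extracted from `K` by the hypotheses; the 2 of `weight-22` or `weight-211` completes the 8.
  pair-sum : ∀ (K : ℕ → ℕ → ℕ) (lo : ℕ) (d : ℕ → ℕ) (f : ℕ → ℕ → ℕ) →
    (∀ i → i * i * (c i C 2) * K i i ≡ 2 * (⟨ lo ≤? i ⟩ * d i)) →
    (∀ i j → i < j → i * c i * (j * c j * K i j) ≡ 2 * (⟨ lo ≤? i ⟩ * f i j)) →
    2 * (Σ (λ i → i * i * (c i C 2) * K i i) + Σ (λ i → Σ (λ j → ⟨ i <? j ⟩ * (i * c i * (j * c j * K i j))))) ≡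
    4 * (sumFromTo lo n d + sumFromTo lo n (λ i → sumFromTo (i + 1) n (f i)))
  pair-sum K lo d f on-diag off-diag = begin
    2 * (Σ (λ i → i * i * (c i C 2) * K i i) + Σ (λ i → Σ (λ j → ⟨ i <? j ⟩ * (i * c i * (j * c j * K i j)))))
      ≡⟨ cong (2 *_) (cong₂ _+_ (trans (Σ-cong on-diag) (∑-*ˡ (upTo (suc n)) 2 _))
        (trans (Σ-cong row) (∑-*ˡ (upTo (suc n)) 2 _))) ⟩
    2 * (2 * Σ (λ i → ⟨ lo ≤? i ⟩ * d i) + 2 * Σ (λ i → ⟨ lo ≤? i ⟩ * sumFromTo (i + 1) n (f i)))
      ≡⟨ solve 2 (λ x y → con 2 :* (con 2 :* x :+ con 2 :* y) := con 4 :* (x :+ y)) refl (Σ (λ i → ⟨ lo ≤? i ⟩ * d i))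
        (Σ (λ i → ⟨ lo ≤? i ⟩ * sumFromTo (i + 1) n (f i))) ⟩
    4 * (Σ (λ i → ⟨ lo ≤? i ⟩ * d i) + Σ (λ i → ⟨ lo ≤? i ⟩ * sumFromTo (i + 1) n (f i)))
      ≡⟨ cong (4 *_) (cong₂ _+_ (sumFromTo-∑ lo n d) (sumFromTo-∑ lo n (λ i → sumFromTo (i + 1) n (f i)))) ⟨
    4 * (sumFromTo lo n d + sumFromTo lo n (λ i → sumFromTo (i + 1) n (f i))) ∎
    where
    row : ∀ i → Σ (λ j → ⟨ i <? j ⟩ * (i * c i * (j * c j * K i j))) ≡ 2 * (⟨ lo ≤? i ⟩ * sumFromTo (i + 1) n (f i))
    row i = begin
      Σ (λ j → ⟨ i <? j ⟩ * (i * c i * (j * c j * K i j))) ≡⟨ Σ-cong (λ j → trans (⟨⟩-guard (i <? j) (off-diag i j))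
            (trans (cong (_* (2 * (⟨ lo ≤? i ⟩ * f i j))) (⟨⟩-cong (subst (_≤ j) (+-comm 1 i)) (subst (_≤ j) (+-comm i 1))
              (i <? j) (i + 1 ≤? j)))
              (solve 3 (λ u l f → u :* (con 2 :* (l :* f)) := con 2 :* l :* (u :* f)) refl ⟨ i + 1 ≤? j ⟩ ⟨ lo ≤? i ⟩
                (f i j)))) ⟩
      Σ (λ j → 2 * ⟨ lo ≤? i ⟩ * (⟨ i + 1 ≤? j ⟩ * f i j)) ≡⟨ ∑-*ˡ (upTo (suc n)) (2 * ⟨ lo ≤? i ⟩) _ ⟩
      2 * ⟨ lo ≤? i ⟩ * Σ (λ j → ⟨ i + 1 ≤? j ⟩ * f i j) ≡⟨ trans (*-assoc 2 ⟨ lo ≤? i ⟩ _) (cong (λ x → 2 * (⟨ lo ≤? i ⟩ * x))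
        (sym (sumFromTo-∑ (i + 1) n (f i)))) ⟩
      2 * (⟨ lo ≤? i ⟩ * sumFromTo (i + 1) n (f i)) ∎

  cPart-22 : cPart (2 ∷ 2 ∷ []) β ≡ Z * (sumFromTo 2 n (λ i → i * (i C 2) * (c i C 2))
            + sumFromTo 2 n (λ i → sumFromTo (i + 1) n (λ j → i * (i ∸ 1) * j * c i * c j)))
  cPart-22 = *-cancelˡ-≡ _ _ 8 (begin
    8 * cPart (2 ∷ 2 ∷ []) β ≡⟨ trans weight-22 (cong (2 *_) ∑-p₂) ⟩
    2 * (∑ᶠ (λ a → ∑ᶠ (λ b → ⟨ ¬? (β.same? a b) ⟩ * crossings (β.len a) (β.len b))) * Z) ≡⟨ cong (λ x → 2 * (x * Z))
      (trans (∑-separate crossings crossings-sym) (pair-sum crossings 2 d f on-diag off-diag)) ⟩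
    2 * (4 * S * Z) ≡⟨ solve 2 (λ s z → con 2 :* (con 4 :* s :* z) := con 8 :* (z :* s)) refl S Z ⟩
    8 * (Z * S) ∎)
    where
    d : ℕ → ℕ
    d i = i * (i C 2) * (c i C 2)
    f : ℕ → ℕ → ℕ
    f i j = i * (i ∸ 1) * j * c i * c j
    S = sumFromTo 2 n d + sumFromTo 2 n (λ i → sumFromTo (i + 1) n (f i))
    -- On the diagonal the 2 comes from i * (i - 1) being twice a binomial, off it from the two
    -- values of `t` in `crossings-<`.
    on-diag : ∀ i → i * i * (c i C 2) * crossings i i ≡ 2 * (⟨ 2 ≤? i ⟩ * d i)
    on-diag i = begin
      i * i * (c i C 2) * crossings i i ≡⟨ cong (i * i * (c i C 2) *_) (crossings-diagonal i) ⟩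
      i * i * (c i C 2) * (i ∸ 1) ≡⟨ solve 3 (λ i x p → i :* i :* x :* p := i :* x :* (i :* p)) refl i (c i C 2) (i ∸ 1) ⟩
      i * (c i C 2) * (i * (i ∸ 1)) ≡⟨ cong (i * (c i C 2) *_) (C2-twice i) ⟨
      i * (c i C 2) * (2 * (i C 2)) ≡⟨ solve 3 (λ i x p → i :* x :* (con 2 :* p) := con 2 :* (i :* p :* x)) refl i (c i C 2)
        (i C 2) ⟩
      2 * d i ≡⟨ cong (2 *_) (drop-guard (2 ≤? i) (λ h → cong (_* (c i C 2)) (trans (cong (i *_) (k>n⇒nCk≡0 (≰⇒> h)))
        (*-zeroʳ i)))) ⟨
      2 * (⟨ 2 ≤? i ⟩ * d i) ∎
    off-diag : ∀ i j → i < j → i * c i * (j * c j * crossings i j) ≡ 2 * (⟨ 2 ≤? i ⟩ * f i j)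
    off-diag zero    j _   = refl
    off-diag (suc i) j i<j = begin
      suc i * c (suc i) * (j * c j * crossings (suc i) j) ≡⟨ cong (λ x → suc i * c (suc i) * (j * c j * x))
        (crossings-< (s≤s z≤n) i<j) ⟩
      suc i * c (suc i) * (j * c j * (2 * i)) ≡⟨ solve 5 (λ k x j y i → k :* x :* (j :* y :* (con 2 :* i)) := con 2 :*
        (k :* i :* j :* x :* y)) refl (suc i) (c (suc i)) j (c j) i ⟩
      2 * f (suc i) j ≡⟨ cong (2 *_) (drop-guard (2 ≤? suc i) (vanish i)) ⟨
      2 * (⟨ 2 ≤? suc i ⟩ * f (suc i) j) ∎
      where
      vanish : ∀ i → ¬ (2 ≤ suc i) → f (suc i) j ≡ 0
      vanish zero    _ = refl
      vanish (suc i) h = contradiction (s≤s (s≤s z≤n)) h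

  cPart-211 : cPart (2 ∷ 1 ∷ 1 ∷ []) β ≡ Z * (sumFromTo 1 n (λ i → i ^ 3 * c (2 * i) * (c i C 2))
            + sumFromTo 1 n (λ i → sumFromTo (i + 1) n (λ j → i * j * (i + j) * c i * c j * c (i + j))))
  cPart-211 = *-cancelˡ-≡ _ _ 8 (begin
    8 * cPart (2 ∷ 1 ∷ 1 ∷ []) β ≡⟨ trans weight-211 (cong (2 *_) ∑-p₁) ⟩
    2 * (∑ᶠ (λ x → ∑ᶠ (λ y → ⟨ ¬? (β.same? x y) ⟩ * K (β.len x) (β.len y))) * Z) ≡⟨ cong (λ x → 2 * (x * Z))
      (trans (∑-separate K K-sym) (pair-sum K 1 d f on-diag off-diag)) ⟩
    2 * (4 * S * Z) ≡⟨ solve 2 (λ s z → con 2 :* (con 4 :* s :* z) := con 8 :* (z :* s)) refl S Z ⟩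
    8 * (Z * S) ∎)
    where
    K : ℕ → ℕ → ℕ
    K i j = (i + j) * β.count (i + j) * (1 + ⟨ ¬? (i ℕ.≟ j) ⟩)
    K-sym : ∀ i j → K i j ≡ K j i
    K-sym i j = cong₂ (λ s u → s * β.count s * (1 + u)) (+-comm i j) (⟨⟩-cong (_∘ sym) (_∘ sym) (¬? (i ℕ.≟ j)) (¬? (j ℕ.≟ i)))
    d : ℕ → ℕ
    d i = i ^ 3 * c (2 * i) * (c i C 2)
    f : ℕ → ℕ → ℕ
    f i j = i * j * (i + j) * c i * c j * c (i + j)
    S = sumFromTo 1 n d + sumFromTo 1 n (λ i → sumFromTo (i + 1) n (f i))
    -- On the diagonal the 2 comes from the cycle length i + i = 2 * i, off it from the two
    -- different cuts.
    on-diag : ∀ i → i * i * (c i C 2) * K i i ≡ 2 * (⟨ 1 ≤? i ⟩ * d i)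
    on-diag i = begin
      i * i * (c i C 2) * K i i ≡⟨ cong₂ (λ x u → i * i * (c i C 2) * (x * (1 + u)))
        (cong₂ _*_ (cong (i +_) (sym (+-identityʳ i))) (trans (β.count-def (i + i))
        (cong (λ k → c (i + k)) (sym (+-identityʳ i))))) (⟨⟩-no (¬? (i ℕ.≟ i)) (λ ne → ne refl)) ⟩
      i * i * (c i C 2) * (2 * i * c (2 * i) * 1) ≡⟨ solve 3 (λ i x y → i :* i :* x :* (con 2 :* i :* y :* con 1) := con 2 :*
        (i :* (i :* (i :* con 1)) :* y :* x)) refl i (c i C 2) (c (2 * i)) ⟩
      2 * d i ≡⟨ cong (2 *_) (drop-guard (1 ≤? i) (vanish i)) ⟨
      2 * (⟨ 1 ≤? i ⟩ * d i) ∎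
      where
      vanish : ∀ i → ¬ (1 ≤ i) → d i ≡ 0
      vanish zero    _ = refl
      vanish (suc i) h = contradiction (s≤s z≤n) h
    off-diag : ∀ i j → i < j → i * c i * (j * c j * K i j) ≡ 2 * (⟨ 1 ≤? i ⟩ * f i j)
    off-diag i j i<j = begin
      i * c i * (j * c j * K i j) ≡⟨ cong₂ (λ x u → i * c i * (j * c j * ((i + j) * x * (1 + u)))) (β.count-def (i + j))
        (⟨⟩-yes (¬? (i ℕ.≟ j)) (λ e → <-irrefl e i<j)) ⟩
      i * c i * (j * c j * ((i + j) * c (i + j) * 2)) ≡⟨ solve 6 (λ i x j y s z → i :* x :* (j :* y :* (s :* z :* con 2)) := con
        2 :* (i :* j :* s :* x :* y :* z)) refl i (c i) j (c j) (i + j) (c (i + j)) ⟩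
      2 * f i j ≡⟨ cong (2 *_) (drop-guard (1 ≤? i) (vanish i)) ⟨
      2 * (⟨ 1 ≤? i ⟩ * f i j) ∎
      where
      vanish : ∀ i → ¬ (1 ≤ i) → f i j ≡ 0
      vanish zero    _ = refl
      vanish (suc i) h = contradiction (s≤s z≤n) h

theorem6 : (n : ℕ) (β : Fin n → Fin n) → Injective _≡_ _≡_ β →
  let c = cycleCount β
      Z = centralizerSize β
  in (cK 4 β ≡ cPart (4 ∷ []) β + cPart (3 ∷ 1 ∷ []) β + cPart (2 ∷ 2 ∷ []) β + cPart (2 ∷ 1 ∷ 1 ∷ []) β)
   × (cPart (4 ∷ []) β ≡ Z * sumFromTo 4 n (λ i → c i * (i C 4)))
   × (cPart (3 ∷ 1 ∷ []) β ≡ Z * sumFromTo 1 n (λ i → sumFromTo (i + 2) n (λ j → i * j * (j ∸ i ∸ 1) * c i * c j)))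
   × (cPart (2 ∷ 2 ∷ []) β ≡ Z * (sumFromTo 2 n (λ i → i * (i C 2) * (c i C 2))
                                 + sumFromTo 2 n (λ i → sumFromTo (i + 1) n (λ j → i * (i ∸ 1) * j * c i * c j))))
   × (cPart (2 ∷ 1 ∷ 1 ∷ []) β ≡ Z * (sumFromTo 1 n (λ i → i ^ 3 * c (2 * i) * (c i C 2))
                                 + sumFromTo 1 n (λ i → sumFromTo (i + 1) n (λ j → i * j * (i + j) * c i * c j * c (i + j)))))
theorem6 n β injβ = cK-cParts , cPart-4 , cPart-31 , cPart-22 , cPart-211
  where open ByLength β injβ
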